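{- Let $\mathbf{M}$ be a Markov chain with $n$ states whose transition matrix has at most $d$ non-zero entries in each row. Given an $\ell_1$ distance tester with time complexity $T(n,\epsilon,\delta)$ and gap $f$, and an oracle next_node for $\mathbf{M}$, there exists a test (taking parameters $t,\epsilon$) with the following behavior: if $\mathbf{M}$ is $(f(\epsilon),t)$-mixing then the test accepts with probability at least $2/3$; if $\mathbf{M}$ is not $(2\epsilon,1.01\epsilon)$-close to any $\widetilde{\mathbf{M}}$ which is $(4\epsilon,2t)$-mixing then the test rejects with probability at least $2/3$. The running time of the test is $O\left(\frac{1}{\epsilon^2}\cdot t^2\cdot T\left(n,\epsilon,\frac{1}{6t}\right)\right)$.
   Context: A Markov chain on $n$ states is represented by its $n\times n$ transition probability matrix $\mathbf{M}$. For a state $u$, $\mathbf{e}_u$ is the row vector with a one in position $u$ and zeros elsewhere, so $\mathbf{e}_u\mathbf{M}^t$ is the distribution of the endpoint of a $t$-step random walk started at $u$. $\|\mathbf{v}\|_1=\sum_i|v_i|$. The chain $\mathbf{M}$ is $(\epsilon,t)$-mixing if there exists a distribution $\mathbf{s}$ such that $\|\mathbf{e}_u\mathbf{M}^t-\mathbf{s}\|_1\le\epsilon$ for all states $u$. The average $t$-step distribution of $\mathbf{M}$ is $\mathbf{s}_{\mathbf{M},t}=\frac1n\sum_u\mathbf{e}_u\mathbf{M}^t$. For $n$-state Markov chains $\mathbf{M}_1,\mathbf{M}_2$ with at most $d$ non-zero entries in each row, $\Delta(\mathbf{M}_1,\mathbf{M}_2)=(\epsilon_1,\epsilon_2)$ means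 that $\mathbf{M}_1$ and $\mathbf{M}_2$ differ on $\epsilon_1 dn$ entries and $\|\mathbf{s}_{\mathbf{M}_1,t}-\mathbf{s}_{\mathbf{M}_2,t}\|_1=\epsilon_2$. They are $(\epsilon_1,\epsilon_2)$-close if $\Delta(\mathbf{M}_1,\mathbf{M}_2)\le(\epsilon_1,\epsilon_2)$ coordinatewise. Here $t$ is the parameter given to the test. The oracle next_node, on input a state $u$, responds at unit cost with a state $v$ with probability $\mathbf{M}(u,v)$ (independently across calls). An $\ell_1$ distance tester with gap $f$ and time complexity $T(n,\epsilon,\delta)$ is a randomized algorithm which, given parameters $\epsilon,\delta$ and oracle (sample) access to two distributions over the same $n$-element set, runs in time $T(n,\epsilon,\delta)$ (each sample counted at unit cost) and decides with confidence $1-\delta$ whether their $\ell_1$ distance is at most $f(\epsilon)$ (in which case it accepts) or more than $\epsilon$ (in which case it rejects).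
   Formalization: The running-time bound is stated only for ε ≤ 2 (ℓ1 distances never exceed 2; for ε→∞ the bound drops below one step), correctness for all ε > 0; numbers range over any Archimedean ordered field with decidable order, which by excluded middle includes the reals. -}

module Defs where

open import Algebra.Bundles using (CommutativeRing; Semiring)
import Algebra.Construct.NaturalChoice.Max as Max
import Algebra.Definitions.RawSemiring as RawSemiringDefinitions
open import Data.Bool using (if_then_else_)
open import Data.Empty using (⊥)
open import Data.Fin using (Fin; toℕ; fromℕ<)
import Data.Fin.Properties as Fin
open import Data.List using (List; []; _∷_; allFin; cartesianProduct; filter; length)
open import Data.Nat as ℕ using (ℕ; zero; suc; NonZero; _≡ᵇ_)
open import Data.Product using (Σ; ∃; _×_; _,_)
open import Data.Unit using (⊤)
open import Data.Vec.Functional as Vector using (Vector)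
open import Level using (_⊔_) renaming (suc to lsuc)
open import Relation.Binary.Bundles using (DecTotalOrder)
open import Relation.Binary.Core using (Rel)
import Relation.Binary.Construct.NonStrictToStrict as ToStrict
open import Relation.Binary.Definitions using (Decidable)
open import Relation.Binary.Structures using (IsDecTotalOrder)
open import Relation.Binary.PropositionalEquality using (_≡_)
open import Relation.Nullary using (¬_; Dec; yes; no; does; ¬?)

-- Probabilities, distances and the parameters ε, δ are taken in an arbitrary
-- Archimedean ordered field with decidable order. Classically these are the
-- subfields of ℝ, ℝ itself being one of them; ℚ is one constructively.

record ArchimedeanField c ℓ₁ ℓ₂ : Set (lsuc (c ⊔ ℓ₁ ⊔ ℓ₂)) where
  field
    commutativeRing : CommutativeRing c ℓ₁

  open CommutativeRing commutativeRing public
    using (Carrier; _≈_; _+_; _*_; -_; _-_; 0#; 1#; semiring)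

  infix  4 _≤_ _<?_
  infixl 7 _/_
  infix  8 _⁻¹

  open RawSemiringDefinitions (Semiring.rawSemiring semiring) public
    using (sum; _^_) renaming (_×_ to _·_)

  fromℕ : ℕ → Carrier
  fromℕ k = k · 1#

  field
    _≤_             : Rel Carrier ℓ₂
    isDecTotalOrder : IsDecTotalOrder _≈_ _≤_
    +-monoʳ-≤       : ∀ x {y z} → y ≤ z → x + y ≤ x + z
    *-nonNegative   : ∀ {x y} → 0# ≤ x → 0# ≤ y → 0# ≤ x * y
    -- The value of 0# ⁻¹ is unconstrained.
    _⁻¹             : Carrier → Carrier
    ⁻¹-cong         : ∀ {x y} → x ≈ y → x ⁻¹ ≈ y ⁻¹
    ⁻¹-inverseʳ     : ∀ {x} → ¬ x ≈ 0# → x * x ⁻¹ ≈ 1#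
    1≉0             : ¬ 1# ≈ 0#
    archimedean     : ∀ x → ∃ λ k → x ≤ fromℕ k

  decTotalOrder : DecTotalOrder c ℓ₁ ℓ₂
  decTotalOrder = record { isDecTotalOrder = isDecTotalOrder }

  open DecTotalOrder decTotalOrder public using (_≟_; _≤?_; totalOrder)
  open ToStrict _≈_ _≤_ public using (_<_)
  open Max totalOrder public using () renaming (_⊔_ to max)

  _<?_ : Decidable _<_
  _<?_ = ToStrict.<-decidable _≈_ _≤_ _≟_ _≤?_

  _/_ : Carrier → Carrier → Carrier
  x / y = x * y ⁻¹

  ∣_∣ : Carrier → Carrier
  ∣ x ∣ = max x (- x)

-- Programs run on a random access machine that computes with natural numbers
-- and with field elements at unit cost. A name denotes an array of naturals
-- or of field elements (the two name spaces are separate); the scalar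
-- variable x is cell 0 of the array x. Programs contain no field constants,
-- so one program serves all values of the parameters.

Name : Set
Name = ℕ

data Arithmetic : Set where
  add subtract multiply divide : Arithmetic

infixr 5 _⨾_

data Command : Set where
  skip            : Command
  _⨾_             : Command → Command → Command
  ifNonZero       : Name → Command → Command → Command
  whileNonZero    : Name → Command → Command
  constant        : (x : Name) (k : ℕ) → Command
  natOp numOp     : Arithmetic → (x y z : Name) → Command
  natLess numLess : (x y z : Name) → Command
  embed           : (x y : Name) → Command
  -- x := a[y]; the index y is always a natural number
  natLoad numLoad : (x a y : Name) → Command
  -- a[y] := x
  natStore numStore : (a y x : Name) → Command
  -- x := answer of the oracle to the query y; no effect if y is not a query
  sample          : (x y : Name) → Command
  -- x := uniformly random element of {0, …, y - 1}; no effect if y = 0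
  uniform         : (x y : Name) → Command

-- Naturals: on entry the number of states n and, for chain tests, the number
-- of steps t; on exit the decision, any nonzero value meaning acceptance.
size steps verdict : Name
size    = 0
steps   = 1
verdict = 2

-- Field elements: ε and, for distance testers, the allowed error δ.
accuracy failure : Name
accuracy = 0
failure  = 1

data Verdict : Set where
  accept reject : Verdict

module Testing {c ℓ₁ ℓ₂} (F : ArchimedeanField c ℓ₁ ℓ₂) where

  open ArchimedeanField F

  Memory : ∀ {a} → Set a → Set a
  Memory A = Name → ℕ → A

  write : ∀ {a} {A : Set a} → Name → ℕ → A → Memory A → Memory A
  write x i v μ y j =
    if x ≡ᵇ y then (if i ≡ᵇ j then v else μ y j) else μ y j

  record Store : Set c where
    constructor store
    field
      nats : Memory ℕ
      nums : Memory Carrier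

  open Store public

  setNat : Name → ℕ → ℕ → Store → Store
  setNat x i v s = record s { nats = write x i v (nats s) }

  setNum : Name → ℕ → Carrier → Store → Store
  setNum x i v s = record s { nums = write x i v (nums s) }

  nat : Store → Name → ℕ
  nat s x = nats s x 0

  num : Store → Name → Carrier
  num s x = nums s x 0

  natArithmetic : Arithmetic → ℕ → ℕ → ℕ
  natArithmetic add      k l       = k ℕ.+ l
  natArithmetic subtract k l       = k ℕ.∸ l
  natArithmetic multiply k l       = k ℕ.* l
  natArithmetic divide   k zero    = 0
  natArithmetic divide   k (suc l) = k ℕ./ suc l

  numArithmetic : Arithmetic → Carrier → Carrier → Carrier
  numArithmetic add      x y = x + y
  numArithmetic subtract x y = x - y
  numArithmetic multiply x y = x * y
  numArithmetic divide   x y = x / y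

  truth : ∀ {p} {P : Set p} → Dec P → ℕ
  truth P? = if does P? then 1 else 0

  Configuration : Set c
  Configuration = List Command × Store

  -- The oracle has m queries and n answers.
  data Next (m n : ℕ) : Set c where
    halted : Verdict → Next m n
    goto   : Configuration → Next m n
    ask    : Fin m → (Fin n → Configuration) → Next m n
    toss   : ∀ k → (Fin (suc k) → Configuration) → Next m n

  decision : ℕ → Verdict
  decision zero    = reject
  decision (suc _) = accept

  next : ∀ {m n} → Configuration → Next m n
  next ([] , s) = halted (decision (nat s verdict))
  next (skip ∷ K , s) = goto (K , s)
  next ((C ⨾ D) ∷ K , s) = goto (C ∷ D ∷ K , s)
  next (ifNonZero x C D ∷ K , s) with nat s x
  ... | zero  = goto (D ∷ K , s)
  ... | suc _ = goto (C ∷ K , s)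
  next (whileNonZero x C ∷ K , s) with nat s x
  ... | zero  = goto (K , s)
  ... | suc _ = goto (C ∷ whileNonZero x C ∷ K , s)
  next (constant x k ∷ K , s) = goto (K , setNat x 0 k s)
  next (natOp o x y z ∷ K , s) =
    goto (K , setNat x 0 (natArithmetic o (nat s y) (nat s z)) s)
  next (numOp o x y z ∷ K , s) =
    goto (K , setNum x 0 (numArithmetic o (num s y) (num s z)) s)
  next (natLess x y z ∷ K , s) =
    goto (K , setNat x 0 (truth (nat s y ℕ.<? nat s z)) s)
  next (numLess x y z ∷ K , s) =
    goto (K , setNat x 0 (truth (num s y <? num s z)) s)
  next (embed x y ∷ K , s) = goto (K , setNum x 0 (fromℕ (nat s y)) s)
  next (natLoad x a y ∷ K , s) =
    goto (K , setNat x 0 (nats s a (nat s y)) s)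
  next (numLoad x a y ∷ K , s) =
    goto (K , setNum x 0 (nums s a (nat s y)) s)
  next (natStore a y x ∷ K , s) = goto (K , setNat a (nat s y) (nat s x) s)
  next (numStore a y x ∷ K , s) = goto (K , setNum a (nat s y) (num s x) s)
  next {m} (sample x y ∷ K , s) with nat s y ℕ.<? m
  ... | yes y<m = ask (fromℕ< y<m) λ v → K , setNat x 0 (toℕ v) s
  ... | no  _   = goto (K , s)
  next (uniform x y ∷ K , s) with nat s y
  ... | zero  = goto (K , s)
  ... | suc k = toss k λ i → K , setNat x 0 (toℕ i) s

  -- HaltsWithin m n k C: whatever the random choices and oracle answers, the
  -- machine stops within k steps. Stopping is itself a step, and every oracle
  -- call costs one step.
  mutual
    HaltsWithin : (m n k : ℕ) → Configuration → Set
    HaltsWithin m n zero    C = ⊥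
    HaltsWithin m n (suc k) C = HaltsAfter m n k (next C)

    HaltsAfter : (m n k : ℕ) → Next m n → Set
    HaltsAfter m n k (halted _) = ⊤
    HaltsAfter m n k (goto C)   = HaltsWithin m n k C
    HaltsAfter m n k (ask _ C)  = ∀ v → HaltsWithin m n k (C v)
    HaltsAfter m n k (toss _ C) = ∀ i → HaltsWithin m n k (C i)

  -- The oracle answers the query q with v with probability O q v,
  -- independently across calls.
  Oracle : (m n : ℕ) → Set c
  Oracle m n = Fin m → Vector Carrier n

  indicator : Verdict → Verdict → Carrier
  indicator accept accept = 1#
  indicator reject reject = 1#
  indicator _      _      = 0#

  -- Pr O w k C: the probability that C stops within k steps with verdict w.
  mutual
    Pr : ∀ {m n} → Oracle m n → Verdict → ℕ → Configuration → Carrier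
    Pr O w zero    C = 0#
    Pr O w (suc k) C = PrAfter O w k (next C)

    PrAfter : ∀ {m n} → Oracle m n → Verdict → ℕ → Next m n → Carrier
    PrAfter O w k (halted w′) = indicator w w′
    PrAfter O w k (goto C)    = Pr O w k C
    PrAfter O w k (ask q C)   = sum λ v → O q v * Pr O w k (C v)
    PrAfter O w k (toss j C)  = sum λ i → (1# / fromℕ (suc j)) * Pr O w k (C i)

  blank : Store
  blank = store (λ _ _ → 0) (λ _ _ → 0#)

  ∥_∥₁ : ∀ {n} → Vector Carrier n → Carrier
  ∥ v ∥₁ = sum λ i → ∣ v i ∣

  distance : ∀ {n} → Vector Carrier n → Vector Carrier n → Carrier
  distance p q = ∥ (λ i → p i - q i) ∥₁

  record IsDistribution {n} (p : Vector Carrier n) : Set (ℓ₁ ⊔ ℓ₂) where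
    field
      nonNegative : ∀ i → 0# ≤ p i
      total       : sum p ≈ 1#

  Matrix : ℕ → Set c
  Matrix n = Fin n → Fin n → Carrier

  unit : ∀ {n} → Fin n → Vector Carrier n
  unit u i = if does (u Fin.≟ i) then 1# else 0#

  identity : ∀ {n} → Matrix n
  identity = unit

  infixl 7 _⊗_ _⊛_

  _⊗_ : ∀ {n} → Matrix n → Matrix n → Matrix n
  (A ⊗ B) i j = sum λ k → A i k * B k j

  _⊛_ : ∀ {n} → Vector Carrier n → Matrix n → Vector Carrier n
  (v ⊛ A) j = sum λ i → v i * A i j

  power : ∀ {n} → Matrix n → ℕ → Matrix n
  power A zero    = identity
  power A (suc t) = A ⊗ power A t

  nonZeroEntries : ∀ {n} → Vector Carrier n → ℕ
  nonZeroEntries {n} v = length (filter (λ i → ¬? (v i ≟ 0#)) (allFin n))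

  record MarkovChain (n d : ℕ) : Set (c ⊔ ℓ₁ ⊔ ℓ₂) where
    field
      matrix     : Matrix n
      stochastic : ∀ u → IsDistribution (matrix u)
      sparse     : ∀ u → nonZeroEntries (matrix u) ℕ.≤ d

  open MarkovChain public

  -- The distribution e_u M^t of the endpoint of a t-step walk from u.
  walk : ∀ {n d} → MarkovChain n d → ℕ → Fin n → Vector Carrier n
  walk M t u = unit u ⊛ power (matrix M) t

  Mixing : ∀ {n d} → MarkovChain n d → Carrier → ℕ → Set (c ⊔ ℓ₁ ⊔ ℓ₂)
  Mixing {n} M ε t =
    Σ (Vector Carrier n) λ s →
      IsDistribution s × (∀ u → distance (walk M t u) s ≤ ε)

  average : ∀ {n d} → MarkovChain n d → ℕ → Vector Carrier n
  average {n} M t i = (1# / fromℕ n) * sum λ u → walk M t u i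

  differingEntries : ∀ {n} → Matrix n → Matrix n → ℕ
  differingEntries {n} A B =
    length (filter (λ (i , j) → ¬? (A i j ≟ B i j))
                   (cartesianProduct (allFin n) (allFin n)))

  -- Δ t M₁ M₂ ε₁ ε₂ is the relation "Δ(M₁, M₂) = (ε₁, ε₂)".
  Δ : ℕ → ∀ {n d} → MarkovChain n d → MarkovChain n d →
      Carrier → Carrier → Set ℓ₁
  Δ t {n} {d} M₁ M₂ ε₁ ε₂ =
    (fromℕ (differingEntries (matrix M₁) (matrix M₂))
       ≈ ε₁ * fromℕ d * fromℕ n)
    × (distance (average M₁ t) (average M₂ t) ≈ ε₂)

  Close : ℕ → ∀ {n d} → MarkovChain n d → MarkovChain n d →
          Carrier → Carrier → Set (c ⊔ ℓ₁ ⊔ ℓ₂)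
  Close t M₁ M₂ ε₁ ε₂ =
    Σ Carrier λ η₁ → Σ Carrier λ η₂ →
      Δ t M₁ M₂ η₁ η₂ × η₁ ≤ ε₁ × η₂ ≤ ε₂

  -- Query 0 samples from the first distribution and query 1 from the second.
  pair : ∀ {n} → Vector Carrier n → Vector Carrier n → Oracle 2 n
  pair p q = p Vector.∷ q Vector.∷ Vector.[]

  testerStart : Command → (n : ℕ) (ε δ : Carrier) → Configuration
  testerStart P n ε δ =
    P ∷ [] , setNat size 0 n (setNum accuracy 0 ε (setNum failure 0 δ blank))

  record IsDistanceTester
    (P : Command)
    (f : Carrier → Carrier)
    (T : ℕ → Carrier → Carrier → ℕ) : Set (c ⊔ ℓ₁ ⊔ ℓ₂) where
    field
      f-cong : ∀ {ε ε′} → ε ≈ ε′ → f ε ≈ f ε′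
      T-cong : ∀ n {ε ε′ δ δ′} → ε ≈ ε′ → δ ≈ δ′ → T n ε δ ≡ T n ε′ δ′

      halts : ∀ n .{{_ : NonZero n}} ε δ → 0# < ε → 0# < δ → δ < 1# →
              HaltsWithin 2 n (T n ε δ) (testerStart P n ε δ)

      accepts : ∀ n .{{_ : NonZero n}} ε δ → 0# < ε → 0# < δ → δ < 1# →
                ∀ (p q : Vector Carrier n) →
                IsDistribution p → IsDistribution q →
                distance p q ≤ f ε →
                1# - δ ≤ Pr (pair p q) accept (T n ε δ) (testerStart P n ε δ)

      rejects : ∀ n .{{_ : NonZero n}} ε δ → 0# < ε → 0# < δ → δ < 1# →
                ∀ (p q : Vector Carrier n) →
                IsDistribution p → IsDistribution q →
                ε < distance p q →
                1# - δ ≤ Pr (pair p q) reject (T n ε δ) (testerStart P n ε δ)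

  -- The oracle next_node: the query u is answered with a successor of u.
  nextNode : ∀ {n d} → MarkovChain n d → Oracle n n
  nextNode = matrix

  testStart : Command → (n t : ℕ) (ε : Carrier) → Configuration
  testStart Q n t ε =
    Q ∷ [] , setNat size 0 n (setNat steps 0 t (setNum accuracy 0 ε blank))

module Submission where

-- The test. Call s the average t-step distribution. A state u is bad when the
-- even mixture of s with the t-step distribution of u is further than ε from
-- s, that is, when the distribution itself is further than 2ε from s. The test
-- walks for 2t steps from each of about 8 / ε² uniform states, and has the
-- distance tester compare the mixture with s in each of the 2t + 1 states met.
-- The mixture is compared rather than the distribution itself because, when
-- all walks end within φ of some distribution, they are only known to end
-- within 2φ of s; the mixture is then within φ of s (mixing⇒probe-near).
--
-- The tester may err with probability 1 / (6t), so that its verdicts have to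
-- be amplified, with only a constant number of runs per state to spare. A
-- state is cleared as soon as one more of its runs has accepted than rejected,
-- and the test rejects when 20 runs for each state to be met do not suffice.
-- If the mixtures are within f(ε) of s then the number L of clearances still
-- needed goes down with probability at least 5/6 in each run, 2 to the power L
-- shrinks at least by the factor 3/4 on average, and the budget suffices with
-- high probability (accepting). A bad state, on the other hand, is ever cleared
-- with probability at most 1/2, whatever the budget; so if a walk of 2t steps
-- from a uniform state meets a bad state with probability q, called the risk,
-- then the test accepts with probability at most (1 - q / 2) to the power of
-- the number of rounds, which is small when 2q is at least ε² (rejecting).
--
-- It remains to see that 2q ≥ ε² when no mixing chain is close to the given
-- one (far⇒risky). For ε ≥ 1 the given chain itself is mixing. For ε ≤ 1
-- suppose that 2q ≤ ε², let w be a state whose walk of 2t steps is the least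
-- likely to meet a bad state, and redirect the bad states: let each move as w
-- does. At most a fraction q of the rows change, and the average distribution
-- moves by at most 2q. The redirected chain is within 4ε of s after 2t steps
-- from any state u (redirected-mixing):
--   * When a bad state is met at a time r ≤ t, the walk goes on as one from w
--     with at least t steps left. That walk avoids the bad states except with
--     probability at most q, and then its last t steps start in a good state,
--     so that it ends within 2ε + 2q of s (distance≤hit).
--   * Otherwise the state at time t is good, and its walk ends within 2ε of s
--     unless it meets a bad state. As u is good the distribution at time t is
--     within ε of s in total variation, and from s bad states are met within t
--     steps with probability at most q, so that this happens with probability
--     at most ε + q, at an additional cost of at most 2 - 2ε.
-- This adds up to 2ε + 2q + ε (2 - 2ε) + 2q = 4ε - 2ε² + 4q ≤ 4ε. The term of
-- second order is what pays for q.
--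
-- The program. The tester is an arbitrary program, and is simulated command by
-- command (simulates); a simulated oracle call walks through the chain. Each
-- run uses an array region of its own, indexed by the remaining budget, so
-- that it finds a blank memory. The real machine is related to the process
-- just described (value, advance) by lower bounds on the probabilities of the
-- two verdicts (Yields), which are propagated backwards through the program.

open import Defs
open import Algebra.Bundles using (CommutativeRing)
import Algebra.Construct.NaturalChoice.Max as Max
import Algebra.Construct.NaturalChoice.Min as Min
import Algebra.Properties.CommutativeSemiring.Exp as ExpProperties
import Algebra.Properties.Ring as RingProperties
import Algebra.Properties.Semiring.Mult as MultProperties
import Algebra.Properties.Semiring.Sum as SumProperties
import Algebra.Solver.Ring as RingSolver
open import Algebra.Solver.Ring.AlmostCommutativeRing using (fromCommutativeRing; _-Raw-AlmostCommutative⟶_)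
open import Data.Bool using (true; false; if_then_else_; T)
open import Data.Empty using (⊥)
open import Data.Fin using (Fin; zero; suc; toℕ)
import Data.Fin.Properties as Fin
open import Data.Integer as ℤ using (ℤ; +_; -[1+_]; _⊖_)
import Data.Integer.Properties as ℤ
open import Data.List using (List; []; _∷_; _++_; map; filter; length; tabulate; allFin; cartesianProduct)
import Data.List.Properties as List
open import Data.Maybe using (Maybe; nothing; just)
open import Data.Nat as ℕ using (ℕ; zero; suc; NonZero; _≡ᵇ_)
open import Data.Nat.DivMod using (m<n⇒m%n≡m; [m+kn]%n≡m%n; _%_)
import Data.Nat.Properties as ℕ
open import Data.Nat.Tactic.RingSolver using (solve-∀)
open import Data.Product using (Σ; ∃; _×_; _,_; proj₁; proj₂)
open import Data.Sum using (_⊎_; inj₁; inj₂; [_,_])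
open import Data.Unit using (tt)
open import Data.Vec.Functional as Vector using (Vector)
open import Function.Bundles using (mk⇔)
open import Level using (Lift)
open import Relation.Binary.Bundles using (DecTotalOrder)
import Relation.Binary.Construct.NonStrictToStrict as ToStrict
open import Relation.Binary.PropositionalEquality as ≡ using (_≡_; _≢_)
open import Relation.Nullary using (¬_; Dec; yes; no; does; ¬?; contradiction)
open import Relation.Nullary.Decidable using (does-⇔; dec-false)
open import Relation.Unary using (Decidable)


-- Ordered fields

module OrderedField {c ℓ₁ ℓ₂} (F : ArchimedeanField c ℓ₁ ℓ₂) where

  open ArchimedeanField F public
  open CommutativeRing commutativeRing public
    using ( refl; sym; trans; reflexive; setoid; ring
          ; +-cong; +-congˡ; +-congʳ; +-assoc; +-comm; +-identityˡ; +-identityʳ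
          ; -‿inverseˡ; -‿inverseʳ; -‿cong
          ; *-cong; *-congˡ; *-congʳ; *-assoc; *-comm; *-identityˡ; *-identityʳ
          ; zeroˡ; zeroʳ; distribˡ; distribʳ)
  open RingProperties ring public using (-‿distribˡ-*; -‿distribʳ-*; -0#≈0#; -‿anti-homo-+; -‿involutive)
  open MultProperties semiring using (×-homo-+; ×1-homo-*)
  private module MaxP = Max totalOrder
  open DecTotalOrder decTotalOrder public
    using (poset) renaming
      (refl to ≤-refl; trans to ≤-trans; reflexive to ≤-reflexive; antisym to ≤-antisym; total to ≤-total)
  open import Relation.Binary.Reasoning.PartialOrder poset public
    using (begin_; begin-equality_; step-≤; step-≈-⟩; step-≈-⟨; step-≡-⟩; step-≡-∣; _∎)

  -- Integers as elements of the field, the coefficients of the ring solver.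

  fromℕ-+ : ∀ m n → fromℕ (m ℕ.+ n) ≈ fromℕ m + fromℕ n
  fromℕ-+ m n = ×-homo-+ 1# m n

  fromℕ-* : ∀ m n → fromℕ (m ℕ.* n) ≈ fromℕ m * fromℕ n
  fromℕ-* m n = ×1-homo-* m n

  private
    -- The number 1 denotes 1# itself and not fromℕ 1, which unfolds to
    -- 1# + 0#.
    ⟦_⟧ℕ : ℕ → Carrier
    ⟦ 1 ⟧ℕ = 1#
    ⟦ n ⟧ℕ = fromℕ n

    ⟦_⟧ℤ : ℤ → Carrier
    ⟦ + n ⟧ℤ      = ⟦ n ⟧ℕ
    ⟦ -[1+ n ] ⟧ℤ = - fromℕ (suc n)

    ⟦⟧ℕ≈fromℕ : ∀ n → ⟦ n ⟧ℕ ≈ fromℕ n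
    ⟦⟧ℕ≈fromℕ 0             = refl
    ⟦⟧ℕ≈fromℕ 1             = sym (+-identityʳ 1#)
    ⟦⟧ℕ≈fromℕ (suc (suc n)) = refl

    cancel : ∀ x y z → (x + y) - (x + z) ≈ y - z
    cancel x y z =
      trans (+-congˡ (-‿anti-homo-+ x z))
      (trans (+-assoc x y _)
      (trans (+-comm x _)
      (trans (+-assoc y _ x)
      (+-congˡ (trans (+-assoc (- z) (- x) x)
               (trans (+-congˡ (-‿inverseˡ x)) (+-identityʳ (- z))))))))

    ⊖-homo : ∀ m n → ⟦ m ⊖ n ⟧ℤ ≈ fromℕ m - fromℕ n
    ⊖-homo m zero =
      trans (⟦⟧ℕ≈fromℕ m)
            (sym (trans (+-congˡ -0#≈0#) (+-identityʳ _)))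
    ⊖-homo zero (suc n) = sym (+-identityˡ _)
    ⊖-homo (suc m) (suc n) =
      trans (reflexive (≡.cong ⟦_⟧ℤ (ℤ.[1+m]⊖[1+n]≡m⊖n m n)))
      (trans (⊖-homo m n) (sym (cancel 1# (fromℕ m) (fromℕ n))))

    -⟦⟧ : ∀ i → ⟦ ℤ.- i ⟧ℤ ≈ - ⟦ i ⟧ℤ
    -⟦⟧ (+ 0)           = sym -0#≈0#
    -⟦⟧ (+ 1)           = -‿cong (+-identityʳ 1#)
    -⟦⟧ (+ suc (suc n)) = refl
    -⟦⟧ -[1+ n ]        = trans (⟦⟧ℕ≈fromℕ (suc n)) (sym (-‿involutive _))

    +-homo : ∀ i j → ⟦ i ℤ.+ j ⟧ℤ ≈ ⟦ i ⟧ℤ + ⟦ j ⟧ℤ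
    +-homo (+ m) (+ n) =
      trans (⟦⟧ℕ≈fromℕ (m ℕ.+ n))
      (trans (fromℕ-+ m n)
             (+-cong (sym (⟦⟧ℕ≈fromℕ m)) (sym (⟦⟧ℕ≈fromℕ n))))
    +-homo (+ m) -[1+ n ] =
      trans (⊖-homo m (suc n)) (+-congʳ (sym (⟦⟧ℕ≈fromℕ m)))
    +-homo -[1+ m ] (+ n) =
      trans (⊖-homo n (suc m))
      (trans (+-comm _ _) (+-congˡ (sym (⟦⟧ℕ≈fromℕ n))))
    +-homo -[1+ m ] -[1+ n ] =
      trans (-‿cong (trans (reflexive (≡.cong fromℕ
                      (≡.cong suc (≡.trans (≡.cong suc (ℕ.+-comm m n)) (≡.sym (ℕ.+-suc n m))))))
                    (fromℕ-+ (suc n) (suc m))))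
            (-‿anti-homo-+ _ _)

    *-homo-+ : ∀ m n → ⟦ (+ m) ℤ.* (+ n) ⟧ℤ ≈ fromℕ m * fromℕ n
    *-homo-+ m n =
      trans (reflexive (≡.cong ⟦_⟧ℤ (≡.sym (ℤ.pos-* m n))))
      (trans (⟦⟧ℕ≈fromℕ (m ℕ.* n)) (fromℕ-* m n))

    *-homo : ∀ i j → ⟦ i ℤ.* j ⟧ℤ ≈ ⟦ i ⟧ℤ * ⟦ j ⟧ℤ
    *-homo (+ m) (+ n) =
      trans (*-homo-+ m n) (*-cong (sym (⟦⟧ℕ≈fromℕ m)) (sym (⟦⟧ℕ≈fromℕ n)))
    *-homo (+ m) -[1+ n ] =
      trans (reflexive (≡.cong ⟦_⟧ℤ (≡.sym (ℤ.neg-distribʳ-* (+ m) (+ suc n)))))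
      (trans (-⟦⟧ ((+ m) ℤ.* (+ suc n)))
      (trans (-‿cong (*-homo-+ m (suc n)))
      (trans (-‿distribʳ-* _ _) (*-congʳ (sym (⟦⟧ℕ≈fromℕ m))))))
    *-homo -[1+ m ] (+ n) =
      trans (reflexive (≡.cong ⟦_⟧ℤ (≡.sym (ℤ.neg-distribˡ-* (+ suc m) (+ n)))))
      (trans (-⟦⟧ ((+ suc m) ℤ.* (+ n)))
      (trans (-‿cong (*-homo-+ (suc m) n))
      (trans (-‿distribˡ-* _ _) (*-congˡ (sym (⟦⟧ℕ≈fromℕ n))))))
    *-homo -[1+ m ] -[1+ n ] =
      trans (*-homo-+ (suc m) (suc n))
      (trans (sym (-‿involutive _))
      (trans (-‿cong (-‿distribˡ-* _ _)) (-‿distribʳ-* _ _)))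

    integers : ℤ.+-*-rawRing -Raw-AlmostCommutative⟶ fromCommutativeRing commutativeRing
    integers = record
      { ⟦_⟧    = ⟦_⟧ℤ
      ; +-homo = +-homo
      ; *-homo = *-homo
      ; -‿homo = -⟦⟧
      ; 0-homo = refl
      ; 1-homo = refl
      }

    decide : ∀ i j → Maybe (⟦ i ⟧ℤ ≈ ⟦ j ⟧ℤ)
    decide i j with i ℤ.≟ j
    ... | yes i≡j = just (reflexive (≡.cong ⟦_⟧ℤ i≡j))
    ... | no  _   = nothing

  open RingSolver ℤ.+-*-rawRing (fromCommutativeRing commutativeRing) integers decide public
    using (solve; _:=_; _:+_; _:*_; _:-_; :-_; con)

  -- Order

  ≤-respʳ : ∀ {x y z} → y ≈ z → x ≤ y → x ≤ z
  ≤-respʳ y≈z x≤y = ≤-trans x≤y (≤-reflexive y≈z)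

  ≤-respˡ : ∀ {x y z} → x ≈ y → x ≤ z → y ≤ z
  ≤-respˡ x≈y x≤z = ≤-trans (≤-reflexive (sym x≈y)) x≤z

  <⇒≤ : ∀ {x y} → x < y → x ≤ y
  <⇒≤ = proj₁

  ≮⇒≥ : ∀ {x y} → ¬ x < y → y ≤ x
  ≮⇒≥ = ToStrict.≮⇒≥ _≈_ _≤_ sym _≟_ ≤-reflexive ≤-total

  ≰⇒> : ∀ {x y} → ¬ x ≤ y → y < x
  ≰⇒> = ToStrict.≰⇒> _≈_ _≤_ sym ≤-reflexive ≤-total

  <⇒≱ : ∀ {x y} → x < y → ¬ y ≤ x
  <⇒≱ = ToStrict.<⇒≱ _≈_ _≤_ ≤-antisym

  <-≤-trans : ∀ {x y z} → x < y → y ≤ z → x < z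
  <-≤-trans = ToStrict.<-≤-trans _≈_ _≤_ sym ≤-trans ≤-antisym (λ y≈z x≤y → ≤-respʳ y≈z x≤y)

  +-mono-≤ : ∀ {u v x y} → u ≤ v → x ≤ y → u + x ≤ v + y
  +-mono-≤ {u} {v} {x} {y} u≤v x≤y = begin
    u + x ≈⟨ +-comm u x ⟩
    x + u ≤⟨ +-monoʳ-≤ x u≤v ⟩
    x + v ≈⟨ +-comm x v ⟩
    v + x ≤⟨ +-monoʳ-≤ v x≤y ⟩
    v + y ∎

  +-nonNegative : ∀ {x y} → 0# ≤ x → 0# ≤ y → 0# ≤ x + y
  +-nonNegative 0≤x 0≤y = ≤-respˡ (+-identityˡ 0#) (+-mono-≤ 0≤x 0≤y)

  ≤⇒0≤- : ∀ {x y} → x ≤ y → 0# ≤ y - x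
  ≤⇒0≤- {x} {y} x≤y = begin
    0#    ≈⟨ -‿inverseˡ x ⟨
    - x + x ≤⟨ +-monoʳ-≤ (- x) x≤y ⟩
    - x + y ≈⟨ +-comm (- x) y ⟩
    y - x ∎

  -- Certificate for an inequality: the difference is a nonnegative number.
  ≤-by : ∀ {x y} d → 0# ≤ d → y ≈ x + d → x ≤ y
  ≤-by {x} {y} d 0≤d y≈x+d = begin
    x      ≈⟨ +-identityʳ x ⟨
    x + 0# ≤⟨ +-monoʳ-≤ x 0≤d ⟩
    x + d  ≈⟨ y≈x+d ⟨
    y      ∎

  0≤-⇒≤ : ∀ {x y} → 0# ≤ y - x → x ≤ y
  0≤-⇒≤ {x} {y} 0≤y-x = ≤-by (y - x) 0≤y-x (solve 2 (λ x y → y := x :+ (y :- x)) refl x y)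

  neg-mono-≤ : ∀ {x y} → x ≤ y → - y ≤ - x
  neg-mono-≤ {x} {y} x≤y =
    ≤-by (y - x) (≤⇒0≤- x≤y) (solve 2 (λ x y → :- x := :- y :+ (y :- x)) refl x y)

  minus-monoʳ-≤ : ∀ x {y z} → y ≤ z → x - z ≤ x - y
  minus-monoʳ-≤ x y≤z = +-monoʳ-≤ x (neg-mono-≤ y≤z)

  *-monoʳ-≤ : ∀ {x y z} → 0# ≤ x → y ≤ z → x * y ≤ x * z
  *-monoʳ-≤ {x} {y} {z} 0≤x y≤z =
    ≤-by (x * (z - y)) (*-nonNegative 0≤x (≤⇒0≤- y≤z))
         (solve 3 (λ x y z → x :* z := x :* y :+ x :* (z :- y)) refl x y z)

  *-monoˡ-≤ : ∀ {x y z} → 0# ≤ x → y ≤ z → y * x ≤ z * x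
  *-monoˡ-≤ {x} {y} {z} 0≤x y≤z =
    ≤-respˡ (*-comm x y) (≤-respʳ (*-comm x z) (*-monoʳ-≤ 0≤x y≤z))

  *-mono-≤ : ∀ {u v x y} → 0# ≤ u → 0# ≤ y → u ≤ v → x ≤ y → u * x ≤ v * y
  *-mono-≤ 0≤u 0≤y u≤v x≤y = ≤-trans (*-monoʳ-≤ 0≤u x≤y) (*-monoˡ-≤ 0≤y u≤v)

  0≤1 : 0# ≤ 1#
  0≤1 with ≤-total 0# 1#
  ... | inj₁ 0≤1 = 0≤1
  ... | inj₂ 1≤0 = begin
    0#            ≤⟨ *-nonNegative 0≤-1 0≤-1 ⟩
    - 1# * - 1#   ≈⟨ solve 0 (:- con (+ 1) :* :- con (+ 1) := con (+ 1)) refl ⟩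
    1#            ∎
    where
    0≤-1 : 0# ≤ - 1#
    0≤-1 = ≤-respˡ -0#≈0# (neg-mono-≤ 1≤0)

  0<1 : 0# < 1#
  0<1 = 0≤1 , λ 0≈1 → 1≉0 (sym 0≈1)

  fromℕ-nonNegative : ∀ n → 0# ≤ fromℕ n
  fromℕ-nonNegative zero    = ≤-refl
  fromℕ-nonNegative (suc n) = +-nonNegative 0≤1 (fromℕ-nonNegative n)

  fromℕ-mono-≤ : ∀ {m n} → m ℕ.≤ n → fromℕ m ≤ fromℕ n
  fromℕ-mono-≤ {n = n} ℕ.z≤n = fromℕ-nonNegative n
  fromℕ-mono-≤ (ℕ.s≤s m≤n)   = +-monoʳ-≤ 1# (fromℕ-mono-≤ m≤n)

  fromℕ-1 : fromℕ 1 ≈ 1#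
  fromℕ-1 = +-identityʳ 1#

  1≤fromℕ : ∀ {n} → 1 ℕ.≤ n → 1# ≤ fromℕ n
  1≤fromℕ {n} 1≤n = ≤-respˡ fromℕ-1 (fromℕ-mono-≤ {1} {n} 1≤n)

  fromℕ-positive : ∀ n .{{_ : NonZero n}} → 0# < fromℕ n
  fromℕ-positive (suc n) = <-≤-trans 0<1 (1≤fromℕ {suc n} (ℕ.s≤s ℕ.z≤n))

  positive⇒≉0 : ∀ {x} → 0# < x → ¬ x ≈ 0#
  positive⇒≉0 (_ , 0≉x) x≈0 = 0≉x (sym x≈0)

  fromℕ≉0 : ∀ n .{{_ : NonZero n}} → ¬ fromℕ n ≈ 0#
  fromℕ≉0 n = positive⇒≉0 (fromℕ-positive n)

  ⁻¹-inverseˡ : ∀ {x} → 0# < x → x ⁻¹ * x ≈ 1#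
  ⁻¹-inverseˡ {x} 0<x = trans (*-comm (x ⁻¹) x) (⁻¹-inverseʳ (positive⇒≉0 0<x))

  *-cancelˡ-≤ : ∀ {x y z} → 0# < x → x * y ≤ x * z → y ≤ z
  *-cancelˡ-≤ {x} {y} {z} 0<x xy≤xz with ≤-total y z
  ... | inj₁ y≤z = y≤z
  ... | inj₂ z≤y = ≤-reflexive (begin-equality
    y                ≈⟨ *-identityˡ y ⟨
    1# * y           ≈⟨ *-congʳ (⁻¹-inverseˡ 0<x) ⟨
    x ⁻¹ * x * y     ≈⟨ *-assoc _ _ _ ⟩
    x ⁻¹ * (x * y)   ≈⟨ *-congˡ (≤-antisym xy≤xz (*-monoʳ-≤ (<⇒≤ 0<x) z≤y)) ⟩
    x ⁻¹ * (x * z)   ≈⟨ *-assoc _ _ _ ⟨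
    x ⁻¹ * x * z     ≈⟨ *-congʳ (⁻¹-inverseˡ 0<x) ⟩
    1# * z           ≈⟨ *-identityˡ z ⟩
    z                ∎)

  *-positive : ∀ {x y} → 0# < x → 0# < y → 0# < x * y
  *-positive {x} {y} 0<x 0<y =
    *-nonNegative (<⇒≤ 0<x) (<⇒≤ 0<y) , λ 0≈xy → <⇒≱ 0<y
      (*-cancelˡ-≤ 0<x (≤-reflexive (trans (sym 0≈xy) (sym (zeroʳ x)))))

  ⁻¹-nonNegative : ∀ {x} → 0# < x → 0# ≤ x ⁻¹
  ⁻¹-nonNegative {x} 0<x = *-cancelˡ-≤ 0<x (begin
    x * 0#   ≈⟨ zeroʳ x ⟩
    0#       ≤⟨ 0≤1 ⟩
    1#       ≈⟨ ⁻¹-inverseʳ (positive⇒≉0 0<x) ⟨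
    x * x ⁻¹ ∎)

  /-nonNegative : ∀ {x y} → 0# ≤ x → 0# < y → 0# ≤ x / y
  /-nonNegative 0≤x 0<y = *-nonNegative 0≤x (⁻¹-nonNegative 0<y)

  *-/-cancel : ∀ x {y} → 0# < y → y * (x / y) ≈ x
  *-/-cancel x {y} 0<y = begin-equality
    y * (x * y ⁻¹)   ≈⟨ solve 3 (λ x y z → y :* (x :* z) := x :* (y :* z)) refl x y (y ⁻¹) ⟩
    x * (y * y ⁻¹)   ≈⟨ *-congˡ (⁻¹-inverseʳ (positive⇒≉0 0<y)) ⟩
    x * 1#           ≈⟨ *-identityʳ x ⟩
    x                ∎

  half : Carrier
  half = 1# / fromℕ 2

  0≤half : 0# ≤ half
  0≤half = /-nonNegative 0≤1 (fromℕ-positive 2)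

  2*half : fromℕ 2 * half ≈ 1#
  2*half = *-/-cancel 1# (fromℕ-positive 2)

  ≤-/ : ∀ {x y z} → 0# < y → y * x ≤ z → x ≤ z / y
  ≤-/ {x} {y} {z} 0<y yx≤z = *-cancelˡ-≤ 0<y (≤-respʳ (sym (*-/-cancel z 0<y)) yx≤z)

  /-≤ : ∀ {x y z} → 0# < y → z ≤ y * x → z / y ≤ x
  /-≤ {x} {y} {z} 0<y z≤yx = *-cancelˡ-≤ 0<y (≤-respˡ (sym (*-/-cancel z 0<y)) z≤yx)

  ^-nonNegative : ∀ {x} k → 0# ≤ x → 0# ≤ x ^ k
  ^-nonNegative zero    0≤x = 0≤1
  ^-nonNegative (suc k) 0≤x = *-nonNegative 0≤x (^-nonNegative k 0≤x)

  ^-≤1 : ∀ {x} k → 0# ≤ x → x ≤ 1# → x ^ k ≤ 1#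
  ^-≤1 zero    0≤x x≤1 = ≤-refl
  ^-≤1 {x} (suc k) 0≤x x≤1 = begin
    x * x ^ k ≤⟨ *-mono-≤ 0≤x 0≤1 x≤1 (^-≤1 k 0≤x x≤1) ⟩
    1# * 1#   ≈⟨ *-identityʳ 1# ⟩
    1#        ∎

  -- Bernoulli's inequality, in the form (1 - x)ᵏ ≤ 1 / (1 + k x).
  bernoulli : ∀ k {x} → 0# ≤ x → x ≤ 1# → (1# + fromℕ k * x) * (1# - x) ^ k ≤ 1#
  bernoulli zero {x} 0≤x x≤1 =
    ≤-reflexive (solve 1 (λ x → (con (+ 1) :+ con (+ 0) :* x) :* con (+ 1) := con (+ 1)) refl x)
  bernoulli (suc k) {x} 0≤x x≤1 = begin
    (1# + (1# + K) * x) * ((1# - x) * (1# - x) ^ k)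
      ≤⟨ ≤-by _ (*-nonNegative (*-nonNegative (*-nonNegative 0≤x 0≤x) (+-nonNegative 0≤1 (fromℕ-nonNegative k)))
                               (^-nonNegative k (≤⇒0≤- x≤1)))
           (solve 3 (λ x K p →
              (con (+ 1) :+ K :* x) :* p :=
              (con (+ 1) :+ (con (+ 1) :+ K) :* x) :* ((con (+ 1) :- x) :* p)
              :+ x :* x :* (con (+ 1) :+ K) :* p) refl x K ((1# - x) ^ k)) ⟩
    (1# + K * x) * (1# - x) ^ k
      ≤⟨ bernoulli k 0≤x x≤1 ⟩
    1# ∎
    where K = fromℕ k

  -- Absolute values

  x≤∣x∣ : ∀ x → x ≤ ∣ x ∣
  x≤∣x∣ x = MaxP.x≤x⊔y x (- x)

  -x≤∣x∣ : ∀ x → - x ≤ ∣ x ∣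
  -x≤∣x∣ x = MaxP.x≤y⊔x x (- x)

  ∣∣-≤ : ∀ {x y} → x ≤ y → - x ≤ y → ∣ x ∣ ≤ y
  ∣∣-≤ = MaxP.⊔-lub

  ∣∣-cong : ∀ {x y} → x ≈ y → ∣ x ∣ ≈ ∣ y ∣
  ∣∣-cong x≈y = MaxP.⊔-cong x≈y (-‿cong x≈y)

  0≤x⇒∣x∣≈x : ∀ {x} → 0# ≤ x → ∣ x ∣ ≈ x
  0≤x⇒∣x∣≈x {x} 0≤x = ≤-antisym
    (∣∣-≤ ≤-refl (≤-trans (≤-respʳ -0#≈0# (neg-mono-≤ 0≤x)) 0≤x)) (x≤∣x∣ x)

  ∣x+y∣≤∣x∣+∣y∣ : ∀ x y → ∣ x + y ∣ ≤ ∣ x ∣ + ∣ y ∣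
  ∣x+y∣≤∣x∣+∣y∣ x y = ∣∣-≤ (+-mono-≤ (x≤∣x∣ x) (x≤∣x∣ y))
    (≤-respˡ (solve 2 (λ x y → :- x :+ :- y := :- (x :+ y)) refl x y)
             (+-mono-≤ (-x≤∣x∣ x) (-x≤∣x∣ y)))

  ∣-x∣≈∣x∣ : ∀ x → ∣ - x ∣ ≈ ∣ x ∣
  ∣-x∣≈∣x∣ x = ≤-antisym
    (∣∣-≤ (-x≤∣x∣ x) (≤-respˡ (sym (-‿involutive x)) (x≤∣x∣ x)))
    (∣∣-≤ (≤-respˡ (-‿involutive x) (-x≤∣x∣ (- x))) (x≤∣x∣ (- x)))

  ∣c*x∣≈c*∣x∣ : ∀ {c} x → 0# ≤ c → ∣ c * x ∣ ≈ c * ∣ x ∣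
  ∣c*x∣≈c*∣x∣ {c} x 0≤c = ≤-antisym
    (∣∣-≤ (*-monoʳ-≤ 0≤c (x≤∣x∣ x))
          (≤-respˡ (sym (-‿distribʳ-* c x)) (*-monoʳ-≤ 0≤c (-x≤∣x∣ x))))
    (lower (≤-total 0# x))
    where
    lower : 0# ≤ x ⊎ x ≤ 0# → c * ∣ x ∣ ≤ ∣ c * x ∣
    lower (inj₁ 0≤x) = ≤-respˡ (*-congˡ (sym (0≤x⇒∣x∣≈x 0≤x))) (x≤∣x∣ (c * x))
    lower (inj₂ x≤0) = begin
      c * ∣ x ∣     ≈⟨ *-congˡ (∣-x∣≈∣x∣ x) ⟨
      c * ∣ - x ∣   ≈⟨ *-congˡ (0≤x⇒∣x∣≈x (≤-respˡ -0#≈0# (neg-mono-≤ x≤0))) ⟩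
      c * - x       ≈⟨ -‿distribʳ-* c x ⟨
      - (c * x)     ≤⟨ -x≤∣x∣ (c * x) ⟩
      ∣ c * x ∣     ∎

  -- Sums

  private module SumP = SumProperties semiring

  sum-cong : ∀ {n} {f g : Vector Carrier n} → (∀ i → f i ≈ g i) → sum f ≈ sum g
  sum-cong {zero}  f≈g = refl
  sum-cong {suc n} f≈g = +-cong (f≈g zero) (sum-cong (λ i → f≈g (suc i)))

  sum-+ : ∀ {n} (f g : Vector Carrier n) → sum (λ i → f i + g i) ≈ sum f + sum g
  sum-+ f g = SumP.∑-distrib-+ f g

  sum-comm : ∀ {m n} (f : Fin m → Fin n → Carrier) →
             sum (λ i → sum (λ j → f i j)) ≈ sum (λ j → sum (λ i → f i j))
  sum-comm f = SumP.∑-comm f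

  sum-*ˡ : ∀ {n} x (f : Vector Carrier n) → sum (λ i → x * f i) ≈ x * sum f
  sum-*ˡ x f = sym (SumP.*-distribˡ-sum x f)

  sum-*ʳ : ∀ {n} x (f : Vector Carrier n) → sum (λ i → f i * x) ≈ sum f * x
  sum-*ʳ x f = sym (SumP.*-distribʳ-sum x f)

  sum-zero : ∀ n → sum {n} (λ _ → 0#) ≈ 0#
  sum-zero n = SumP.sum-replicate-zero n

  sum-mono-≤ : ∀ {n} {f g : Vector Carrier n} → (∀ i → f i ≤ g i) → sum f ≤ sum g
  sum-mono-≤ {zero}  f≤g = ≤-refl
  sum-mono-≤ {suc n} f≤g = +-mono-≤ (f≤g zero) (sum-mono-≤ (λ i → f≤g (suc i)))

  sum-nonNegative : ∀ {n} {f : Vector Carrier n} → (∀ i → 0# ≤ f i) → 0# ≤ sum f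
  sum-nonNegative {zero}  0≤f = ≤-refl
  sum-nonNegative {suc n} 0≤f = +-nonNegative (0≤f zero) (sum-nonNegative (λ i → 0≤f (suc i)))

  sum-const : ∀ n x → sum {n} (λ _ → x) ≈ fromℕ n * x
  sum-const zero    x = sym (zeroˡ x)
  sum-const (suc n) x = trans (+-cong (sym (*-identityˡ x)) (sum-const n x)) (sym (distribʳ x 1# (fromℕ n)))

  ∣sum∣≤sum∣∣ : ∀ {n} (f : Vector Carrier n) → ∣ sum f ∣ ≤ sum (λ i → ∣ f i ∣)
  ∣sum∣≤sum∣∣ {zero}  f = ≤-reflexive (0≤x⇒∣x∣≈x ≤-refl)
  ∣sum∣≤sum∣∣ {suc n} f = ≤-trans (∣x+y∣≤∣x∣+∣y∣ _ _) (+-monoʳ-≤ _ (∣sum∣≤sum∣∣ (λ i → f (suc i))))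

  sum-minus : ∀ {n} (f g : Vector Carrier n) → sum (λ i → f i - g i) ≈ sum f - sum g
  sum-minus {zero}  f g = sym (-‿inverseʳ 0#)
  sum-minus {suc n} f g = trans (+-congˡ (sum-minus (λ i → f (suc i)) (λ i → g (suc i))))
    (solve 4 (λ a b c d → (a :- b) :+ (c :- d) := (a :+ c) :- (b :+ d)) refl _ _ _ _)

-- Distributions and Markov chains

module Chains {c ℓ₁ ℓ₂} (F : ArchimedeanField c ℓ₁ ℓ₂) where

  open OrderedField F
  open Testing F

  -- Distributions and expectations

  -- The expectation of f under the weights p.
  expect : ∀ {n} → Vector Carrier n → Vector Carrier n → Carrier
  expect p f = sum λ i → p i * f i

  expect-cong : ∀ {n} {p q f g : Vector Carrier n} →
                (∀ i → p i ≈ q i) → (∀ i → f i ≈ g i) → expect p f ≈ expect q g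
  expect-cong p≈q f≈g = sum-cong λ i → *-cong (p≈q i) (f≈g i)

  open IsDistribution

  expect-mono-≤ : ∀ {n} {p f g : Vector Carrier n} → IsDistribution p →
                  (∀ i → f i ≤ g i) → expect p f ≤ expect p g
  expect-mono-≤ P f≤g = sum-mono-≤ λ i → *-monoʳ-≤ (nonNegative P i) (f≤g i)

  expect-const : ∀ {n} {p : Vector Carrier n} x → IsDistribution p → expect p (λ _ → x) ≈ x
  expect-const {p = p} x P =
    trans (sum-*ʳ x p) (trans (*-congʳ (total P)) (*-identityˡ x))

  expect-+ : ∀ {n} (p f g : Vector Carrier n) → expect p (λ i → f i + g i) ≈ expect p f + expect p g
  expect-+ {n} p f g = trans (sum-cong {n} λ i → distribˡ (p i) (f i) (g i)) (sum-+ {n} _ _)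

  expect-scale : ∀ {n} x (p f : Vector Carrier n) → expect p (λ i → x * f i) ≈ x * expect p f
  expect-scale {n} x p f = trans
    (sum-cong {n} λ i → solve 3 (λ x p f → p :* (x :* f) := x :* (p :* f)) refl x (p i) (f i))
    (sum-*ˡ {n} x _)

  -- The affine form in which bounds on probabilities are averaged.
  expect-affine : ∀ {n} {p : Vector Carrier n} x y (f : Vector Carrier n) → IsDistribution p →
                  expect p (λ i → x + y * f i) ≈ x + y * expect p f
  expect-affine {p = p} x y f P = trans (expect-+ p _ _)
    (+-cong (expect-const x P) (expect-scale y p f))

  expect-swap : ∀ {m n} (p : Vector Carrier m) (A : Fin m → Vector Carrier n) (f : Vector Carrier n) →
                expect (λ j → expect p (λ i → A i j)) f ≈ expect p (λ i → expect (A i) f)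
  expect-swap {m} {n} p A f = trans (sum-cong {n} λ j → sym (sum-*ʳ {m} (f j) _))
    (trans (sum-comm {n} {m} λ j i → p i * A i j * f j)
    (sum-cong {m} λ i → trans (sum-cong {n} λ j → *-assoc (p i) (A i j) (f j)) (sum-*ˡ {n} (p i) _)))

  -- Choosing i from p and then j from A i.
  mixture-isDistribution : ∀ {m n} {p : Vector Carrier m} {A : Fin m → Vector Carrier n} →
    IsDistribution p → (∀ i → IsDistribution (A i)) → IsDistribution λ j → expect p (λ i → A i j)
  mixture-isDistribution {m} {n} {p} {A} P A-dist = record
    { nonNegative = λ j → sum-nonNegative λ i → *-nonNegative (nonNegative P i) (nonNegative (A-dist i) j)
    ; total = trans (sum-comm {n} {m} λ j i → p i * A i j)
        (trans (sum-cong {m} λ i → trans (sum-*ˡ (p i) (A i))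
                                  (trans (*-congˡ (total (A-dist i))) (*-identityʳ (p i))))
               (total P))
    }

  -- The uniform distribution on n states.
  uniformly : ∀ n → Vector Carrier n
  uniformly n _ = 1# / fromℕ n

  uniformly-isDistribution : ∀ n .{{_ : NonZero n}} → IsDistribution (uniformly n)
  uniformly-isDistribution n = record
    { nonNegative = λ _ → /-nonNegative 0≤1 (fromℕ-positive n)
    ; total = trans (sum-const n _) (*-/-cancel 1# (fromℕ-positive n))
    }

  expect-unit : ∀ {n} (u : Fin n) (f : Vector Carrier n) → expect (unit u) f ≈ f u
  expect-unit {suc n} zero f = trans
    (+-cong (*-identityˡ (f zero))
            (trans (sum-cong {n} λ i → zeroˡ (f (suc i))) (sum-zero n)))
    (+-identityʳ (f zero))
  expect-unit {suc n} (suc u) f = trans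
    (+-cong (zeroˡ (f zero)) (expect-unit u (λ i → f (suc i))))
    (+-identityˡ (f (suc u)))

  unit-isDistribution : ∀ {n} (u : Fin n) → IsDistribution (unit u)
  unit-isDistribution {n} u = record
    { nonNegative = λ i → unit-nonNegative (does (u Fin.≟ i))
    ; total = trans (sum-cong {n} λ i → sym (*-identityʳ (unit u i))) (expect-unit u (λ _ → 1#))
    }
    where
    unit-nonNegative : ∀ b → 0# ≤ (if b then 1# else 0#)
    unit-nonNegative true  = 0≤1
    unit-nonNegative false = ≤-refl

  least : ∀ {n} .{{_ : NonZero n}} (f : Vector Carrier n) → ∃ λ w → ∀ i → f w ≤ f i
  least {suc zero} f = zero , λ { zero → ≤-refl }
  least {suc (suc n)} f with least (λ i → f (suc i))
  ... | w , fw≤ with ≤-total (f zero) (f (suc w))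
  ...   | inj₁ f0≤fw = zero , λ { zero → ≤-refl ; (suc i) → ≤-trans f0≤fw (fw≤ i) }
  ...   | inj₂ fw≤f0 = suc w , λ { zero → fw≤f0 ; (suc i) → fw≤ i }

  -- Distances

  distance-cong : ∀ {n} {p p′ q q′ : Vector Carrier n} →
    (∀ i → p i ≈ p′ i) → (∀ i → q i ≈ q′ i) → distance p q ≈ distance p′ q′
  distance-cong {n} p≈p′ q≈q′ = sum-cong {n} λ i → ∣∣-cong (+-cong (p≈p′ i) (-‿cong (q≈q′ i)))

  distance-congˡ : ∀ {n} {p p′ q : Vector Carrier n} →
    (∀ i → p i ≈ p′ i) → distance p q ≈ distance p′ q
  distance-congˡ p≈p′ = distance-cong p≈p′ (λ _ → refl)

  distance-refl : ∀ {n} (p : Vector Carrier n) → distance p p ≈ 0#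
  distance-refl {n} p = trans
    (sum-cong {n} λ i → trans (∣∣-cong (-‿inverseʳ (p i))) (0≤x⇒∣x∣≈x ≤-refl))
    (sum-zero n)

  distance-sym : ∀ {n} (p q : Vector Carrier n) → distance p q ≈ distance q p
  distance-sym {n} p q = sum-cong {n} λ i → trans (sym (∣-x∣≈∣x∣ (p i - q i)))
    (∣∣-cong (solve 2 (λ x y → :- (x :- y) := y :- x) refl (p i) (q i)))

  distance-triangle : ∀ {n} (p q r : Vector Carrier n) → distance p r ≤ distance p q + distance q r
  distance-triangle {n} p q r = ≤-respʳ (sum-+ {n} _ _) (sum-mono-≤ {n} λ i →
    ≤-respˡ (∣∣-cong (solve 3 (λ x y z → (x :- y) :+ (y :- z) := x :- z) refl (p i) (q i) (r i)))
            (∣x+y∣≤∣x∣+∣y∣ (p i - q i) (q i - r i)))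

  distance≤2 : ∀ {n} {p q : Vector Carrier n} → IsDistribution p → IsDistribution q →
               distance p q ≤ fromℕ 2
  distance≤2 {n} {p} {q} P Q = begin
    distance p q
      ≤⟨ sum-mono-≤ {n} (λ i → ∣x+y∣≤∣x∣+∣y∣ (p i) (- q i)) ⟩
    sum (λ i → ∣ p i ∣ + ∣ - q i ∣)
      ≈⟨ sum-cong {n} (λ i → +-cong (0≤x⇒∣x∣≈x (nonNegative P i))
           (trans (∣-x∣≈∣x∣ (q i)) (0≤x⇒∣x∣≈x (nonNegative Q i)))) ⟩
    sum (λ i → p i + q i)
      ≈⟨ sum-+ p q ⟩
    sum p + sum q
      ≈⟨ +-cong (total P) (total Q) ⟩
    1# + 1#
      ≈⟨ solve 0 (con (+ 1) :+ con (+ 1) := con (+ 2)) refl ⟩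
    fromℕ 2 ∎

  -- The ℓ₁ distance is jointly convex.
  distance-convex : ∀ {m n} {w : Vector Carrier m} (A B : Fin m → Vector Carrier n) →
    (∀ k → 0# ≤ w k) →
    distance (λ j → expect w (λ k → A k j)) (λ j → expect w (λ k → B k j))
      ≤ expect w (λ k → distance (A k) (B k))
  distance-convex {m} {n} {w} A B 0≤w = begin
    sum (λ j → ∣ expect w (λ k → A k j) - expect w (λ k → B k j) ∣)
      ≈⟨ sum-cong {n} (λ j → ∣∣-cong (trans (sym (sum-minus {m} _ _)) (sum-cong {m} λ k →
           solve 3 (λ w a b → w :* a :- w :* b := w :* (a :- b)) refl (w k) (A k j) (B k j)))) ⟩
    sum (λ j → ∣ sum (λ k → w k * (A k j - B k j)) ∣)
      ≤⟨ sum-mono-≤ {n} (λ j → ∣sum∣≤sum∣∣ {m} (λ k → w k * (A k j - B k j))) ⟩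
    sum (λ j → sum (λ k → ∣ w k * (A k j - B k j) ∣))
      ≈⟨ sum-cong {n} (λ j → sum-cong {m} λ k → ∣c*x∣≈c*∣x∣ (A k j - B k j) (0≤w k)) ⟩
    sum (λ j → sum (λ k → w k * ∣ A k j - B k j ∣))
      ≈⟨ sum-comm {n} {m} (λ j k → w k * ∣ A k j - B k j ∣) ⟩
    sum (λ k → sum (λ j → w k * ∣ A k j - B k j ∣))
      ≈⟨ sum-cong {m} (λ k → sum-*ˡ {n} (w k) _) ⟩
    expect w (λ k → distance (A k) (B k)) ∎

  distance-convexˡ : ∀ {m n} {w : Vector Carrier m} (A : Fin m → Vector Carrier n) (s : Vector Carrier n) →
    IsDistribution w →
    distance (λ j → expect w (λ k → A k j)) s ≤ expect w (λ k → distance (A k) s)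
  distance-convexˡ A s W = ≤-respˡ
    (distance-cong (λ _ → refl) (λ j → expect-const (s j) W))
    (distance-convex A (λ _ → s) (nonNegative W))

  -- Two distributions give a function with values in [0, c] expectations that
  -- differ by at most c / 2 times their distance.
  expect-diff : ∀ {n} {p s f : Vector Carrier n} c → IsDistribution p → IsDistribution s →
    (∀ i → 0# ≤ f i) → (∀ i → f i ≤ c) →
    fromℕ 2 * expect p f ≤ fromℕ 2 * expect s f + c * distance p s
  expect-diff {n} {p} {s} {f} c P S 0≤f f≤c = 0≤-⇒≤ (begin
    0#
      ≤⟨ sum-nonNegative {n} (λ i → +-nonNegative
           (*-nonNegative (≤-respʳ (solve 2 (λ a x → a :- :- x := a :+ x) refl ∣ x i ∣ (x i)) (≤⇒0≤- (-x≤∣x∣ (x i))))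
                          (≤⇒0≤- (f≤c i)))
           (*-nonNegative (≤⇒0≤- (x≤∣x∣ (x i))) (0≤f i))) ⟩
    sum (λ i → (∣ x i ∣ + x i) * (c - f i) + (∣ x i ∣ - x i) * f i)
      ≈⟨ sum-cong {n} (λ i → solve 5 (λ a p s f c →
            (a :+ (p :- s)) :* (c :- f) :+ (a :- (p :- s)) :* f :=
            (c :* a :+ (c :* p :+ con (+ 2) :* (s :* f))) :- (c :* s :+ con (+ 2) :* (p :* f)))
            refl ∣ x i ∣ (p i) (s i) (f i) c) ⟩
    sum (λ i → (c * ∣ x i ∣ + (c * p i + fromℕ 2 * (s i * f i))) - (c * s i + fromℕ 2 * (p i * f i)))
      ≈⟨ sum-minus {n} _ _ ⟩
    sum (λ i → c * ∣ x i ∣ + (c * p i + fromℕ 2 * (s i * f i))) - sum (λ i → c * s i + fromℕ 2 * (p i * f i))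
      ≈⟨ +-cong (trans (sum-+ {n} _ _) (+-cong (sum-*ˡ {n} c _) (linear p s P)))
                (-‿cong (linear s p S)) ⟩
    (c * distance p s + (c + fromℕ 2 * expect s f)) - (c + fromℕ 2 * expect p f)
      ≈⟨ solve 4 (λ c d e g → (c :* d :+ (c :+ con (+ 2) :* e)) :- (c :+ con (+ 2) :* g)
            := (con (+ 2) :* e :+ c :* d) :- con (+ 2) :* g) refl c (distance p s) (expect s f) (expect p f) ⟩
    (fromℕ 2 * expect s f + c * distance p s) - fromℕ 2 * expect p f ∎)
    where
    x : ∀ i → Carrier
    x i = p i - s i

    linear : ∀ q r → IsDistribution q →
             sum (λ i → c * q i + fromℕ 2 * (r i * f i)) ≈ c + fromℕ 2 * expect r f
    linear q r Q = trans (sum-+ {n} _ _) (+-cong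
      (trans (sum-*ˡ c q) (trans (*-congˡ (total Q)) (*-identityʳ c)))
      (sum-*ˡ {n} (fromℕ 2) _))

  -- Powers of a stochastic matrix

  -- Each row is a distribution.
  Stochastic : ∀ {n} → Matrix n → Set _
  Stochastic A = ∀ u → IsDistribution (A u)

  power-stochastic : ∀ {n} {A : Matrix n} → Stochastic A → ∀ j → Stochastic (power A j)
  power-stochastic A-stoch zero    u = unit-isDistribution u
  power-stochastic A-stoch (suc j) u = mixture-isDistribution (A-stoch u) (power-stochastic A-stoch j)

  walk≈power : ∀ {n d} (M : MarkovChain n d) t u i → walk M t u i ≈ power (matrix M) t u i
  walk≈power M t u i = expect-unit u (λ k → power (matrix M) t k i)

  -- The distribution of the endpoint of a j-step walk from a uniform state.
  endpoint : ∀ {n} → Matrix n → ℕ → Vector Carrier n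
  endpoint {n} A j i = expect (uniformly n) λ u → power A j u i

  average≈endpoint : ∀ {n d} (M : MarkovChain n d) t i → average M t i ≈ endpoint (matrix M) t i
  average≈endpoint {n} M t i = trans (*-congˡ (sum-cong {n} λ u → walk≈power M t u i))
    (sym (sum-*ˡ {n} (1# / fromℕ n) _))

  endpoint-isDistribution : ∀ {n} .{{_ : NonZero n}} {A : Matrix n} → Stochastic A →
                            ∀ j → IsDistribution (endpoint A j)
  endpoint-isDistribution {n} A-stoch j =
    mixture-isDistribution (uniformly-isDistribution n) (power-stochastic A-stoch j)

-- Meeting bad states, and redirecting them

-- Bad may be any decidable set of states here.
module Hitting {c ℓ₁ ℓ₂} (F : ArchimedeanField c ℓ₁ ℓ₂)
  {n : ℕ} (A : Fin n → Fin n → ArchimedeanField.Carrier F)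
  (A-stochastic : Chains.Stochastic F A)
  {b} (Bad : Fin n → Set b) (bad? : ∀ u → Dec (Bad u)) where

  open OrderedField F
  open Testing F
  open Chains F

  -- hit j u is the probability that one of the states X₀, …, Xⱼ of the walk
  -- from X₀ = u is bad.
  hit : ℕ → Vector Carrier n
  hit zero    u = if does (bad? u) then 1# else 0#
  hit (suc j) u = if does (bad? u) then 1# else expect (A u) (hit j)

  hit-bad : ∀ j {u} → Bad u → hit j u ≈ 1#
  hit-bad zero {u} bad with bad? u
  ... | yes _    = refl
  ... | no ¬bad  = contradiction bad ¬bad
  hit-bad (suc j) {u} bad with bad? u
  ... | yes _    = refl
  ... | no ¬bad  = contradiction bad ¬bad

  hit-zero : ∀ {u} → ¬ Bad u → hit 0 u ≈ 0#
  hit-zero {u} ¬bad with bad? u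
  ... | yes bad = contradiction bad ¬bad
  ... | no _    = refl

  hit-suc : ∀ j {u} → ¬ Bad u → hit (suc j) u ≈ expect (A u) (hit j)
  hit-suc j {u} ¬bad with bad? u
  ... | yes bad = contradiction bad ¬bad
  ... | no _    = refl

  hit≤1 : ∀ j u → hit j u ≤ 1#
  hit≤1 j u with bad? u in eq
  hit≤1 j       u | yes bad = ≤-reflexive (hit-bad j bad)
  hit≤1 zero    u | no ¬bad = ≤-respˡ (sym (hit-zero ¬bad)) 0≤1
  hit≤1 (suc j) u | no ¬bad = begin
    hit (suc j) u              ≈⟨ hit-suc j ¬bad ⟩
    expect (A u) (hit j)       ≤⟨ expect-mono-≤ (A-stochastic u) (hit≤1 j) ⟩
    expect (A u) (λ _ → 1#)    ≈⟨ expect-const 1# (A-stochastic u) ⟩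
    1#                         ∎

  hit-nonNegative : ∀ j u → 0# ≤ hit j u
  hit-nonNegative j u with bad? u
  hit-nonNegative j       u | yes bad = ≤-respʳ (sym (hit-bad j bad)) 0≤1
  hit-nonNegative zero    u | no ¬bad = ≤-reflexive (sym (hit-zero ¬bad))
  hit-nonNegative (suc j) u | no ¬bad = ≤-respʳ (sym (hit-suc j ¬bad))
    (sum-nonNegative {n} λ i →
      *-nonNegative (IsDistribution.nonNegative (A-stochastic u) i) (hit-nonNegative j i))

  hit-mono-suc : ∀ j u → hit j u ≤ hit (suc j) u
  hit-mono-suc j u = cases j (bad? u)
    where
    cases : ∀ j → Dec (Bad u) → hit j u ≤ hit (suc j) u
    cases j       (yes bad) = ≤-reflexive (trans (hit-bad j bad) (sym (hit-bad (suc j) bad)))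
    cases zero    (no ¬bad) = ≤-respˡ (sym (hit-zero ¬bad)) (hit-nonNegative 1 u)
    cases (suc j) (no ¬bad) = begin
      hit (suc j) u                ≈⟨ hit-suc j ¬bad ⟩
      expect (A u) (hit j)         ≤⟨ expect-mono-≤ (A-stochastic u) (hit-mono-suc j) ⟩
      expect (A u) (hit (suc j))   ≈⟨ hit-suc (suc j) ¬bad ⟨
      hit (suc (suc j)) u          ∎

  hit-mono : ∀ {j k} → j ℕ.≤ k → ∀ u → hit j u ≤ hit k u
  hit-mono j≤k u = go (ℕ.≤⇒≤′ j≤k)
    where
    go : ∀ {j k} → j ℕ.≤′ k → hit j u ≤ hit k u
    go (ℕ.≤′-reflexive ≡.refl) = ≤-refl
    go {k = suc k} (ℕ.≤′-step j≤k) = ≤-trans (go j≤k) (hit-mono-suc k u)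

  -- A bad state met between the times i and i + j is met before i + j.
  expect-hit : ∀ i j u → expect (power A i u) (hit j) ≤ hit (i ℕ.+ j) u
  expect-hit zero    j u = ≤-reflexive (expect-unit u (hit j))
  expect-hit (suc i) j u = cases (bad? u)
    where
    cases : Dec (Bad u) → expect (power A (suc i) u) (hit j) ≤ hit (suc i ℕ.+ j) u
    cases (yes bad) = begin
      expect (power A (suc i) u) (hit j)    ≤⟨ expect-mono-≤ stochastic-i (hit≤1 j) ⟩
      expect (power A (suc i) u) (λ _ → 1#) ≈⟨ expect-const 1# stochastic-i ⟩
      1#                                    ≈⟨ hit-bad (suc i ℕ.+ j) bad ⟨
      hit (suc i ℕ.+ j) u                   ∎
      where stochastic-i = power-stochastic A-stochastic (suc i) u
    cases (no ¬bad) = begin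
      expect (power A (suc i) u) (hit j)
        ≈⟨ expect-swap (A u) (power A i) (hit j) ⟩
      expect (A u) (λ v → expect (power A i v) (hit j))
        ≤⟨ expect-mono-≤ (A-stochastic u) (expect-hit i j) ⟩
      expect (A u) (hit (i ℕ.+ j))
        ≈⟨ hit-suc (i ℕ.+ j) ¬bad ⟨
      hit (suc i ℕ.+ j) u ∎

  -- The probability that a walk of 2t steps from a uniform state meets a bad
  -- state.
  risk : ℕ → Carrier
  risk t = expect (uniformly n) (hit (t ℕ.+ t))

  module Redirect .{{_ : NonZero n}} (w : Fin n) where

    -- Bad states move as the state w does.
    redirected : Matrix n
    redirected u = if does (bad? u) then A w else A u

    redirected-good : ∀ {u} → ¬ Bad u → redirected u ≡ A u
    redirected-good {u} ¬bad with bad? u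
    ... | yes bad = contradiction bad ¬bad
    ... | no _    = ≡.refl

    redirected-bad : ∀ {u} → Bad u → redirected u ≡ A w
    redirected-bad {u} bad with bad? u
    ... | yes _   = ≡.refl
    ... | no ¬bad = contradiction bad ¬bad

    redirected-w : redirected w ≡ A w
    redirected-w with bad? w
    ... | yes _ = ≡.refl
    ... | no _  = ≡.refl

    redirected-stochastic : Stochastic redirected
    redirected-stochastic u with bad? u
    ... | yes _ = A-stochastic w
    ... | no _  = A-stochastic u

    redirected-sparse : ∀ {d} → (∀ u → nonZeroEntries (A u) ℕ.≤ d) →
                        ∀ u → nonZeroEntries (redirected u) ℕ.≤ d
    redirected-sparse A-sparse u with bad? u
    ... | yes _ = A-sparse w
    ... | no _  = A-sparse u

    first-step : ∀ j {u v} → redirected u ≡ A v → ∀ i →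
      power redirected (suc j) u i ≈ expect (A v) (λ k → power redirected j k i)
    first-step j eq i = reflexive (≡.cong (λ r → expect r (λ k → power redirected j k i)) eq)

    bad-walks-as-w : ∀ j {u} → 0 ℕ.< j → Bad u → ∀ i →
      power redirected j u i ≈ power redirected j w i
    bad-walks-as-w (suc j) _ bad i =
      trans (first-step j (redirected-bad bad) i) (sym (first-step j redirected-w i))

    -- The two chains can be coupled until they meet a bad state.
    redirected-deviation : ∀ j u →
      distance (power redirected j u) (power A j u) ≤ fromℕ 2 * hit j u
    redirected-deviation j u with bad? u
    redirected-deviation j u | yes bad = begin
      distance (power redirected j u) (power A j u)
        ≤⟨ distance≤2 (power-stochastic redirected-stochastic j u) (power-stochastic A-stochastic j u) ⟩
      fromℕ 2
        ≈⟨ *-identityʳ (fromℕ 2) ⟨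
      fromℕ 2 * 1#
        ≈⟨ *-congˡ (hit-bad j bad) ⟨
      fromℕ 2 * hit j u ∎
    redirected-deviation zero u | no _ =
      ≤-respˡ (sym (distance-refl (unit u))) (*-nonNegative (fromℕ-nonNegative 2) (hit-nonNegative 0 u))
    redirected-deviation (suc j) u | no ¬bad = begin
      distance (power redirected (suc j) u) (power A (suc j) u)
        ≈⟨ distance-congˡ (first-step j (redirected-good ¬bad)) ⟩
      distance (λ i → expect (A u) (λ v → power redirected j v i)) (power A (suc j) u)
        ≤⟨ distance-convex (power redirected j) (power A j) (IsDistribution.nonNegative (A-stochastic u)) ⟩
      expect (A u) (λ v → distance (power redirected j v) (power A j v))
        ≤⟨ expect-mono-≤ (A-stochastic u) (redirected-deviation j) ⟩
      expect (A u) (λ v → fromℕ 2 * hit j v)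
        ≈⟨ expect-scale (fromℕ 2) (A u) (hit j) ⟩
      fromℕ 2 * expect (A u) (hit j)
        ≈⟨ *-congˡ (hit-suc j ¬bad) ⟨
      fromℕ 2 * hit (suc j) u ∎

    module Mixed
      (t : ℕ) (0<t : 0 ℕ.< t) (ε : Carrier) (0≤ε : 0# ≤ ε) (ε≤1 : ε ≤ 1#)
      (good-near : ∀ {u} → ¬ Bad u → distance (power A t u) (endpoint A t) ≤ fromℕ 2 * ε)
      where

      private
        s : Vector Carrier n
        s = endpoint A t

        s-isDistribution : IsDistribution s
        s-isDistribution = endpoint-isDistribution A-stochastic t

        D : Carrier
        D = fromℕ 2 * ε

        0≤D : 0# ≤ D
        0≤D = *-nonNegative (fromℕ-nonNegative 2) 0≤ε

        distance-to-s≤2 : ∀ j u → distance (power redirected j u) s ≤ fromℕ 2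
        distance-to-s≤2 j u = distance≤2 (power-stochastic redirected-stochastic j u) s-isDistribution

        first-step-distance : ∀ j {u} → ¬ Bad u →
          distance (power redirected (suc j) u) s ≤ expect (A u) (λ v → distance (power redirected j v) s)
        first-step-distance j {u} ¬bad = ≤-respˡ
          (sym (distance-congˡ (first-step j (redirected-good ¬bad))))
          (distance-convexˡ (power redirected j) s (A-stochastic u))

      -- A walk that avoids the bad states is within 2ε of s at all times
      -- from t on, because its last t steps start in a good state.
      distance≤hit : ∀ r u → distance (power redirected (r ℕ.+ t) u) s ≤ D + fromℕ 2 * hit (r ℕ.+ t) u
      distance≤hit r u with bad? u
      distance≤hit r u | yes bad = begin
        distance (power redirected (r ℕ.+ t) u) s
          ≤⟨ distance-to-s≤2 (r ℕ.+ t) u ⟩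
        fromℕ 2
          ≤⟨ ≤-by D 0≤D (trans (+-congˡ (*-congˡ (hit-bad (r ℕ.+ t) bad)))
               (solve 1 (λ d → d :+ con (+ 2) :* con (+ 1) := con (+ 2) :+ d) refl D)) ⟩
        D + fromℕ 2 * hit (r ℕ.+ t) u ∎
      distance≤hit zero u | no ¬bad = begin
        distance (power redirected t u) s
          ≤⟨ distance-triangle (power redirected t u) (power A t u) s ⟩
        distance (power redirected t u) (power A t u) + distance (power A t u) s
          ≤⟨ +-mono-≤ (redirected-deviation t u) (good-near ¬bad) ⟩
        fromℕ 2 * hit t u + D
          ≈⟨ +-comm _ _ ⟩
        D + fromℕ 2 * hit t u ∎
      distance≤hit (suc r) u | no ¬bad = begin
        distance (power redirected (suc (r ℕ.+ t)) u) s
          ≤⟨ first-step-distance (r ℕ.+ t) ¬bad ⟩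
        expect (A u) (λ v → distance (power redirected (r ℕ.+ t) v) s)
          ≤⟨ expect-mono-≤ (A-stochastic u) (distance≤hit r) ⟩
        expect (A u) (λ v → D + fromℕ 2 * hit (r ℕ.+ t) v)
          ≈⟨ expect-affine D (fromℕ 2) (hit (r ℕ.+ t)) (A-stochastic u) ⟩
        D + fromℕ 2 * expect (A u) (hit (r ℕ.+ t))
          ≈⟨ +-congˡ (*-congˡ (hit-suc (r ℕ.+ t) ¬bad)) ⟨
        D + fromℕ 2 * hit (suc r ℕ.+ t) u ∎

      private
        open Min totalOrder using (_⊓_; ⊓-glb; x⊓y≤x; x⊓y≤y; ⊓-sel)

        -- What meeting bad states adds to the bound 2ε on the distance from s
        -- after t steps from a good state, where no distance exceeds 2.
        excess : Vector Carrier n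
        excess u = (fromℕ 2 - D) ⊓ (fromℕ 2 * hit t u)

        D≤2 : D ≤ fromℕ 2
        D≤2 = ≤-respʳ (*-identityʳ (fromℕ 2)) (*-monoʳ-≤ (fromℕ-nonNegative 2) ε≤1)

        excess-nonNegative : ∀ u → 0# ≤ excess u
        excess-nonNegative u =
          ⊓-glb (≤⇒0≤- D≤2) (*-nonNegative (fromℕ-nonNegative 2) (hit-nonNegative t u))

        distance≤excess : ∀ {u} → ¬ Bad u → distance (power redirected t u) s ≤ D + excess u
        distance≤excess {u} ¬bad with ⊓-sel (fromℕ 2 - D) (fromℕ 2 * hit t u)
        ... | inj₁ excess≈2-D = begin
          distance (power redirected t u) s  ≤⟨ distance-to-s≤2 t u ⟩
          fromℕ 2                            ≈⟨ solve 1 (λ d → con (+ 2) := d :+ (con (+ 2) :- d)) refl D ⟩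
          D + (fromℕ 2 - D)                  ≈⟨ +-congˡ excess≈2-D ⟨
          D + excess u                       ∎
        ... | inj₂ excess≈2hit = ≤-respʳ (+-congˡ (sym excess≈2hit)) (distance≤hit 0 u)

      -- From a bad state the walk is as from w, whose risk over 2t steps is
      -- small.
      distance-bad : ∀ r {u} → r ℕ.≤ t → Bad u →
        distance (power redirected (r ℕ.+ t) u) s ≤ D + fromℕ 2 * hit (t ℕ.+ t) w
      distance-bad r {u} r≤t bad = begin
        distance (power redirected (r ℕ.+ t) u) s
          ≈⟨ distance-congˡ (bad-walks-as-w (r ℕ.+ t) (ℕ.<-≤-trans 0<t (ℕ.m≤n+m t r)) bad) ⟩
        distance (power redirected (r ℕ.+ t) w) s
          ≤⟨ distance≤hit r w ⟩
        D + fromℕ 2 * hit (r ℕ.+ t) w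
          ≤⟨ +-monoʳ-≤ D (*-monoʳ-≤ (fromℕ-nonNegative 2) (hit-mono (ℕ.+-monoˡ-≤ t r≤t) w)) ⟩
        D + fromℕ 2 * hit (t ℕ.+ t) w ∎

      -- A walk that meets a bad state in its first r steps has at least t more
      -- steps to mix as a walk from w; any other pays the excess of the state
      -- that it reaches after r steps.
      distance≤expected-excess : ∀ r u → r ℕ.≤ t →
        distance (power redirected (r ℕ.+ t) u) s
          ≤ (D + fromℕ 2 * hit (t ℕ.+ t) w) + expect (power A r u) excess
      distance≤expected-excess r u r≤t with bad? u
      distance≤expected-excess r u r≤t | yes bad = ≤-trans (distance-bad r r≤t bad)
        (≤-by _ (sum-nonNegative {n} λ i → *-nonNegative
          (IsDistribution.nonNegative (power-stochastic A-stochastic r u) i) (excess-nonNegative i)) refl)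
      distance≤expected-excess zero u r≤t | no ¬bad = begin
        distance (power redirected t u) s
          ≤⟨ distance≤excess ¬bad ⟩
        D + excess u
          ≤⟨ ≤-by (fromℕ 2 * hit (t ℕ.+ t) w) (*-nonNegative (fromℕ-nonNegative 2) (hit-nonNegative (t ℕ.+ t) w))
               (solve 3 (λ d h e → (d :+ h) :+ e := (d :+ e) :+ h) refl D _ (excess u)) ⟩
        (D + fromℕ 2 * hit (t ℕ.+ t) w) + excess u
          ≈⟨ +-congˡ (expect-unit u excess) ⟨
        (D + fromℕ 2 * hit (t ℕ.+ t) w) + expect (unit u) excess ∎
      distance≤expected-excess (suc r) u r<t | no ¬bad = begin
        distance (power redirected (suc r ℕ.+ t) u) s
          ≤⟨ first-step-distance (r ℕ.+ t) ¬bad ⟩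
        expect (A u) (λ v → distance (power redirected (r ℕ.+ t) v) s)
          ≤⟨ expect-mono-≤ (A-stochastic u) (λ v → distance≤expected-excess r v (ℕ.<⇒≤ r<t)) ⟩
        expect (A u) (λ v → E + expect (power A r v) excess)
          ≈⟨ trans (expect-+ (A u) _ _) (+-cong (expect-const E (A-stochastic u)) (sym (expect-swap (A u) (power A r) excess))) ⟩
        E + expect (power A (suc r) u) excess ∎
        where E = D + fromℕ 2 * hit (t ℕ.+ t) w

      private
        expect-s-excess : expect s excess ≤ fromℕ 2 * risk t
        expect-s-excess = begin
          expect s excess
            ≤⟨ expect-mono-≤ s-isDistribution (λ u → x⊓y≤y (fromℕ 2 - D) (fromℕ 2 * hit t u)) ⟩
          expect s (λ u → fromℕ 2 * hit t u)
            ≈⟨ expect-scale (fromℕ 2) s (hit t) ⟩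
          fromℕ 2 * expect s (hit t)
            ≈⟨ *-congˡ (expect-swap (uniformly n) (power A t) (hit t)) ⟩
          fromℕ 2 * expect (uniformly n) (λ u → expect (power A t u) (hit t))
            ≤⟨ *-monoʳ-≤ (fromℕ-nonNegative 2) (expect-mono-≤ (uniformly-isDistribution n) (expect-hit t t)) ⟩
          fromℕ 2 * risk t ∎

      -- The expected excess after t steps from a good state is at most that
      -- under s plus ε, half the distance of the two distributions, times the
      -- largest excess 2 - 2ε; as this falls short of 2, there is room for the
      -- risk.
      redirected-mixing :
        hit (t ℕ.+ t) w ≤ risk t → fromℕ 2 * risk t ≤ ε * ε →
        ∀ u → distance (power redirected (t ℕ.+ t) u) s ≤ fromℕ 4 * ε
      redirected-mixing hit≤risk 2risk≤ε² u with bad? u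
      ... | yes bad = begin
        distance (power redirected (t ℕ.+ t) u) s
          ≤⟨ distance-bad t ℕ.≤-refl bad ⟩
        D + fromℕ 2 * hit (t ℕ.+ t) w
          ≤⟨ +-monoʳ-≤ D (*-monoʳ-≤ (fromℕ-nonNegative 2) hit≤risk) ⟩
        D + fromℕ 2 * risk t
          ≤⟨ +-monoʳ-≤ D 2risk≤ε² ⟩
        D + ε * ε
          ≤⟨ ≤-by (ε + ε * (1# - ε)) (+-nonNegative 0≤ε (*-nonNegative 0≤ε (≤⇒0≤- ε≤1)))
               (solve 1 (λ e → con (+ 4) :* e :=
                  (con (+ 2) :* e :+ e :* e) :+ (e :+ e :* (con (+ 1) :- e))) refl ε) ⟩
        fromℕ 4 * ε ∎
      ... | no ¬bad = *-cancelˡ-≤ (fromℕ-positive 2) (begin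
        fromℕ 2 * distance (power redirected (t ℕ.+ t) u) s
          ≤⟨ *-monoʳ-≤ (fromℕ-nonNegative 2) (distance≤expected-excess t u ℕ.≤-refl) ⟩
        fromℕ 2 * ((D + fromℕ 2 * hit (t ℕ.+ t) w) + expect (power A t u) excess)
          ≤⟨ *-monoʳ-≤ (fromℕ-nonNegative 2) (+-mono-≤ (+-monoʳ-≤ D
               (*-monoʳ-≤ (fromℕ-nonNegative 2) hit≤risk)) ≤-refl) ⟩
        fromℕ 2 * ((D + fromℕ 2 * risk t) + expect (power A t u) excess)
          ≈⟨ distribˡ (fromℕ 2) _ _ ⟩
        fromℕ 2 * (D + fromℕ 2 * risk t) + fromℕ 2 * expect (power A t u) excess
          ≤⟨ +-monoʳ-≤ _ (expect-diff (fromℕ 2 - D) (power-stochastic A-stochastic t u) s-isDistribution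
               excess-nonNegative (λ v → x⊓y≤x (fromℕ 2 - D) (fromℕ 2 * hit t v))) ⟩
        fromℕ 2 * (D + fromℕ 2 * risk t)
          + (fromℕ 2 * expect s excess + (fromℕ 2 - D) * distance (power A t u) s)
          ≤⟨ +-monoʳ-≤ _ (+-mono-≤ (*-monoʳ-≤ (fromℕ-nonNegative 2) expect-s-excess)
               (*-monoʳ-≤ (≤⇒0≤- D≤2) (good-near ¬bad))) ⟩
        fromℕ 2 * (D + fromℕ 2 * risk t) + (fromℕ 2 * (fromℕ 2 * risk t) + (fromℕ 2 - D) * D)
          ≤⟨ ≤-by (fromℕ 4 * (ε * ε - fromℕ 2 * risk t))
               (*-nonNegative (fromℕ-nonNegative 4) (≤⇒0≤- 2risk≤ε²))
               (solve 2 (λ e q → con (+ 2) :* (con (+ 4) :* e) :=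
                  con (+ 2) :* (con (+ 2) :* e :+ con (+ 2) :* q)
                  :+ (con (+ 2) :* (con (+ 2) :* q) :+ (con (+ 2) :- con (+ 2) :* e) :* (con (+ 2) :* e))
                  :+ con (+ 4) :* (e :* e :- con (+ 2) :* q)) refl ε (risk t)) ⟩
        fromℕ 2 * (fromℕ 4 * ε) ∎)

-- Closeness of the redirected chain

count-≤ : ∀ {a b p q r} {A : Set a} {B : Set b} {P : B → Set p} {Q : A → Set q} {R : A → Set r}
  (P? : Decidable P) (Q? : Decidable Q) (R? : Decidable R) (f : A → B) →
  (∀ x → P (f x) → Q x ⊎ R x) → ∀ xs →
  length (filter P? (map f xs)) ℕ.≤ length (filter Q? xs) ℕ.+ length (filter R? xs)
count-≤ P? Q? R? f P⊆Q∪R [] = ℕ.z≤n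
count-≤ P? Q? R? f P⊆Q∪R (x ∷ xs) with P? (f x) | Q? x | R? x | count-≤ P? Q? R? f P⊆Q∪R xs
... | yes p | yes q | yes r | ih = ℕ.s≤s (ℕ.≤-trans ih (ℕ.+-monoʳ-≤ _ (ℕ.n≤1+n _)))
... | yes p | yes q | no ¬r | ih = ℕ.s≤s ih
... | yes p | no ¬q | yes r | ih = ℕ.≤-trans (ℕ.s≤s ih) (ℕ.≤-reflexive (≡.sym (ℕ.+-suc _ _)))
... | yes p | no ¬q | no ¬r | ih = contradiction (P⊆Q∪R x p) [ ¬q , ¬r ]
... | no ¬p | yes q | yes r | ih = ℕ.m≤n⇒m≤1+n (ℕ.≤-trans ih (ℕ.+-monoʳ-≤ _ (ℕ.n≤1+n _)))
... | no ¬p | yes q | no ¬r | ih = ℕ.m≤n⇒m≤1+n ih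
... | no ¬p | no ¬q | yes r | ih = ℕ.≤-trans ih (ℕ.+-monoʳ-≤ _ (ℕ.n≤1+n _))
... | no ¬p | no ¬q | no ¬r | ih = ih

count-none : ∀ {a p} {A : Set a} {P : A → Set p} (P? : Decidable P) → (∀ x → ¬ P x) →
  ∀ xs → length (filter P? xs) ≡ 0
count-none P? none [] = ≡.refl
count-none P? none (x ∷ xs) with P? x
... | yes p = contradiction p (none x)
... | no _  = count-none P? none xs

-- Pairs (x , y) are counted by rows, of which only the bad ones contribute.
count-rows : ∀ {a b p q} {A : Set a} {B : Set b} {P : A × B → Set p} {Bad : A → Set q}
  (P? : Decidable P) (bad? : Decidable Bad) (k : ℕ) (ys : List B) →
  (∀ x y → ¬ Bad x → ¬ P (x , y)) →
  (∀ x → length (filter P? (map (x ,_) ys)) ℕ.≤ k) → ∀ xs →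
  length (filter P? (cartesianProduct xs ys)) ℕ.≤ length (filter bad? xs) ℕ.* k
count-rows P? bad? k ys good-row row≤k [] = ℕ.z≤n
count-rows {P = P} {Bad} P? bad? k ys good-row row≤k (x ∷ xs) =
  ℕ.≤-trans (ℕ.≤-reflexive split) bound
  where
  rest = cartesianProduct xs ys

  split : length (filter P? (map (x ,_) ys ++ rest))
            ≡ length (filter P? (map (x ,_) ys)) ℕ.+ length (filter P? rest)
  split = ≡.trans (≡.cong length (List.filter-++ P? (map (x ,_) ys) rest))
                  (List.length-++ (filter P? (map (x ,_) ys)))

  empty : ¬ Bad x → ∀ ys → length (filter P? (map (x ,_) ys)) ≡ 0
  empty ¬bad [] = ≡.refl
  empty ¬bad (y ∷ ys) with P? (x , y)
  ... | yes p = contradiction p (good-row x y ¬bad)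
  ... | no _  = empty ¬bad ys

  bound : length (filter P? (map (x ,_) ys)) ℕ.+ length (filter P? rest)
            ℕ.≤ length (filter bad? (x ∷ xs)) ℕ.* k
  bound with bad? x
  ... | yes _   = ℕ.+-mono-≤ (row≤k x) (count-rows P? bad? k ys good-row row≤k xs)
  ... | no ¬bad = ℕ.+-mono-≤ (ℕ.≤-reflexive (empty ¬bad ys)) (count-rows P? bad? k ys good-row row≤k xs)

module Closeness {c ℓ₁ ℓ₂} (F : ArchimedeanField c ℓ₁ ℓ₂) where

  open OrderedField F
  open Testing F
  open Chains F

  count≤sum : ∀ {m n b} {Bad : Fin n → Set b} (bad? : Decidable Bad) (h : Vector Carrier n) →
    (∀ i → 0# ≤ h i) → (∀ {i} → Bad i → h i ≈ 1#) → (f : Fin m → Fin n) →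
    fromℕ (length (filter bad? (tabulate f))) ≤ sum (λ i → h (f i))
  count≤sum {zero}  bad? h 0≤h h-bad f = ≤-refl
  count≤sum {suc m} bad? h 0≤h h-bad f with bad? (f zero)
  ... | yes bad = +-mono-≤ (≤-reflexive (sym (h-bad bad))) (count≤sum bad? h 0≤h h-bad (λ i → f (suc i)))
  ... | no _    = ≤-respˡ (+-identityˡ _) (+-mono-≤ (0≤h (f zero)) (count≤sum bad? h 0≤h h-bad (λ i → f (suc i))))

  half+half : half + half ≈ 1#
  half+half = trans (solve 1 (λ h → h :+ h := con (+ 2) :* h) refl half) 2*half

  -- A row without nonzero entries would not sum to 1.
  degree-positive : ∀ {n d} .{{_ : NonZero n}} → MarkovChain n d → 0# < fromℕ d
  degree-positive {d = suc d} M = fromℕ-positive (suc d)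
  degree-positive {n = suc n} {d = zero} M =
    contradiction (trans (sym (IsDistribution.total (stochastic M zero))) zero-row) 1≉0
    where
    zero-entries : ∀ {m} (v : Vector Carrier (suc n)) (f : Fin m → Fin (suc n)) →
      length (filter (λ i → ¬? (v i ≟ 0#)) (tabulate f)) ℕ.≤ 0 → ∀ i → v (f i) ≈ 0#
    zero-entries {suc m} v f len i with v (f zero) ≟ 0#
    zero-entries {suc m} v f len zero    | yes v≈0 = v≈0
    zero-entries {suc m} v f len (suc i) | yes v≈0 = zero-entries v (λ i → f (suc i)) len i
    zero-entries {suc m} v f () i        | no _

    zero-row : sum (matrix M zero) ≈ 0#
    zero-row = trans (sum-cong {suc n} (zero-entries (matrix M zero) (λ i → i) (sparse M zero)))
                     (sum-zero (suc n))

  module Probes {n d} .{{_ : NonZero n}} (M : MarkovChain n d) (t : ℕ) where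

    private
      A : Matrix n
      A = matrix M

      s : Vector Carrier n
      s = endpoint A t

    -- The average distribution mixed with that of the walk from u. When all
    -- walks end within φ of a common distribution, they end within 2φ of the
    -- average one, and the mixture is within φ of it.
    probe : Fin n → Vector Carrier n
    probe u i = half * s i + half * power A t u i

    s-isDistribution : IsDistribution s
    s-isDistribution = endpoint-isDistribution (stochastic M) t

    probe-isDistribution : ∀ u → IsDistribution (probe u)
    probe-isDistribution u = record
      { nonNegative = λ i → +-nonNegative
          (*-nonNegative 0≤half (IsDistribution.nonNegative s-isDistribution i))
          (*-nonNegative 0≤half (IsDistribution.nonNegative walk-isDistribution i))
      ; total = trans (sum-+ {n} _ _)
          (trans (+-cong (trans (sum-*ˡ {n} half _) (trans (*-congˡ (IsDistribution.total s-isDistribution)) (*-identityʳ half)))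
                         (trans (sum-*ˡ {n} half _) (trans (*-congˡ (IsDistribution.total walk-isDistribution)) (*-identityʳ half))))
                 half+half)
      }
      where
      walk-isDistribution : IsDistribution (power A t u)
      walk-isDistribution = power-stochastic (stochastic M) t u

    distance-probe : ∀ u → fromℕ 2 * distance (probe u) s ≈ distance (power A t u) s
    distance-probe u = trans (sym (sum-*ˡ {n} (fromℕ 2) _)) (sum-cong {n} λ i →
      trans (sym (∣c*x∣≈c*∣x∣ (probe u i - s i) (fromℕ-nonNegative 2)))
            (∣∣-cong (trans (solve 4 (λ z h a b → z :* ((h :* a :+ h :* b) :- a) := (z :* h) :* (a :+ b) :- z :* a)
                               refl (fromℕ 2) half (s i) (power A t u i))
                      (trans (+-congʳ (*-congʳ 2*half))
                      (solve 2 (λ a b → con (+ 1) :* (a :+ b) :- con (+ 2) :* a := b :- a) refl (s i) (power A t u i))))))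

    mixing⇒probe-near : ∀ {φ} → Mixing M φ t → ∀ u → distance (probe u) s ≤ φ
    mixing⇒probe-near {φ} (s′ , s′-dist , near) u = *-cancelˡ-≤ (fromℕ-positive 2) (begin
      fromℕ 2 * distance (probe u) s
        ≈⟨ distance-probe u ⟩
      distance (power A t u) s
        ≤⟨ distance-triangle (power A t u) s′ s ⟩
      distance (power A t u) s′ + distance s′ s
        ≈⟨ +-congˡ (distance-sym s′ s) ⟩
      distance (power A t u) s′ + distance s s′
        ≤⟨ +-mono-≤ (walk-near u)
             (≤-trans (distance-convexˡ (power A t) s′ (uniformly-isDistribution n))
             (≤-trans (expect-mono-≤ (uniformly-isDistribution n) walk-near)
                      (≤-reflexive (expect-const φ (uniformly-isDistribution n))))) ⟩
      φ + φ
        ≈⟨ solve 1 (λ x → x :+ x := con (+ 2) :* x) refl φ ⟩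
      fromℕ 2 * φ ∎)
      where
      walk-near : ∀ v → distance (power A t v) s′ ≤ φ
      walk-near v = ≤-respˡ (distance-congˡ (walk≈power M t v)) (near v)

  module Far {n d} .{{_ : NonZero n}} (M : MarkovChain n d) (t : ℕ) .{{_ : NonZero t}}
    (ε : Carrier) (0<ε : 0# < ε) where

    open Probes M t public

    private
      A : Matrix n
      A = matrix M

    -- The tester rejects these states with probability at least 1 - δ. Nothing
    -- is known about its verdicts on the others.
    Bad : Fin n → Set _
    Bad u = ε < distance (probe u) (endpoint A t)

    bad? : ∀ u → Dec (Bad u)
    bad? u = ε <? distance (probe u) (endpoint A t)

    open Hitting F A (stochastic M) Bad bad? public

    private
      good-near : ∀ {u} → ¬ Bad u → distance (power A t u) (endpoint A t) ≤ fromℕ 2 * ε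
      good-near {u} ¬bad = ≤-respˡ (distance-probe u) (*-monoʳ-≤ (fromℕ-nonNegative 2) (≮⇒≥ ¬bad))

      -- The state whose walks of 2t steps are the least likely to meet a bad
      -- state. It need not be good by definition.
      w : Fin n
      w = proj₁ (least (hit (t ℕ.+ t)))

      hit-w≤risk : hit (t ℕ.+ t) w ≤ risk t
      hit-w≤risk = ≤-respˡ (expect-const _ (uniformly-isDistribution n))
        (expect-mono-≤ (uniformly-isDistribution n) (proj₂ (least (hit (t ℕ.+ t)))))

      open Redirect w

      M̃ : MarkovChain n d
      M̃ = record
        { matrix = redirected ; stochastic = redirected-stochastic ; sparse = redirected-sparse (sparse M) }

      differ : Carrier
      differ = fromℕ (differingEntries A redirected)

      badStates : ℕ
      badStates = length (filter bad? (allFin n))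

      differingEntries≤ : differingEntries A redirected ℕ.≤ badStates ℕ.* (d ℕ.+ d)
      differingEntries≤ = count-rows (λ (i , j) → ¬? (A i j ≟ redirected i j)) bad? (d ℕ.+ d) (allFin n)
        (λ x y ¬bad A≉ → A≉ (reflexive (≡.cong (λ r → r y) (≡.sym (redirected-good ¬bad)))))
        (λ x → ℕ.≤-trans
          (count-≤ (λ (i , j) → ¬? (A i j ≟ redirected i j)) (λ y → ¬? (A x y ≟ 0#)) (λ y → ¬? (redirected x y ≟ 0#))
                   (x ,_) (nonzero x) (allFin n))
          (ℕ.+-mono-≤ (sparse M x) (redirected-sparse (sparse M) x)))
        (allFin n)
        where
        nonzero : ∀ x y → ¬ A x y ≈ redirected x y → ¬ A x y ≈ 0# ⊎ ¬ redirected x y ≈ 0#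
        nonzero x y A≉ with A x y ≟ 0# | redirected x y ≟ 0#
        ... | no A≉0  | _        = inj₁ A≉0
        ... | yes _   | no Ã≉0   = inj₂ Ã≉0
        ... | yes A≈0 | yes Ã≈0  = contradiction (trans A≈0 (sym Ã≈0)) A≉

      -- A uniform state is bad with probability at most the risk.
      badStates≤ : fromℕ badStates ≤ fromℕ n * risk t
      badStates≤ = begin
        fromℕ badStates
          ≤⟨ count≤sum bad? (hit (t ℕ.+ t)) (hit-nonNegative (t ℕ.+ t)) (hit-bad (t ℕ.+ t)) (λ i → i) ⟩
        sum (hit (t ℕ.+ t))
          ≈⟨ *-identityˡ _ ⟨
        1# * sum (hit (t ℕ.+ t))
          ≈⟨ *-congʳ (*-/-cancel 1# (fromℕ-positive n)) ⟨
        fromℕ n * (1# / fromℕ n) * sum (hit (t ℕ.+ t))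
          ≈⟨ *-assoc _ _ _ ⟩
        fromℕ n * ((1# / fromℕ n) * sum (hit (t ℕ.+ t)))
          ≈⟨ *-congˡ (sum-*ˡ {n} (1# / fromℕ n) (hit (t ℕ.+ t))) ⟨
        fromℕ n * risk t ∎

      0<dn : 0# < fromℕ d * fromℕ n
      0<dn = *-positive (degree-positive M) (fromℕ-positive n)

      -- A changed row differs from the old one where either is nonzero, in at
      -- most 2d entries.
      close-entries : fromℕ 2 * risk t ≤ ε * ε → ε ≤ 1# → differ / (fromℕ d * fromℕ n) ≤ fromℕ 2 * ε
      close-entries 2risk≤ε² ε≤1 = /-≤ 0<dn (begin
        fromℕ (differingEntries A redirected)
          ≤⟨ fromℕ-mono-≤ differingEntries≤ ⟩
        fromℕ (badStates ℕ.* (d ℕ.+ d))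
          ≈⟨ trans (fromℕ-* badStates (d ℕ.+ d)) (*-congˡ (fromℕ-+ d d)) ⟩
        fromℕ badStates * (fromℕ d + fromℕ d)
          ≤⟨ *-monoˡ-≤ (+-nonNegative (fromℕ-nonNegative d) (fromℕ-nonNegative d)) badStates≤ ⟩
        fromℕ n * risk t * (fromℕ d + fromℕ d)
          ≈⟨ solve 3 (λ n q d → n :* q :* (d :+ d) := d :* n :* (con (+ 2) :* q)) refl (fromℕ n) (risk t) (fromℕ d) ⟩
        fromℕ d * fromℕ n * (fromℕ 2 * risk t)
          ≤⟨ *-monoʳ-≤ (<⇒≤ 0<dn) (≤-trans 2risk≤ε² ε²≤2ε) ⟩
        fromℕ d * fromℕ n * (fromℕ 2 * ε) ∎)
        where
        ε²≤2ε : ε * ε ≤ fromℕ 2 * ε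
        ε²≤2ε = ≤-by (ε * (1# - ε) + ε) (+-nonNegative (*-nonNegative (<⇒≤ 0<ε) (≤⇒0≤- ε≤1)) (<⇒≤ 0<ε))
          (solve 1 (λ e → con (+ 2) :* e := e :* e :+ (e :* (con (+ 1) :- e) :+ e)) refl ε)

      1≤101/100 : 1# ≤ fromℕ 101 / fromℕ 100
      1≤101/100 = ≤-/ (fromℕ-positive 100)
        (≤-respˡ (sym (*-identityʳ (fromℕ 100))) (fromℕ-mono-≤ {100} {101} (ℕ.n≤1+n 100)))

      ε≤1·01ε : ε ≤ fromℕ 101 / fromℕ 100 * ε
      ε≤1·01ε = ≤-respˡ (*-identityˡ ε) (*-monoˡ-≤ (<⇒≤ 0<ε) 1≤101/100)

      close-averages : fromℕ 2 * risk t ≤ ε * ε → ε ≤ 1# →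
        distance (average M t) (average M̃ t) ≤ fromℕ 101 / fromℕ 100 * ε
      close-averages 2risk≤ε² ε≤1 = begin
        distance (average M t) (average M̃ t)
          ≈⟨ distance-cong (average≈endpoint M t) (average≈endpoint M̃ t) ⟩
        distance (endpoint A t) (endpoint redirected t)
          ≤⟨ distance-convex (power A t) (power redirected t) (IsDistribution.nonNegative (uniformly-isDistribution n)) ⟩
        expect (uniformly n) (λ u → distance (power A t u) (power redirected t u))
          ≤⟨ expect-mono-≤ (uniformly-isDistribution n) (λ u → ≤-respˡ (distance-sym (power redirected t u) (power A t u))
               (≤-trans (redirected-deviation t u)
                        (*-monoʳ-≤ (fromℕ-nonNegative 2) (hit-mono (ℕ.m≤m+n t t) u)))) ⟩
        expect (uniformly n) (λ u → fromℕ 2 * hit (t ℕ.+ t) u)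
          ≈⟨ expect-scale (fromℕ 2) (uniformly n) (hit (t ℕ.+ t)) ⟩
        fromℕ 2 * risk t
          ≤⟨ 2risk≤ε² ⟩
        ε * ε
          ≤⟨ ≤-by (ε * (1# - ε)) (*-nonNegative (<⇒≤ 0<ε) (≤⇒0≤- ε≤1))
               (solve 1 (λ e → e := e :* e :+ e :* (con (+ 1) :- e)) refl ε) ⟩
        ε
          ≤⟨ ε≤1·01ε ⟩
        fromℕ 101 / fromℕ 100 * ε ∎

      0<t : 0 ℕ.< t
      0<t = ℕ.>-nonZero⁻¹ t

      redirected-is-mixing : fromℕ 2 * risk t ≤ ε * ε → ε ≤ 1# → Mixing M̃ (fromℕ 4 * ε) (2 ℕ.* t)
      redirected-is-mixing 2risk≤ε² ε≤1 =
        ≡.subst (Mixing M̃ (fromℕ 4 * ε)) (≡.cong (t ℕ.+_) (≡.sym (ℕ.+-identityʳ t)))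
          (endpoint A t , s-isDistribution , λ u →
            ≤-respˡ (sym (distance-congˡ (walk≈power M̃ (t ℕ.+ t) u)))
                    (redirected-mixing hit-w≤risk 2risk≤ε² u))
        where open Mixed t 0<t ε (<⇒≤ 0<ε) ε≤1 good-near

      redirected-is-close : fromℕ 2 * risk t ≤ ε * ε → ε ≤ 1# →
        Close t M M̃ (fromℕ 2 * ε) (fromℕ 101 / fromℕ 100 * ε)
      redirected-is-close 2risk≤ε² ε≤1 =
        differ / (fromℕ d * fromℕ n) , distance (average M t) (average M̃ t) ,
        (trans (sym (trans (*-comm _ _) (*-/-cancel differ 0<dn))) (sym (*-assoc _ _ _)) , refl) ,
        close-entries 2risk≤ε² ε≤1 , close-averages 2risk≤ε² ε≤1

      -- No distance exceeds 2, so that for ε ≥ 1 there is nothing to change.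
      trivially-mixing : 1# ≤ ε → Mixing M (fromℕ 4 * ε) (2 ℕ.* t)
      trivially-mixing 1≤ε = endpoint A t , s-isDistribution , λ u → begin
        distance (walk M (2 ℕ.* t) u) (endpoint A t)
          ≈⟨ distance-congˡ (walk≈power M (2 ℕ.* t) u) ⟩
        distance (power A (2 ℕ.* t) u) (endpoint A t)
          ≤⟨ distance≤2 (power-stochastic (stochastic M) (2 ℕ.* t) u) s-isDistribution ⟩
        fromℕ 2
          ≤⟨ fromℕ-mono-≤ {2} {4} (ℕ.s≤s (ℕ.s≤s ℕ.z≤n)) ⟩
        fromℕ 4
          ≈⟨ *-identityʳ (fromℕ 4) ⟨
        fromℕ 4 * 1#
          ≤⟨ *-monoʳ-≤ (fromℕ-nonNegative 4) 1≤ε ⟩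
        fromℕ 4 * ε ∎

      trivially-close : Close t M M (fromℕ 2 * ε) (fromℕ 101 / fromℕ 100 * ε)
      trivially-close = 0# , 0# ,
        (trans (reflexive (≡.cong fromℕ (count-none (λ (i , j) → ¬? (A i j ≟ A i j)) (λ _ A≉A → A≉A refl)
                  (cartesianProduct (allFin n) (allFin n)))))
               (sym (trans (*-congʳ (zeroˡ (fromℕ d))) (zeroˡ (fromℕ n))))
        , distance-refl (average M t)) ,
        *-nonNegative (fromℕ-nonNegative 2) (<⇒≤ 0<ε) ,
        ≤-trans (<⇒≤ 0<ε) ε≤1·01ε

    -- Redirecting the bad states gives a mixing chain close to M unless the
    -- bad states are met often.
    far⇒risky :
      (∀ (M̃ : MarkovChain n d) → Mixing M̃ (fromℕ 4 * ε) (2 ℕ.* t) →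
       ¬ Close t M M̃ (fromℕ 2 * ε) (fromℕ 101 / fromℕ 100 * ε)) →
      ε * ε ≤ fromℕ 2 * risk t
    far⇒risky far with ≤-total (ε * ε) (fromℕ 2 * risk t) | ≤-total ε 1#
    ... | inj₁ ε²≤2risk | _        = ε²≤2risk
    ... | inj₂ 2risk≤ε² | inj₁ ε≤1 = contradiction (redirected-is-close 2risk≤ε² ε≤1)
                                       (far M̃ (redirected-is-mixing 2risk≤ε² ε≤1))
    ... | inj₂ 2risk≤ε² | inj₂ 1≤ε = contradiction trivially-close (far M (trivially-mixing 1≤ε))

-- The random process behind the test

-- The test as a random process on states and counters, in which the runs of the
-- tester in the state u are replaced by coins that accept with probability α u
-- and reject with probability β u.
module Process {c ℓ₁ ℓ₂} (F : ArchimedeanField c ℓ₁ ℓ₂)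
  {n : ℕ} .{{_ : NonZero n}} (A : Fin n → Fin n → ArchimedeanField.Carrier F)
  (A-stochastic : Chains.Stochastic F A) (t : ℕ)
  (α β : Fin n → ArchimedeanField.Carrier F)
  (0≤α : ∀ u → ArchimedeanField._≤_ F (ArchimedeanField.0# F) (α u))
  (0≤β : ∀ u → ArchimedeanField._≤_ F (ArchimedeanField.0# F) (β u))
  (α+β≈1 : ∀ u → ArchimedeanField._≈_ F (ArchimedeanField._+_ F (α u) (β u)) (ArchimedeanField.1# F))
  where

  open OrderedField F
  open Testing F
  open Chains F
  open ExpProperties (CommutativeRing.commutativeSemiring commutativeRing)
    using (^-assocʳ; ^-distrib-*)

  private
    -- The number of states met in a round.
    width : ℕ
    width = suc (t ℕ.+ t)

  mutual
    -- The probability of verdict w when b runs of the tester may still be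
    -- spent, r rounds have not yet been started, the present round has p
    -- more steps, and the present state u needs l + 1 more acceptances than
    -- rejections to be cleared.
    -- The budget is decreased in each run, and the test rejects when it is
    -- spent.
    value : Verdict → (b r p l : ℕ) → Fin n → Carrier
    value w zero    r p l u = indicator w reject
    value w (suc b) r p l u = α u * cleared w b r p l u + β u * value w b r p (suc l) u

    -- The same after a run has accepted u.
    cleared : Verdict → (b r p l : ℕ) → Fin n → Carrier
    cleared w b r p zero    u = advance w b r p u
    cleared w b r p (suc l) u = value w b r p l u

    -- The same after u has been cleared.
    advance : Verdict → (b r p : ℕ) → Fin n → Carrier
    advance w b r       (suc p) u = expect (A u) (λ v → value w b r p 0 v)
    advance w b (suc r) zero    u = expect (uniformly n) (λ v → value w b r (t ℕ.+ t) 0 v)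
    advance w b zero    zero    u = indicator w accept

  -- A weighted average of two upper bounds on failure probabilities.
  combine : ∀ {x y} u z X Y →
    1# - X ≤ x → 1# - Y ≤ y → α u * X + β u * Y ≤ z → 1# - z ≤ α u * x + β u * y
  combine {x} {y} u z X Y X≤x Y≤y bound = begin
    1# - z
      ≤⟨ minus-monoʳ-≤ 1# bound ⟩
    1# - (α u * X + β u * Y)
      ≈⟨ +-congʳ (α+β≈1 u) ⟨
    (α u + β u) - (α u * X + β u * Y)
      ≈⟨ solve 4 (λ a b x y → (a :+ b) :- (a :* x :+ b :* y) :=
            a :* (con (+ 1) :- x) :+ b :* (con (+ 1) :- y)) refl (α u) (β u) X Y ⟩
    α u * (1# - X) + β u * (1# - Y)
      ≤⟨ +-mono-≤ (*-monoʳ-≤ (0≤α u) X≤x) (*-monoʳ-≤ (0≤β u) Y≤y) ⟩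
    α u * x + β u * y ∎

  -- Acceptance when no state is likely to be rejected

  module Accepting (6β≤1 : ∀ u → fromℕ 6 * β u ≤ 1#) where

    private
      ρ : Carrier
      ρ = 1# - 1# / fromℕ 4

      4ρ≈3 : fromℕ 4 * ρ ≈ fromℕ 3
      4ρ≈3 = trans (solve 1 (λ q → con (+ 4) :* (con (+ 1) :- q) := con (+ 4) :- con (+ 4) :* q) refl (1# / fromℕ 4))
        (trans (+-congˡ (-‿cong (*-/-cancel 1# (fromℕ-positive 4))))
               (solve 0 (con (+ 4) :- con (+ 1) := con (+ 3)) refl))

      0≤¼ : 0# ≤ 1# / fromℕ 4
      0≤¼ = /-nonNegative 0≤1 (fromℕ-positive 4)

      ¼≤1 : 1# / fromℕ 4 ≤ 1#
      ¼≤1 = /-≤ (fromℕ-positive 4) (≤-respʳ (sym (*-identityʳ (fromℕ 4))) (1≤fromℕ {4} (ℕ.s≤s ℕ.z≤n)))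

      0≤ρ : 0# ≤ ρ
      0≤ρ = ≤⇒0≤- ¼≤1

    -- The number of pending clearances decreases by one with probability at
    -- least 5/6 in each run and else increases by one, so that 2 to this
    -- number decreases at least by the factor 3/4 on average.
    potential : (L b : ℕ) → Carrier
    potential L b = fromℕ 2 ^ L * ρ ^ b

    potential-nonNegative : ∀ L b → 0# ≤ potential L b
    potential-nonNegative L b = *-nonNegative (^-nonNegative L (fromℕ-nonNegative 2)) (^-nonNegative b 0≤ρ)

    -- The clearances needed after those of the present state.
    pending : (r p : ℕ) → ℕ
    pending r p = r ℕ.* width ℕ.+ p

    private
      1≤2^ : ∀ L → 1# ≤ fromℕ 2 ^ L
      1≤2^ zero    = ≤-refl
      1≤2^ (suc L) = ≤-respˡ (*-identityʳ 1#)
        (*-mono-≤ 0≤1 (^-nonNegative L (fromℕ-nonNegative 2)) (1≤fromℕ {2} (ℕ.s≤s ℕ.z≤n)) (1≤2^ L))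

      potential-decreases : ∀ u L b →
        α u * potential L b + β u * potential (suc (suc L)) b ≤ potential (suc L) (suc b)
      potential-decreases u L b = *-cancelˡ-≤ (fromℕ-positive 2)
        (≤-by (φ * (1# - fromℕ 6 * β u)) (*-nonNegative (potential-nonNegative L b) (≤⇒0≤- (6β≤1 u)))
          (trans (solve 3 (λ x y r → con (+ 2) :* ((con (+ 2) :* x) :* (r :* y)) := (con (+ 4) :* r) :* (x :* y))
                    refl (fromℕ 2 ^ L) (ρ ^ b) ρ)
          (trans (*-congʳ 4ρ≈3)
          (trans (solve 2 (λ b φ → con (+ 3) :* φ :=
                    con (+ 2) :* (con (+ 1) :* φ :+ con (+ 3) :* b :* φ) :+ φ :* (con (+ 1) :- con (+ 6) :* b)) refl (β u) φ)
          (trans (+-congʳ (*-congˡ (+-congʳ (*-congʳ (sym (α+β≈1 u))))))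
                 (solve 4 (λ a b x y → con (+ 2) :* ((a :+ b) :* (x :* y) :+ con (+ 3) :* b :* (x :* y))
                    :+ x :* y :* (con (+ 1) :- con (+ 6) :* b) :=
                    con (+ 2) :* (a :* (x :* y) :+ b :* ((con (+ 2) :* (con (+ 2) :* x)) :* y))
                    :+ x :* y :* (con (+ 1) :- con (+ 6) :* b)) refl (α u) (β u) (fromℕ 2 ^ L) (ρ ^ b)))))))
        where φ = potential L b

      1-mono : ∀ {L L′} b → L ≡ L′ → ∀ {x} → 1# - potential L b ≤ x → 1# - potential L′ b ≤ x
      1-mono b ≡.refl bound = bound

    -- The test fails to accept with probability at most the potential.
    mutual
      value-accept : ∀ b r p l u → 1# - potential (suc (pending r p ℕ.+ l)) b ≤ value accept b r p l u
      value-accept zero r p l u = 0≤-⇒≤ (≤-respʳ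
        (solve 1 (λ x → x :- con (+ 1) := con (+ 0) :- (con (+ 1) :- x :* con (+ 1))) refl (fromℕ 2 ^ suc (pending r p ℕ.+ l)))
        (≤⇒0≤- (1≤2^ (suc (pending r p ℕ.+ l)))))
      value-accept (suc b) r p l u = combine u _ _ _
        (cleared-accept b r p l u)
        (1-mono b (≡.cong suc (ℕ.+-suc (pending r p) l)) (value-accept b r p (suc l) u))
        (potential-decreases u (pending r p ℕ.+ l) b)

      cleared-accept : ∀ b r p l u → 1# - potential (pending r p ℕ.+ l) b ≤ cleared accept b r p l u
      cleared-accept b r p zero    u = 1-mono b (≡.sym (ℕ.+-identityʳ (pending r p))) (advance-accept b r p u)
      cleared-accept b r p (suc l) u = 1-mono b (≡.sym (ℕ.+-suc (pending r p) l)) (value-accept b r p l u)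

      advance-accept : ∀ b r p u → 1# - potential (pending r p) b ≤ advance accept b r p u
      advance-accept b r (suc p) u =
        ≤-respˡ (expect-const _ (A-stochastic u)) (expect-mono-≤ (A-stochastic u) λ v →
          1-mono b (lemma r p width) (value-accept b r p 0 v))
        where
        lemma : ∀ r p w → suc (r ℕ.* w ℕ.+ p ℕ.+ 0) ≡ r ℕ.* w ℕ.+ suc p
        lemma = solve-∀
      advance-accept b (suc r) zero u =
        ≤-respˡ (expect-const _ (uniformly-isDistribution n)) (expect-mono-≤ (uniformly-isDistribution n) λ v →
          1-mono b (lemma r t) (value-accept b r (t ℕ.+ t) 0 v))
        where
        lemma : ∀ r t → suc (r ℕ.* suc (t ℕ.+ t) ℕ.+ (t ℕ.+ t) ℕ.+ 0) ≡ suc r ℕ.* suc (t ℕ.+ t) ℕ.+ 0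
        lemma = solve-∀
      advance-accept b zero zero u =
        ≤-by (potential 0 b) (potential-nonNegative 0 b)
             (solve 1 (λ x → con (+ 1) := (con (+ 1) :- x) :+ x) refl (potential 0 b))

    -- With 20 runs for each pending clearance the budget hardly ever runs out.
    potential≤⅓ : ∀ N → 1 ℕ.≤ N → fromℕ 3 * potential N (20 ℕ.* N) ≤ 1#
    potential≤⅓ N 1≤N = begin
      fromℕ 3 * (fromℕ 2 ^ N * ρ ^ (20 ℕ.* N))
        ≈⟨ *-congˡ (*-congˡ (sym (^-assocʳ ρ 20 N))) ⟩
      fromℕ 3 * (fromℕ 2 ^ N * (ρ ^ 20) ^ N)
        ≈⟨ *-congˡ (^-distrib-* (fromℕ 2) (ρ ^ 20) N) ⟨
      fromℕ 3 * x ^ N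
        ≤⟨ *-monoʳ-≤ (fromℕ-nonNegative 3) (x^N≤x N 1≤N) ⟩
      fromℕ 3 * x
        ≤⟨ 3x≤1 ⟩
      1# ∎
      where
      x : Carrier
      x = fromℕ 2 * ρ ^ 20

      0≤x : 0# ≤ x
      0≤x = *-nonNegative (fromℕ-nonNegative 2) (^-nonNegative 20 0≤ρ)

      20*¼≈5 : fromℕ 20 * (1# / fromℕ 4) ≈ fromℕ 5
      20*¼≈5 = trans (solve 1 (λ q → con (+ 20) :* q := con (+ 5) :* (con (+ 4) :* q)) refl (1# / fromℕ 4))
        (trans (*-congˡ (*-/-cancel 1# (fromℕ-positive 4))) (*-identityʳ (fromℕ 5)))

      -- Bernoulli's inequality bounds the twentieth power of 3/4 by 1/6.
      3x≤1 : fromℕ 3 * x ≤ 1#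
      3x≤1 = ≤-respˡ
        (trans (*-congʳ (+-congˡ 20*¼≈5))
               (solve 1 (λ y → (con (+ 1) :+ con (+ 5)) :* y := con (+ 3) :* (con (+ 2) :* y)) refl (ρ ^ 20)))
        (bernoulli 20 0≤¼ ¼≤1)

      x≤1 : x ≤ 1#
      x≤1 = ≤-trans (≤-respˡ (*-identityˡ x) (*-monoˡ-≤ 0≤x (1≤fromℕ {3} (ℕ.s≤s ℕ.z≤n)))) 3x≤1

      x^N≤x : ∀ N → 1 ℕ.≤ N → x ^ N ≤ x
      x^N≤x (suc N) _ = ≤-respʳ (*-identityʳ x) (*-monoʳ-≤ 0≤x (^-≤1 N 0≤x x≤1))

    accepting : ∀ K u → 1 ℕ.≤ K →
      fromℕ 2 / fromℕ 3 ≤ advance accept (20 ℕ.* (K ℕ.* width)) K 0 u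
    accepting K u 1≤K = ≤-trans
      (/-≤ (fromℕ-positive 3) (begin
        fromℕ 2
          ≤⟨ ≤-by (1# - fromℕ 3 * φ) (≤⇒0≤- (potential≤⅓ (K ℕ.* width) (ℕ.*-mono-≤ 1≤K (ℕ.s≤s ℕ.z≤n))))
               (solve 1 (λ x → con (+ 3) :* (con (+ 1) :- x) := con (+ 2) :+ (con (+ 1) :- con (+ 3) :* x)) refl φ) ⟩
        fromℕ 3 * (1# - φ) ∎))
      (1-mono (20 ℕ.* (K ℕ.* width)) (ℕ.+-identityʳ (K ℕ.* width)) enough-accepted)
      where
      φ : Carrier
      φ = potential (K ℕ.* width) (20 ℕ.* (K ℕ.* width))

      enough-accepted : 1# - potential (pending K 0) (20 ℕ.* (K ℕ.* width)) ≤ advance accept (20 ℕ.* (K ℕ.* width)) K 0 u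
      enough-accepted = advance-accept (20 ℕ.* (K ℕ.* width)) K 0 u

  -- Rejection when bad states are met often

  module Rejecting {b} (Bad : Fin n → Set b) (bad? : ∀ u → Dec (Bad u))
    (6α≤1 : ∀ {u} → Bad u → fromℕ 6 * α u ≤ 1#) where

    open Hitting F A A-stochastic Bad bad?

    private
      half≤1 : half ≤ 1#
      half≤1 = /-≤ (fromℕ-positive 2) (≤-respʳ (sym (*-identityʳ (fromℕ 2))) (1≤fromℕ {2} (ℕ.s≤s ℕ.z≤n)))

      half-≤1 : ∀ {x} → 0# ≤ x → x ≤ 1# → half * x ≤ 1#
      half-≤1 0≤x x≤1 = ≤-respʳ (*-identityʳ 1#) (*-mono-≤ 0≤half 0≤1 half≤1 x≤1)

      ρ : Carrier
      ρ = 1# - half * risk t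

      risk≤1 : risk t ≤ 1#
      risk≤1 = ≤-respʳ (expect-const 1# (uniformly-isDistribution n))
        (expect-mono-≤ (uniformly-isDistribution n) (hit≤1 (t ℕ.+ t)))

      0≤risk : 0# ≤ risk t
      0≤risk = sum-nonNegative {n} λ u → *-nonNegative
        (IsDistribution.nonNegative (uniformly-isDistribution n) u) (hit-nonNegative (t ℕ.+ t) u)

      0≤ρ : 0# ≤ ρ
      0≤ρ = ≤⇒0≤- (half-≤1 0≤risk risk≤1)

      0≤ρ^ : ∀ r → 0# ≤ ρ ^ r
      0≤ρ^ r = ^-nonNegative r 0≤ρ

      -- A bound on the probability that the remaining p steps of a round are
      -- passed after the clearance of u, when meeting a bad state in them ends
      -- the round with probability at least 1/2.
      onward : ℕ → Fin n → Carrier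
      onward zero    u = 1#
      onward (suc p) u = 1# - half * expect (A u) (hit p)

      onward≤1 : ∀ p u → onward p u ≤ 1#
      onward≤1 zero    u = ≤-refl
      onward≤1 (suc p) u = ≤-by (half * expect (A u) (hit p))
        (*-nonNegative 0≤half (sum-nonNegative {n} λ v →
          *-nonNegative (IsDistribution.nonNegative (A-stochastic u) v) (hit-nonNegative p v)))
        (solve 1 (λ x → con (+ 1) := (con (+ 1) :- x) :+ x) refl (half * expect (A u) (hit p)))

      -- The same when u still needs l + 1 clearances, each of which a bad state
      -- obtains with probability at most 1/2, independently of the past.
      escape : (l p : ℕ) → Fin n → Carrier
      escape l p u = if does (bad? u) then half ^ suc l else onward p u

      escape-bad : ∀ l p {u} → Bad u → escape l p u ≡ half ^ suc l
      escape-bad l p {u} bad with bad? u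
      ... | yes _   = ≡.refl
      ... | no ¬bad = contradiction bad ¬bad

      escape-good : ∀ l p {u} → ¬ Bad u → escape l p u ≡ onward p u
      escape-good l p {u} ¬bad with bad? u
      ... | yes bad = contradiction bad ¬bad
      ... | no _    = ≡.refl

      escape-zero : ∀ p u → escape 0 p u ≈ 1# - half * hit p u
      escape-zero p u = cases p (bad? u)
        where
        cases : ∀ p → Dec (Bad u) → escape 0 p u ≈ 1# - half * hit p u
        cases p (yes bad) = begin-equality
          escape 0 p u                  ≈⟨ reflexive (escape-bad 0 p bad) ⟩
          half * 1#                     ≈⟨ solve 1 (λ h → h :* con (+ 1) := con (+ 2) :* h :- h :* con (+ 1)) refl half ⟩
          fromℕ 2 * half - half * 1#    ≈⟨ +-cong 2*half (-‿cong (*-congˡ (sym (hit-bad p bad)))) ⟩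
          1# - half * hit p u           ∎
        cases zero (no ¬bad) = begin-equality
          escape 0 0 u          ≈⟨ reflexive (escape-good 0 0 ¬bad) ⟩
          1#                    ≈⟨ solve 1 (λ h → con (+ 1) := con (+ 1) :- h :* con (+ 0)) refl half ⟩
          1# - half * 0#        ≈⟨ +-congˡ (-‿cong (*-congˡ (sym (hit-zero ¬bad)))) ⟩
          1# - half * hit 0 u   ∎
        cases (suc p) (no ¬bad) = begin-equality
          escape 0 (suc p) u                 ≈⟨ reflexive (escape-good 0 (suc p) ¬bad) ⟩
          1# - half * expect (A u) (hit p)   ≈⟨ +-congˡ (-‿cong (*-congˡ (sym (hit-suc p ¬bad)))) ⟩
          1# - half * hit (suc p) u          ∎

    -- The test escapes rejection only by clearing all bad states that it meets.
    mutual
      value-reject : ∀ b r p l u → 1# - escape l p u * ρ ^ r ≤ value reject b r p l u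
      value-reject zero r p l u = ≤-by (escape l p u * ρ ^ r) (*-nonNegative (nonNegative (bad? u)) (0≤ρ^ r))
        (solve 1 (λ x → con (+ 1) := (con (+ 1) :- x) :+ x) refl (escape l p u * ρ ^ r))
        where
        nonNegative : Dec (Bad u) → 0# ≤ escape l p u
        nonNegative (yes bad) = ≤-respʳ (reflexive (≡.sym (escape-bad l p bad))) (^-nonNegative (suc l) 0≤half)
        nonNegative (no ¬bad) = ≤-respʳ
          (trans (sym (escape-zero p u)) (reflexive (≡.trans (escape-good 0 p ¬bad) (≡.sym (escape-good l p ¬bad)))))
          (≤⇒0≤- (half-≤1 (hit-nonNegative p u) (hit≤1 p u)))
      value-reject (suc b) r p l u = cases (bad? u)
        where
        cases : Dec (Bad u) → 1# - escape l p u * ρ ^ r ≤ value reject (suc b) r p l u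
        cases (yes bad) = combine u _ _ _ (cleared-bad b r p l bad)
          (≤-respˡ (+-congˡ (-‿cong (*-congʳ (reflexive (escape-bad (suc l) p bad))))) (value-reject b r p (suc l) u))
          (≤-respʳ (*-congʳ (reflexive (≡.sym (escape-bad l p bad)))) (*-cancelˡ-≤ (fromℕ-positive 4)
            (≤-by (half ^ l * ρ ^ r * (1# - fromℕ 6 * α u + fromℕ 3 * α u))
              (*-nonNegative (*-nonNegative (^-nonNegative l 0≤half) (0≤ρ^ r))
                (+-nonNegative (≤⇒0≤- (6α≤1 bad)) (*-nonNegative (fromℕ-nonNegative 3) (0≤α u))))
              (balance (half ^ l) (ρ ^ r)))))
          where
          balance : ∀ z x → fromℕ 4 * ((half * z) * x) ≈
            fromℕ 4 * (α u * (z * x) + β u * ((half * (half * z)) * x)) + z * x * (1# - fromℕ 6 * α u + fromℕ 3 * α u)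
          balance z x = begin-equality
            fromℕ 4 * ((half * z) * x)
              ≈⟨ solve 3 (λ h z x → con (+ 4) :* ((h :* z) :* x) := con (+ 2) :* (con (+ 2) :* h) :* (z :* x)) refl half z x ⟩
            fromℕ 2 * (fromℕ 2 * half) * (z * x)
              ≈⟨ *-congʳ (*-congˡ 2*half) ⟩
            fromℕ 2 * 1# * (z * x)
              ≈⟨ solve 3 (λ a z x → con (+ 2) :* con (+ 1) :* (z :* x) :=
                    (con (+ 4) :* a :+ con (+ 1) :- a) :* (z :* x) :+ z :* x :* (con (+ 1) :- con (+ 6) :* a :+ con (+ 3) :* a)) refl (α u) z x ⟩
            (fromℕ 4 * α u + 1# - α u) * (z * x) + rest
              ≈⟨ +-congʳ (*-congʳ (+-congʳ (+-congˡ (sym (α+β≈1 u))))) ⟩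
            (fromℕ 4 * α u + (α u + β u) - α u) * (z * x) + rest
              ≈⟨ +-congʳ (solve 4 (λ a b z x → (con (+ 4) :* a :+ (a :+ b) :- a) :* (z :* x) :=
                    con (+ 4) :* (a :* (z :* x)) :+ con (+ 1) :* con (+ 1) :* (b :* (z :* x))) refl (α u) (β u) z x) ⟩
            fromℕ 4 * (α u * (z * x)) + 1# * 1# * (β u * (z * x)) + rest
              ≈⟨ +-congʳ (+-congˡ (*-congʳ (*-cong (sym 2*half) (sym 2*half)))) ⟩
            fromℕ 4 * (α u * (z * x)) + (fromℕ 2 * half) * (fromℕ 2 * half) * (β u * (z * x)) + rest
              ≈⟨ +-congʳ (solve 5 (λ a b h z x →
                    con (+ 4) :* (a :* (z :* x)) :+ (con (+ 2) :* h) :* (con (+ 2) :* h) :* (b :* (z :* x)) :=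
                    con (+ 4) :* (a :* (z :* x) :+ b :* ((h :* (h :* z)) :* x))) refl (α u) (β u) half z x) ⟩
            fromℕ 4 * (α u * (z * x) + β u * ((half * (half * z)) * x)) + rest ∎
            where rest = z * x * (1# - fromℕ 6 * α u + fromℕ 3 * α u)
        cases (no ¬bad) = combine u _ _ _ (cleared-good b r p l ¬bad) (value-reject b r p (suc l) u)
          (≤-reflexive (begin-equality
            α u * (onward p u * ρ ^ r) + β u * (escape (suc l) p u * ρ ^ r)
              ≈⟨ +-congˡ (*-congˡ (*-congʳ (reflexive (escape-good (suc l) p ¬bad)))) ⟩
            α u * (onward p u * ρ ^ r) + β u * (onward p u * ρ ^ r)
              ≈⟨ distribʳ _ (α u) (β u) ⟨
            (α u + β u) * (onward p u * ρ ^ r)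
              ≈⟨ *-congʳ (α+β≈1 u) ⟩
            1# * (onward p u * ρ ^ r)
              ≈⟨ *-identityˡ _ ⟩
            onward p u * ρ ^ r
              ≈⟨ *-congʳ (reflexive (escape-good l p ¬bad)) ⟨
            escape l p u * ρ ^ r ∎))

      cleared-good : ∀ b r p l {u} → ¬ Bad u → 1# - onward p u * ρ ^ r ≤ cleared reject b r p l u
      cleared-good b r p zero    {u} ¬bad = advance-reject b r p u
      cleared-good b r p (suc l) {u} ¬bad =
        ≤-respˡ (+-congˡ (-‿cong (*-congʳ (reflexive (escape-good l p ¬bad))))) (value-reject b r p l u)

      cleared-bad : ∀ b r p l {u} → Bad u → 1# - half ^ l * ρ ^ r ≤ cleared reject b r p l u
      cleared-bad b r p zero    {u} bad =
        ≤-trans (minus-monoʳ-≤ 1# (*-monoˡ-≤ (0≤ρ^ r) (onward≤1 p u))) (advance-reject b r p u)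
      cleared-bad b r p (suc l) {u} bad =
        ≤-respˡ (+-congˡ (-‿cong (*-congʳ (reflexive (escape-bad l p bad))))) (value-reject b r p l u)

      advance-reject : ∀ b r p u → 1# - onward p u * ρ ^ r ≤ advance reject b r p u
      advance-reject b r (suc p) u = ≤-respˡ
        (average-escape (A-stochastic u) p r)
        (expect-mono-≤ (A-stochastic u) λ v → value-reject b r p 0 v)
      advance-reject b (suc r) zero u = ≤-respˡ
        (trans (average-escape (uniformly-isDistribution n) (t ℕ.+ t) r)
               (+-congˡ (-‿cong (sym (*-identityˡ (ρ * ρ ^ r))))))
        (expect-mono-≤ (uniformly-isDistribution n) λ v → value-reject b r (t ℕ.+ t) 0 v)
      advance-reject b zero zero u =
        ≤-reflexive (solve 0 (con (+ 1) :- con (+ 1) :* con (+ 1) := con (+ 0)) refl)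

      private
        average-escape : ∀ {q : Vector Carrier n} → IsDistribution q → ∀ p r →
          expect q (λ v → 1# - escape 0 p v * ρ ^ r) ≈ 1# - (1# - half * expect q (hit p)) * ρ ^ r
        average-escape {q} Q p r = trans
          (expect-cong {p = q} (λ _ → refl) λ v → trans (+-congˡ (-‿cong (*-congʳ (escape-zero p v))))
            (solve 3 (λ h e x → con (+ 1) :- (con (+ 1) :- h :* e) :* x := (con (+ 1) :- x) :+ (h :* x) :* e) refl half (hit p v) (ρ ^ r)))
          (trans (expect-affine (1# - ρ ^ r) (half * ρ ^ r) (hit p) Q)
            (solve 3 (λ h e x → (con (+ 1) :- x) :+ (h :* x) :* e := con (+ 1) :- (con (+ 1) :- h :* e) :* x) refl half (expect q (hit p)) (ρ ^ r)))

    rejecting : ∀ ε K b u → ε * ε ≤ fromℕ 2 * risk t → fromℕ 8 ≤ fromℕ K * (ε * ε) →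
      fromℕ 2 / fromℕ 3 ≤ advance reject b K 0 u
    rejecting ε K b u ε²≤2risk 8≤Kε² = ≤-trans
      (/-≤ (fromℕ-positive 3) (begin
        fromℕ 2
          ≤⟨ ≤-by (1# - fromℕ 3 * ρ ^ K) (≤⇒0≤- 3ρ^K≤1)
               (solve 1 (λ x → con (+ 3) :* (con (+ 1) :- con (+ 1) :* x) := con (+ 2) :+ (con (+ 1) :- con (+ 3) :* x)) refl (ρ ^ K)) ⟩
        fromℕ 3 * (1# - 1# * ρ ^ K) ∎))
      (advance-reject b K 0 u)
      where
      y : Carrier
      y = half * risk t

      2≤Ky : fromℕ 2 ≤ fromℕ K * y
      2≤Ky = *-cancelˡ-≤ (fromℕ-positive 4) (begin
        fromℕ 4 * fromℕ 2
          ≈⟨ solve 0 (con (+ 4) :* con (+ 2) := con (+ 8)) refl ⟩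
        fromℕ 8
          ≤⟨ 8≤Kε² ⟩
        fromℕ K * (ε * ε)
          ≤⟨ *-monoʳ-≤ (fromℕ-nonNegative K) ε²≤2risk ⟩
        fromℕ K * (fromℕ 2 * risk t)
          ≈⟨ solve 2 (λ k q → k :* (con (+ 2) :* q) := con (+ 1) :* (con (+ 2) :* (k :* q))) refl (fromℕ K) (risk t) ⟩
        1# * (fromℕ 2 * (fromℕ K * risk t))
          ≈⟨ *-congʳ (sym 2*half) ⟩
        fromℕ 2 * half * (fromℕ 2 * (fromℕ K * risk t))
          ≈⟨ solve 3 (λ h k q → con (+ 2) :* h :* (con (+ 2) :* (k :* q)) := con (+ 4) :* (k :* (h :* q))) refl half (fromℕ K) (risk t) ⟩
        fromℕ 4 * (fromℕ K * y) ∎)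

      3ρ^K≤1 : fromℕ 3 * ρ ^ K ≤ 1#
      3ρ^K≤1 = begin
        fromℕ 3 * ρ ^ K
          ≈⟨ *-congʳ (solve 0 (con (+ 3) := con (+ 1) :+ con (+ 2)) refl) ⟩
        (1# + fromℕ 2) * ρ ^ K
          ≤⟨ *-monoˡ-≤ (0≤ρ^ K) (+-monoʳ-≤ 1# 2≤Ky) ⟩
        (1# + fromℕ K * y) * ρ ^ K
          ≤⟨ bernoulli K (*-nonNegative 0≤half 0≤risk) (half-≤1 0≤risk risk≤1) ⟩
        1# ∎

-- Runs of the machine

module Machine {c ℓ₁ ℓ₂} (F : ArchimedeanField c ℓ₁ ℓ₂) where

  open OrderedField F
  open Testing F
  open Chains F

  module Runs {m n : ℕ} (O : Oracle m n) (O-dist : ∀ q → IsDistribution (O q)) where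

    mutual
      halts-suc : ∀ k C → HaltsWithin m n k C → HaltsWithin m n (suc k) C
      halts-suc (suc k) C h = haltsAfter-suc k (next C) h

      haltsAfter-suc : ∀ k (N : Next m n) → HaltsAfter m n k N → HaltsAfter m n (suc k) N
      haltsAfter-suc k (halted _) h = h
      haltsAfter-suc k (goto C)   h = halts-suc k C h
      haltsAfter-suc k (ask q C)  h = λ v → halts-suc k (C v) (h v)
      haltsAfter-suc k (toss j C) h = λ i → halts-suc k (C i) (h i)

    mutual
      Pr-suc : ∀ w k C → HaltsWithin m n k C → Pr O w (suc k) C ≈ Pr O w k C
      Pr-suc w (suc k) C h = PrAfter-suc w k (next C) h

      PrAfter-suc : ∀ w k (N : Next m n) → HaltsAfter m n k N → PrAfter O w (suc k) N ≈ PrAfter O w k N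
      PrAfter-suc w k (halted _) h = refl
      PrAfter-suc w k (goto C)   h = Pr-suc w k C h
      PrAfter-suc w k (ask q C)  h = sum-cong {n} λ v → *-congˡ (Pr-suc w k (C v) (h v))
      PrAfter-suc w k (toss j C) h = sum-cong {suc j} λ i → *-congˡ {1# / fromℕ (suc j)} (Pr-suc w k (C i) (h i))

    mutual
      Pr-total : ∀ k C → HaltsWithin m n k C → Pr O accept k C + Pr O reject k C ≈ 1#
      Pr-total (suc k) C h = PrAfter-total k (next C) h

      PrAfter-total : ∀ k (N : Next m n) → HaltsAfter m n k N →
        PrAfter O accept k N + PrAfter O reject k N ≈ 1#
      PrAfter-total k (halted accept) h = +-identityʳ 1#
      PrAfter-total k (halted reject) h = +-identityˡ 1#
      PrAfter-total k (goto C)   h = Pr-total k C h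
      PrAfter-total k (ask q C)  h = trans (sym (expect-+ (O q) _ _))
        (trans (expect-cong {p = O q} (λ _ → refl) (λ v → Pr-total k (C v) (h v))) (expect-const 1# (O-dist q)))
      PrAfter-total k (toss j C) h = trans
        (sym (expect-+ (uniformly (suc j)) (λ i → Pr O accept k (C i)) (λ i → Pr O reject k (C i))))
        (trans (expect-cong {p = uniformly (suc j)} (λ _ → refl) (λ i → Pr-total k (C i) (h i)))
               (expect-const 1# (uniformly-isDistribution (suc j))))

    mutual
      Pr-nonNegative : ∀ w k C → 0# ≤ Pr O w k C
      Pr-nonNegative w zero    C = ≤-refl
      Pr-nonNegative w (suc k) C = PrAfter-nonNegative w k (next C)

      PrAfter-nonNegative : ∀ w k (N : Next m n) → 0# ≤ PrAfter O w k N
      PrAfter-nonNegative accept k (halted accept) = 0≤1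
      PrAfter-nonNegative accept k (halted reject) = ≤-refl
      PrAfter-nonNegative reject k (halted accept) = ≤-refl
      PrAfter-nonNegative reject k (halted reject) = 0≤1
      PrAfter-nonNegative w k (goto C)   = Pr-nonNegative w k C
      PrAfter-nonNegative w k (ask q C)  = sum-nonNegative {n} λ v →
        *-nonNegative (IsDistribution.nonNegative (O-dist q) v) (Pr-nonNegative w k (C v))
      PrAfter-nonNegative w k (toss j C) = sum-nonNegative {suc j} λ i →
        *-nonNegative (IsDistribution.nonNegative (uniformly-isDistribution (suc j)) i) (Pr-nonNegative w k (C i))

    -- Yields w k C v means that the machine started in C always halts within k
    -- steps, and reaches the verdict w with probability at least v.
    record Yields (w : Verdict) (k : ℕ) (C : Configuration) (v : Carrier) : Set ℓ₂ where
      constructor yields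
      field
        halts : HaltsWithin m n k C
        bound : v ≤ Pr O w k C

    yields-≤ : ∀ {w k C v v′} → v ≤ v′ → Yields w k C v′ → Yields w k C v
    yields-≤ v≤v′ (yields h v′≤) = yields h (≤-trans v≤v′ v′≤)

    yields-≈ : ∀ {w k C v v′} → v ≈ v′ → Yields w k C v′ → Yields w k C v
    yields-≈ v≈v′ = yields-≤ (≤-reflexive v≈v′)

    yields-later : ∀ {w k k′ C v} → k ℕ.≤ k′ → Yields w k C v → Yields w k′ C v
    yields-later {w} {k} {k′} {C} {v} k≤k′ y = go (ℕ.≤⇒≤′ k≤k′)
      where
      go : ∀ {k′} → k ℕ.≤′ k′ → Yields w k′ C v
      go (ℕ.≤′-reflexive ≡.refl) = y
      go {suc k′} (ℕ.≤′-step k≤k′) with go k≤k′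
      ... | yields h v≤ = yields (halts-suc k′ C h) (≤-respʳ (sym (Pr-suc w k′ C h)) v≤)

    -- Follows j C D means that the machine gets from C to D by j deterministic
    -- steps. For concrete commands it computes to an equation D′ ≡ D, so that
    -- follow executes straight-line code with refl as its only argument.
    mutual
      Follows : ℕ → Configuration → Configuration → Set c
      Follows zero    C D = C ≡ D
      Follows (suc j) C D = FollowsAfter j (next C) D

      FollowsAfter : ℕ → Next m n → Configuration → Set c
      FollowsAfter j (goto C)   D = Follows j C D
      FollowsAfter j (halted _) D = Lift c ⊥
      FollowsAfter j (ask _ _)  D = Lift c ⊥
      FollowsAfter j (toss _ _) D = Lift c ⊥

    mutual
      follow : ∀ {w k v D} j C → Follows j C D → Yields w k D v → Yields w (j ℕ.+ k) C v
      follow zero    C ≡.refl y = y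
      follow (suc j) C f y with followAfter j (next C) f y
      ... | h , v≤ = yields h v≤

      followAfter : ∀ {w k v D} j N → FollowsAfter j N D → Yields w k D v →
        HaltsAfter m n (j ℕ.+ k) N × v ≤ PrAfter O w (j ℕ.+ k) N
      followAfter j (goto C) f y with follow j C f y
      ... | yields h v≤ = h , v≤

    yields-goto : ∀ {w k C D v} → next C ≡ goto D → Yields w k D v → Yields w (suc k) C v
    yields-goto eq (yields h v≤) = yields
      (≡.subst (HaltsAfter m n _) (≡.sym eq) h)
      (≡.subst (λ N → _ ≤ PrAfter O _ _ N) (≡.sym eq) v≤)

    yields-ask : ∀ {w k C q D} {v : Vector Carrier n} → next C ≡ ask q D →
      (∀ a → Yields w k (D a) (v a)) → Yields w (suc k) C (expect (O q) v)
    yields-ask {q = q} eq ys = yields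
      (≡.subst (HaltsAfter m n _) (≡.sym eq) (λ a → Yields.halts (ys a)))
      (≡.subst (λ N → _ ≤ PrAfter O _ _ N) (≡.sym eq)
        (expect-mono-≤ (O-dist q) (λ a → Yields.bound (ys a))))

    yields-toss : ∀ {w k C j D} {v : Vector Carrier (suc j)} → next C ≡ toss j D →
      (∀ i → Yields w k (D i) (v i)) → Yields w (suc k) C (expect (uniformly (suc j)) v)
    yields-toss {j = j} eq ys = yields
      (≡.subst (HaltsAfter m n _) (≡.sym eq) (λ i → Yields.halts (ys i)))
      (≡.subst (λ N → _ ≤ PrAfter O _ _ N) (≡.sym eq)
        (expect-mono-≤ (uniformly-isDistribution (suc j)) (λ i → Yields.bound (ys i))))

    -- The branch taken by a conditional.
    choose : ℕ → Command → Command → Command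
    choose zero    C D = D
    choose (suc _) C D = C

    next-if : ∀ {K s x C D} i → nat s x ≡ i → next {m} {n} (ifNonZero x C D ∷ K , s) ≡ goto (choose i C D ∷ K , s)
    next-if zero    eq rewrite eq = ≡.refl
    next-if (suc i) eq rewrite eq = ≡.refl

    yields-if : ∀ {w k K s x C D v} i → nat s x ≡ i →
      Yields w k (choose i C D ∷ K , s) v → Yields w (suc k) (ifNonZero x C D ∷ K , s) v
    yields-if i eq = yields-goto (next-if i eq)

    next-while-done : ∀ {K s x C} → nat s x ≡ 0 → next {m} {n} (whileNonZero x C ∷ K , s) ≡ goto (K , s)
    next-while-done eq rewrite eq = ≡.refl

    yields-while-done : ∀ {w k K s x C v} → nat s x ≡ 0 →
      Yields w k (K , s) v → Yields w (suc k) (whileNonZero x C ∷ K , s) v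
    yields-while-done eq = yields-goto (next-while-done eq)

    next-while-again : ∀ {K s x C} i → nat s x ≡ suc i →
      next {m} {n} (whileNonZero x C ∷ K , s) ≡ goto (C ∷ whileNonZero x C ∷ K , s)
    next-while-again i eq rewrite eq = ≡.refl

    yields-while-again : ∀ {w k K s x C v} i → nat s x ≡ suc i →
      Yields w k (C ∷ whileNonZero x C ∷ K , s) v → Yields w (suc k) (whileNonZero x C ∷ K , s) v
    yields-while-again i eq = yields-goto (next-while-again i eq)

    next-sample : ∀ {K s x y} (q : Fin m) → nat s y ≡ toℕ q →
      next {m} {n} (sample x y ∷ K , s) ≡ ask q (λ a → K , setNat x 0 (toℕ a) s)
    next-sample {K} {s} {x} {y} q eq with nat s y ℕ.<? m
    ... | no q≮m  = contradiction (≡.subst (ℕ._< m) (≡.sym eq) (Fin.toℕ<n q)) q≮m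
    ... | yes q<m = ≡.cong (λ q → ask q (λ a → K , setNat x 0 (toℕ a) s))
                           (Fin.toℕ-injective (≡.trans (Fin.toℕ-fromℕ< q<m) eq))

    yields-sample : ∀ {w k K s x y} (q : Fin m) {v : Vector Carrier n} → nat s y ≡ toℕ q →
      (∀ a → Yields w k (K , setNat x 0 (toℕ a) s) (v a)) →
      Yields w (suc k) (sample x y ∷ K , s) (expect (O q) v)
    yields-sample q eq = yields-ask (next-sample q eq)

    next-uniform : ∀ {K s x y} j → nat s y ≡ suc j →
      next {m} {n} (uniform x y ∷ K , s) ≡ toss j (λ i → K , setNat x 0 (toℕ i) s)
    next-uniform j eq rewrite eq = ≡.refl

    yields-uniform : ∀ {w k K s x y} j .{{_ : NonZero j}} {v : Vector Carrier j} → nat s y ≡ j →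
      (∀ i → Yields w k (K , setNat x 0 (toℕ i) s) (v i)) →
      Yields w (suc k) (uniform x y ∷ K , s) (expect (uniformly j) v)
    yields-uniform (suc j) eq = yields-toss (next-uniform j eq)

-- The simulation of the tester

-- The natural registers of the test, besides those for its input and output:
-- the rounds not yet started; the steps left in the present round; the state
-- that the round has reached and the clearances that it needs; the remaining
-- budget; the modulus of the memory regions; two scratch registers; the number
-- 1; the position of a simulated oracle's walk, and the steps left to it.
rounds position current level budget modulus scratch scratch′ one token timer : Name
rounds   = 3
position = 4
current  = 5
level    = 6
budget   = 7
modulus  = 8
scratch  = 9
scratch′ = 10
one      = 11
token    = 12
timer    = 13

-- The numeric registers, besides those for ε and δ: the numbers ε² and 8, and
-- two scratch registers.
square bound number number′ : Name
square  = 2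
bound   = 3
number  = 4
number′ = 5

-- Cell (x , j) of the simulated machine is kept in the array virtual x at the
-- index j * modulus + budget. As each simulation is run with another budget,
-- each finds its memory blank.
-- The names below 16 are left to the registers.
virtual : Name → Name
virtual x = 16 ℕ.+ x

-- Copying a simulated scalar, cell 0 of its array, from and to a register.
fetch put : Name → Name → Command
fetch r x = natLoad r (virtual x) budget
put   x r = natStore (virtual x) budget r

fetchNum putNum : Name → Name → Command
fetchNum r x = numLoad r (virtual x) budget
putNum   x r = numStore (virtual x) budget r

-- Compute, in scratch, the index of the cell whose simulated index is the
-- simulated scalar y.
address : Name → Command
address y = fetch scratch y ⨾ natOp multiply scratch scratch modulus ⨾ natOp add scratch scratch budget

walkLoop : Command
walkLoop = whileNonZero timer (sample token token ⨾ natOp subtract timer timer one)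

-- The timer is a copy of the number t of steps.
takeWalk : Command
takeWalk = natOp multiply timer steps one ⨾ walkLoop

-- Query 1 samples the endpoint of a walk from a uniform state; query 0 starts
-- from the current state instead with probability 1/2.
placeToken : Command
placeToken = ifNonZero scratch
  (uniform token size)
  (constant scratch′ 2 ⨾ uniform scratch′ scratch′ ⨾
   ifNonZero scratch′ (natOp multiply token current one) (uniform token size))

-- A loop fetches its condition before the first test and after each pass.
simulate : Command → Command
simulate skip = skip
simulate (C ⨾ D) = simulate C ⨾ simulate D
simulate (ifNonZero x C D) = fetch scratch x ⨾ ifNonZero scratch (simulate C) (simulate D)
simulate (whileNonZero x C) =
  fetch scratch x ⨾ whileNonZero scratch (simulate C ⨾ fetch scratch x)
simulate (constant x k) = constant scratch k ⨾ put x scratch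
simulate (natOp o x y z) =
  fetch scratch y ⨾ fetch scratch′ z ⨾ natOp o scratch scratch scratch′ ⨾ put x scratch
simulate (numOp o x y z) =
  fetchNum number y ⨾ fetchNum number′ z ⨾ numOp o number number number′ ⨾ putNum x number
simulate (natLess x y z) =
  fetch scratch y ⨾ fetch scratch′ z ⨾ natLess scratch scratch scratch′ ⨾ put x scratch
simulate (numLess x y z) =
  fetchNum number y ⨾ fetchNum number′ z ⨾ numLess scratch number number′ ⨾ put x scratch
simulate (embed x y) = fetch scratch y ⨾ embed number scratch ⨾ putNum x number
simulate (natLoad x a y) = address y ⨾ natLoad scratch (virtual a) scratch ⨾ put x scratch
simulate (numLoad x a y) = address y ⨾ numLoad number (virtual a) scratch ⨾ putNum x number
simulate (natStore a y x) = address y ⨾ fetch scratch′ x ⨾ natStore (virtual a) scratch scratch′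
simulate (numStore a y x) = address y ⨾ fetchNum number x ⨾ numStore (virtual a) scratch number
simulate (sample x y) =
  fetch scratch y ⨾ constant scratch′ 2 ⨾ natLess scratch′ scratch scratch′ ⨾
  ifNonZero scratch′ (placeToken ⨾ takeWalk ⨾ put x token) skip
simulate (uniform x y) =
  fetch scratch y ⨾ ifNonZero scratch (uniform scratch scratch ⨾ put x scratch) skip

-- A bound on the steps of the simulation for each simulated step, where t is
-- the length of a walk. Query 0 of the oracle is the longest command.
cost : ℕ → ℕ
cost t = 20 ℕ.+ t ℕ.* 4

≡ᵇ-cong : ∀ {i j k l} → (i ≡ j → k ≡ l) → (k ≡ l → i ≡ j) → (i ≡ᵇ j) ≡ (k ≡ᵇ l)
≡ᵇ-cong {i} {j} {k} {l} to from = does-⇔ (mk⇔ to from) (i ℕ.≟ j) (k ℕ.≟ l)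

≢⇒≡ᵇ-false : ∀ {i j} → i ≢ j → (i ≡ᵇ j) ≡ false
≢⇒≡ᵇ-false {i} {j} i≢j = dec-false (i ℕ.≟ j) i≢j

-- The region of the budget g, when the modulus is G.
module Regions (G g : ℕ) (g<G : g ℕ.< G) where

  private instance
    G-nonZero : NonZero G
    G-nonZero = ℕ.>-nonZero (ℕ.≤-<-trans ℕ.z≤n g<G)

  cell : ℕ → ℕ
  cell j = j ℕ.* G ℕ.+ g

  cell-injective : ∀ {i j} → cell i ≡ cell j → i ≡ j
  cell-injective {i} {j} eq = ℕ.*-cancelʳ-≡ i j G (ℕ.+-cancelʳ-≡ g (i ℕ.* G) (j ℕ.* G) eq)

  cell-disjoint : ∀ {g′} → g′ ℕ.< g → ∀ i j → cell i ≢ j ℕ.* G ℕ.+ g′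
  cell-disjoint {g′} g′<g i j eq = ℕ.<⇒≢ g′<g (≡.sym (begin
    g                    ≡⟨ m<n⇒m%n≡m g<G ⟨
    g % G                ≡⟨ [m+kn]%n≡m%n g i G ⟨
    (g ℕ.+ i ℕ.* G) % G  ≡⟨ ≡.cong (_% G) (≡.trans (ℕ.+-comm g (i ℕ.* G)) (≡.trans eq (ℕ.+-comm (j ℕ.* G) g′))) ⟩
    (g′ ℕ.+ j ℕ.* G) % G ≡⟨ [m+kn]%n≡m%n g′ j G ⟩
    g′ % G               ≡⟨ m<n⇒m%n≡m (ℕ.<-trans g′<g g<G) ⟩
    g′                   ∎))
    where open ≡.≡-Reasoning

module Memories {c ℓ₁ ℓ₂} (F : ArchimedeanField c ℓ₁ ℓ₂) (G g : ℕ) (g<G : g ℕ.< G) where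

  open Testing F
  open Regions G g g<G public

  -- The region of the budget g holds the simulated memory ν.
  Represents : ∀ {a} {A : Set a} → Memory A → Memory A → Set a
  Represents μ ν = ∀ x j → μ (virtual x) (cell j) ≡ ν x j

  -- The regions of the budgets below g are still blank.
  Fresh : ∀ {a} {A : Set a} → A → Memory A → Set a
  Fresh z μ = ∀ g′ → g′ ℕ.< g → ∀ x j → μ (virtual x) (j ℕ.* G ℕ.+ g′) ≡ z

  represents-write : ∀ {a} {A : Set a} {μ ν : Memory A} x i (v : A) →
    Represents μ ν → Represents (write (virtual x) (cell i) v μ) (write x i v ν)
  represents-write x i v rep y j with x ≡ᵇ y
  ... | false = rep y j
  ... | true rewrite ≡ᵇ-cong {cell i} {cell j} {i} {j} cell-injective (≡.cong cell) with i ≡ᵇ j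
  ...   | true  = ≡.refl
  ...   | false = rep y j

  fresh-write : ∀ {a} {A : Set a} {z : A} {μ : Memory A} x i (v : A) →
    Fresh z μ → Fresh z (write (virtual x) (cell i) v μ)
  fresh-write x i v fresh g′ g′<g y j with x ≡ᵇ y
  ... | false = fresh g′ g′<g y j
  ... | true rewrite ≢⇒≡ᵇ-false (cell-disjoint g′<g i j) = fresh g′ g′<g y j

module Registers {c ℓ₁ ℓ₂} (F : ArchimedeanField c ℓ₁ ℓ₂) (n t : ℕ)
  (ε δ : ArchimedeanField.Carrier F) (G : ℕ) where

  open Testing F

  -- The contents of the registers between the steps of the test, when the
  -- budget is g.
  Control : (r p l g : ℕ) (u : Fin n) → Store → Set c
  Control r p l g u s =
    nat s size ≡ n × nat s steps ≡ t × nat s verdict ≡ 0 × nat s rounds ≡ r × nat s position ≡ p ×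
    nat s current ≡ toℕ u × nat s level ≡ l × nat s budget ≡ g × nat s modulus ≡ G × nat s one ≡ 1 ×
    num s accuracy ≡ ε × num s failure ≡ δ

module Tested {c ℓ₁ ℓ₂} (F : ArchimedeanField c ℓ₁ ℓ₂)
  {n d : ℕ} .{{_ : NonZero n}} (M : Testing.MarkovChain F n d) (t : ℕ) where

  open OrderedField F
  open Testing F
  open Chains F
  open Closeness F using (module Probes)
  open Probes M t

  -- The oracle that the tester is given in the state u.
  tested : Fin n → Oracle 2 n
  tested u = pair (probe u) (endpoint (matrix M) t)

  tested-isDistribution : ∀ u q → IsDistribution (tested u q)
  tested-isDistribution u zero       = probe-isDistribution u
  tested-isDistribution u (suc zero) = s-isDistribution

module Simulation {c ℓ₁ ℓ₂} (F : ArchimedeanField c ℓ₁ ℓ₂)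
  {n d : ℕ} .{{_ : NonZero n}} (M : Testing.MarkovChain F n d) (t : ℕ)
  (ε δ : ArchimedeanField.Carrier F) (G g : ℕ) (g<G : g ℕ.< G) (r p l : ℕ) (u : Fin n) where

  open OrderedField F
  open Testing F
  open Chains F
  open Closeness F using (module Probes)
  open Probes M t
  open Machine F
  open Memories F G g g<G
  open Registers F n t ε δ G
  open Tested F M t

  private
    A : Matrix n
    A = matrix M

    reference : Vector Carrier n
    reference = endpoint A t

  open Runs (nextNode M) (stochastic M)
  private module Virtual = Runs (tested u) (tested-isDistribution u)

  -- The store s represents the store σ of the simulated machine, and holds the
  -- right values in the registers of the test.
  record Frame (σ s : Store) : Set c where
    constructor frame
    field
      contents : Control r p l g u s ×
        Represents (nats s) (nats σ) × Represents (nums s) (nums σ) × Fresh 0 (nats s) × Fresh 0# (nums s)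

  module _ {σ s : Store} where

    keep-scratch : ∀ {v} → Frame σ s → Frame σ (setNat scratch 0 v s)
    keep-scratch (frame f) = frame f

    keep-scratch′ : ∀ {v} → Frame σ s → Frame σ (setNat scratch′ 0 v s)
    keep-scratch′ (frame f) = frame f

    keep-token : ∀ {v} → Frame σ s → Frame σ (setNat token 0 v s)
    keep-token (frame f) = frame f

    keep-timer : ∀ {v} → Frame σ s → Frame σ (setNat timer 0 v s)
    keep-timer (frame f) = frame f

    keep-number : ∀ {v} → Frame σ s → Frame σ (setNum number 0 v s)
    keep-number (frame f) = frame f

    keep-number′ : ∀ {v} → Frame σ s → Frame σ (setNum number′ 0 v s)
    keep-number′ (frame f) = frame f

    frame-nat : ∀ {i v v′} x j → i ≡ cell j → v ≡ v′ →
      Frame σ s → Frame (setNat x j v′ σ) (setNat (virtual x) i v s)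
    frame-nat {v = v} x j ≡.refl ≡.refl (frame (control , nats-rep , nums-rep , nats-fresh , nums-fresh)) =
      frame (control , represents-write {μ = nats s} {nats σ} x j v nats-rep , nums-rep ,
             fresh-write {μ = nats s} x j v nats-fresh , nums-fresh)

    frame-num : ∀ {i v v′} x j → i ≡ cell j → v ≡ v′ →
      Frame σ s → Frame (setNum x j v′ σ) (setNum (virtual x) i v s)
    frame-num {v = v} x j ≡.refl ≡.refl (frame (control , nats-rep , nums-rep , nats-fresh , nums-fresh)) =
      frame (control , nats-rep , represents-write {μ = nums s} {nums σ} x j v nums-rep ,
             nats-fresh , fresh-write {μ = nums s} x j v nums-fresh)

    size≡ : Frame σ s → nat s size ≡ n
    size≡ (frame ((eq , _) , _)) = eq

    steps≡ : Frame σ s → nat s steps ≡ t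
    steps≡ (frame ((_ , eq , _) , _)) = eq

    current≡ : Frame σ s → nat s current ≡ toℕ u
    current≡ (frame ((_ , _ , _ , _ , _ , eq , _) , _)) = eq

    budget≡ : Frame σ s → nat s budget ≡ g
    budget≡ (frame ((_ , _ , _ , _ , _ , _ , _ , eq , _) , _)) = eq

    modulus≡ : Frame σ s → nat s modulus ≡ G
    modulus≡ (frame ((_ , _ , _ , _ , _ , _ , _ , _ , eq , _) , _)) = eq

    one≡ : Frame σ s → nat s one ≡ 1
    one≡ (frame ((_ , _ , _ , _ , _ , _ , _ , _ , _ , eq , _) , _)) = eq

    nat≡ : Frame σ s → ∀ x → nats s (virtual x) (nat s budget) ≡ nat σ x
    nat≡ f@(frame (_ , rep , _)) x = ≡.trans (≡.cong (nats s (virtual x)) (budget≡ f)) (rep x 0)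

    num≡ : Frame σ s → ∀ x → nums s (virtual x) (nat s budget) ≡ num σ x
    num≡ f@(frame (_ , _ , rep , _)) x = ≡.trans (≡.cong (nums s (virtual x)) (budget≡ f)) (rep x 0)

    address≡ : Frame σ s → ∀ y →
      nats s (virtual y) (nat s budget) ℕ.* nat s modulus ℕ.+ nat s budget ≡ cell (nat σ y)
    address≡ f y = ≡.cong₂ ℕ._+_ (≡.cong₂ ℕ._*_ (nat≡ f y) (modulus≡ f)) (budget≡ f)

    natElement≡ : Frame σ s → ∀ a y →
      nats s (virtual a) (nats s (virtual y) (nat s budget) ℕ.* nat s modulus ℕ.+ nat s budget) ≡ nats σ a (nat σ y)
    natElement≡ f@(frame (_ , rep , _)) a y =
      ≡.trans (≡.cong (nats s (virtual a)) (address≡ f y)) (rep a (nat σ y))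

    numElement≡ : Frame σ s → ∀ a y →
      nums s (virtual a) (nats s (virtual y) (nat s budget) ℕ.* nat s modulus ℕ.+ nat s budget) ≡ nums σ a (nat σ y)
    numElement≡ f@(frame (_ , _ , rep , _)) a y =
      ≡.trans (≡.cong (nums s (virtual a)) (address≡ f y)) (rep a (nat σ y))

  -- If what follows the walk yields f z when the token has reached z, then the
  -- walk yields the average of f over its endpoint.
  yields-walk : ∀ {w k L σ} {f : Vector Carrier n} j v {s} →
    Frame σ s → nat s token ≡ toℕ v → nat s timer ≡ j →
    (∀ z {s′} → Frame σ s′ → nat s′ token ≡ toℕ z → Yields w k (L , s′) (f z)) →
    Yields w (j ℕ.* 4 ℕ.+ suc k) (walkLoop ∷ L , s) (expect (power A j v) f)
  yields-walk {f = f} zero v fr token≡ timer≡ after =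
    yields-≈ (expect-unit v f) (yields-while-done timer≡ (after v fr token≡))
  yields-walk {f = f} (suc j) v {s} fr token≡ timer≡ after =
    yields-≈ (expect-swap (A v) (power A j) f)
      (yields-while-again j timer≡ (follow 1 _ ≡.refl
        (yields-sample v token≡ λ z → follow 1 _ ≡.refl
          (yields-walk j z (keep-timer (keep-token fr)) ≡.refl
            (≡.cong₂ ℕ._∸_ timer≡ (one≡ fr)) after))))

  yields-takeWalk : ∀ {w k L σ C} {f : Vector Carrier n} v {s} →
    Frame σ s → nat s token ≡ toℕ v →
    (∀ z {s′} → Frame σ s′ → nat s′ token ≡ toℕ z → Yields w k (C ∷ L , s′) (f z)) →
    Yields w (3 ℕ.+ (t ℕ.* 4 ℕ.+ suc k)) ((takeWalk ⨾ C) ∷ L , s) (expect (power A t v) f)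
  yields-takeWalk v fr token≡ after = follow 3 _ ≡.refl
    (yields-walk t v (keep-timer fr) token≡
      (≡.trans (≡.cong₂ ℕ._*_ (steps≡ fr) (one≡ fr)) (ℕ.*-identityʳ t)) after)

  -- Stack R K L means that L is the code for the pending simulated commands K,
  -- followed by R. A pending loop may have been entered already, in which case
  -- the code that tests its condition has been laid open.
  data Stack (R : List Command) : List Command → List Command → Set where
    done  : Stack R [] R
    entry : ∀ {C K L} → Stack R K L → Stack R (C ∷ K) (simulate C ∷ L)
    again : ∀ {x C K L} → Stack R K L →
            Stack R (whileNonZero x C ∷ K)
                    (fetch scratch x ∷ whileNonZero scratch (simulate C ⨾ fetch scratch x) ∷ L)

  select : Verdict → Carrier → Carrier → Carrier
  select accept a b = a
  select reject a b = b

  -- The simulation, followed by code R that yields a or b according to the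
  -- simulated verdict.
  module _ {w : Verdict} {kᵣ : ℕ} {R : List Command} {a b : Carrier}
    (finish : ∀ {σ s} → Frame σ s → Yields w kᵣ (R , s) (select (decision (nat σ verdict)) a b)) where

    -- What a simulated machine yields that has k steps left.
    outcome : ℕ → Configuration → Carrier
    outcome k C = Pr (tested u) accept k C * a + Pr (tested u) reject k C * b

    private
      outcomeAfter : ℕ → Next 2 n → Carrier
      outcomeAfter k N = PrAfter (tested u) accept k N * a + PrAfter (tested u) reject k N * b

      outcome-goto : ∀ {k} C {D} → next {2} {n} C ≡ goto D → outcome (suc k) C ≈ outcome k D
      outcome-goto {k} C eq = reflexive (≡.cong (outcomeAfter k) eq)

      linear : ∀ {m} (q f h : Vector Carrier m) →
        expect q f * a + expect q h * b ≈ expect q (λ i → f i * a + h i * b)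
      linear {m} q f h = sym (trans (expect-+ q _ _) (+-cong (side f a) (side h b)))
        where
        side : ∀ f x → expect q (λ i → f i * x) ≈ expect q f * x
        side f x = trans (sum-cong {m} λ i → sym (*-assoc (q i) (f i) x)) (sum-*ʳ {m} x _)

      outcome-ask : ∀ {k} C {q D} → next {2} {n} C ≡ ask q D → outcome (suc k) C ≈ expect (tested u q) (λ v → outcome k (D v))
      outcome-ask {k} C {q} {D} eq = trans (reflexive (≡.cong (outcomeAfter k) eq))
        (linear (tested u q) (λ v → Pr (tested u) accept k (D v)) (λ v → Pr (tested u) reject k (D v)))

      outcome-toss : ∀ {k} C {j D} → next {2} {n} C ≡ toss j D →
        outcome (suc k) C ≈ expect (uniformly (suc j)) (λ v → outcome k (D v))
      outcome-toss {k} C {j} {D} eq = trans (reflexive (≡.cong (outcomeAfter k) eq))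
        (linear (uniformly (suc j)) (λ v → Pr (tested u) accept k (D v)) (λ v → Pr (tested u) reject k (D v)))

      expect-reference : ∀ (f : Vector Carrier n) →
        expect (uniformly n) (λ v → expect (power A t v) f) ≈ expect reference f
      expect-reference f = sym (expect-swap (uniformly n) (power A t) f)

      expect-probe : ∀ (f : Vector Carrier n) →
        half * expect (uniformly n) (λ v → expect (power A t v) f) + (half * expect (power A t u) f + 0#)
          ≈ expect (probe u) f
      expect-probe f = trans
        (+-cong (trans (*-congˡ (expect-reference f)) (sym (sum-*ˡ {n} half _)))
                (trans (+-identityʳ _) (sym (sum-*ˡ {n} half _))))
        (trans (sym (sum-+ {n} _ _)) (sum-cong {n} λ i →
          solve 4 (λ h s q f → h :* (s :* f) :+ h :* (q :* f) := (h :* s :+ h :* q) :* f) refl half (reference i) (power A t u i) (f i)))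

      -- The code for a simulated step takes j steps.
      spend : ∀ {k C v} j → T (j ℕ.≤ᵇ 20) →
        Yields w (j ℕ.+ (k ℕ.* cost t ℕ.+ kᵣ)) C v → Yields w (suc k ℕ.* cost t ℕ.+ kᵣ) C v
      spend {k} j j≤20 = yields-later (ℕ.≤-trans
        (ℕ.+-monoˡ-≤ (k ℕ.* cost t ℕ.+ kᵣ) (ℕ.≤-trans (ℕ.≤ᵇ⇒≤ j 20 j≤20) (ℕ.m≤m+n 20 (t ℕ.* 4))))
        (ℕ.≤-reflexive (≡.sym (ℕ.+-assoc (cost t) (k ℕ.* cost t) kᵣ))))

      spend-walk : ∀ {k C v} j → T (j ℕ.≤ᵇ 20) →
        Yields w (j ℕ.+ t ℕ.* 4 ℕ.+ (k ℕ.* cost t ℕ.+ kᵣ)) C v → Yields w (suc k ℕ.* cost t ℕ.+ kᵣ) C v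
      spend-walk {k} j j≤20 = yields-later (ℕ.≤-trans
        (ℕ.+-monoˡ-≤ (k ℕ.* cost t ℕ.+ kᵣ) (ℕ.+-monoˡ-≤ (t ℕ.* 4) (ℕ.≤ᵇ⇒≤ j 20 j≤20)))
        (ℕ.≤-reflexive (≡.sym (ℕ.+-assoc (cost t) (k ℕ.* cost t) kᵣ))))

    -- The probabilities of the simulated machine carry over, at the expense of a
    -- constant factor in time for a fixed length of the walks.
    simulates : ∀ k {K L σ s} → HaltsWithin 2 n k (K , σ) → Stack R K L → Frame σ s →
      Yields w (k ℕ.* cost t ℕ.+ kᵣ) (L , s) (outcome k (K , σ))
    simulates (suc k) {[]} {σ = σ} h done f = yields-later (ℕ.m≤n+m kᵣ (suc k ℕ.* cost t))
      (yields-≈ (ended (decision (nat σ verdict))) (finish f))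
      where
      ended : ∀ v → indicator accept v * a + indicator reject v * b ≈ select v a b
      ended accept = solve 2 (λ a b → con (+ 1) :* a :+ con (+ 0) :* b := a) refl a b
      ended reject = solve 2 (λ a b → con (+ 0) :* a :+ con (+ 1) :* b := b) refl a b
    simulates (suc k) {skip ∷ K} h (entry S) f = spend {k} 1 tt (follow 1 _ ≡.refl (simulates k h S f))
    simulates (suc k) {(C ⨾ D) ∷ K} h (entry S) f =
      spend {k} 1 tt (follow 1 _ ≡.refl (simulates k h (entry (entry S)) f))
    simulates (suc k) {constant x i ∷ K} h (entry S) f = spend {k} 3 tt (follow 3 _ ≡.refl
      (simulates k h S (frame-nat x 0 (budget≡ f) ≡.refl (keep-scratch f))))
    simulates (suc k) {natOp o x y z ∷ K} h (entry S) f = spend {k} 7 tt (follow 7 _ ≡.refl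
      (simulates k h S (frame-nat x 0 (budget≡ f) (≡.cong₂ (natArithmetic o) (nat≡ f y) (nat≡ f z))
        (keep-scratch (keep-scratch′ (keep-scratch f))))))
    simulates (suc k) {numOp o x y z ∷ K} h (entry S) f = spend {k} 7 tt (follow 7 _ ≡.refl
      (simulates k h S (frame-num x 0 (budget≡ f) (≡.cong₂ (numArithmetic o) (num≡ f y) (num≡ f z))
        (keep-number (keep-number′ (keep-number f))))))
    simulates (suc k) {natLess x y z ∷ K} h (entry S) f = spend {k} 7 tt (follow 7 _ ≡.refl
      (simulates k h S (frame-nat x 0 (budget≡ f) (≡.cong₂ (λ i j → truth (i ℕ.<? j)) (nat≡ f y) (nat≡ f z))
        (keep-scratch (keep-scratch′ (keep-scratch f))))))
    simulates (suc k) {numLess x y z ∷ K} h (entry S) f = spend {k} 7 tt (follow 7 _ ≡.refl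
      (simulates k h S (frame-nat x 0 (budget≡ f) (≡.cong₂ (λ i j → truth (i <? j)) (num≡ f y) (num≡ f z))
        (keep-scratch (keep-number′ (keep-number f))))))
    simulates (suc k) {embed x y ∷ K} h (entry S) f = spend {k} 5 tt (follow 5 _ ≡.refl
      (simulates k h S (frame-num x 0 (budget≡ f) (≡.cong fromℕ (nat≡ f y)) (keep-number (keep-scratch f)))))
    simulates (suc k) {natLoad x a y ∷ K} h (entry S) f = spend {k} 9 tt (follow 9 _ ≡.refl
      (simulates k h S (frame-nat x 0 (budget≡ f) (natElement≡ f a y)
        (keep-scratch (keep-scratch (keep-scratch (keep-scratch f)))))))
    simulates (suc k) {numLoad x a y ∷ K} h (entry S) f = spend {k} 9 tt (follow 9 _ ≡.refl
      (simulates k h S (frame-num x 0 (budget≡ f) (numElement≡ f a y)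
        (keep-number (keep-scratch (keep-scratch (keep-scratch f)))))))
    simulates (suc k) {natStore a y x ∷ K} {σ = σ} h (entry S) f = spend {k} 9 tt (follow 9 _ ≡.refl
      (simulates k h S (frame-nat a (nat σ y) (address≡ f y) (nat≡ f x)
        (keep-scratch′ (keep-scratch (keep-scratch (keep-scratch f)))))))
    simulates (suc k) {numStore a y x ∷ K} {σ = σ} h (entry S) f = spend {k} 9 tt (follow 9 _ ≡.refl
      (simulates k h S (frame-num a (nat σ y) (address≡ f y) (num≡ f x)
        (keep-number (keep-scratch (keep-scratch (keep-scratch f)))))))
    simulates (suc k) {ifNonZero x C D ∷ K} {σ = σ} h (entry S) f = branch (nat σ x) ≡.refl
      where
      branch : ∀ i → nat σ x ≡ i → Yields w _ _ (outcome (suc k) (ifNonZero x C D ∷ K , σ))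
      branch zero eq = yields-≈ (outcome-goto {k} (ifNonZero x C D ∷ K , σ) (Virtual.next-if zero eq)) (spend {k} 3 tt (follow 2 _ ≡.refl
        (yields-if zero (≡.trans (nat≡ f x) eq)
          (simulates k (≡.subst (HaltsAfter 2 n k) (Virtual.next-if zero eq) h) (entry S) (keep-scratch f)))))
      branch (suc i) eq = yields-≈ (outcome-goto {k} (ifNonZero x C D ∷ K , σ) (Virtual.next-if (suc i) eq)) (spend {k} 3 tt (follow 2 _ ≡.refl
        (yields-if (suc i) (≡.trans (nat≡ f x) eq)
          (simulates k (≡.subst (HaltsAfter 2 n k) (Virtual.next-if (suc i) eq) h) (entry S) (keep-scratch f)))))
    simulates (suc k) {whileNonZero x C ∷ K} {σ = σ} h (entry S) f = branch (nat σ x) ≡.refl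
      where
      branch : ∀ i → nat σ x ≡ i → Yields w _ _ (outcome (suc k) (whileNonZero x C ∷ K , σ))
      branch zero eq = yields-≈ (outcome-goto {k} (whileNonZero x C ∷ K , σ) (Virtual.next-while-done eq)) (spend {k} 3 tt (follow 2 _ ≡.refl
        (yields-while-done (≡.trans (nat≡ f x) eq)
          (simulates k (≡.subst (HaltsAfter 2 n k) (Virtual.next-while-done eq) h) S (keep-scratch f)))))
      branch (suc i) eq = yields-≈ (outcome-goto {k} (whileNonZero x C ∷ K , σ) (Virtual.next-while-again i eq)) (spend {k} 4 tt (follow 2 _ ≡.refl
        (yields-while-again i (≡.trans (nat≡ f x) eq) (follow 1 _ ≡.refl
          (simulates k (≡.subst (HaltsAfter 2 n k) (Virtual.next-while-again i eq) h) (entry (again S)) (keep-scratch f))))))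
    simulates (suc k) {whileNonZero x C ∷ K} {σ = σ} h (again S) f = branch (nat σ x) ≡.refl
      where
      branch : ∀ i → nat σ x ≡ i → Yields w _ _ (outcome (suc k) (whileNonZero x C ∷ K , σ))
      branch zero eq = yields-≈ (outcome-goto {k} (whileNonZero x C ∷ K , σ) (Virtual.next-while-done eq)) (spend {k} 2 tt (follow 1 _ ≡.refl
        (yields-while-done (≡.trans (nat≡ f x) eq)
          (simulates k (≡.subst (HaltsAfter 2 n k) (Virtual.next-while-done eq) h) S (keep-scratch f)))))
      branch (suc i) eq = yields-≈ (outcome-goto {k} (whileNonZero x C ∷ K , σ) (Virtual.next-while-again i eq)) (spend {k} 3 tt (follow 1 _ ≡.refl
        (yields-while-again i (≡.trans (nat≡ f x) eq) (follow 1 _ ≡.refl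
          (simulates k (≡.subst (HaltsAfter 2 n k) (Virtual.next-while-again i eq) h) (entry (again S)) (keep-scratch f))))))
    simulates (suc k) {uniform x y ∷ K} {σ = σ} h (entry S) f = branch (nat σ y) ≡.refl
      where
      stay : nat σ y ≡ 0 → next {2} {n} (uniform x y ∷ K , σ) ≡ goto (K , σ)
      stay eq rewrite eq = ≡.refl

      draw : ∀ i → nat σ y ≡ suc i →
        next {2} {n} (uniform x y ∷ K , σ) ≡ toss i (λ j → K , setNat x 0 (toℕ j) σ)
      draw i eq = Virtual.next-uniform i eq

      branch : ∀ i → nat σ y ≡ i → Yields w _ _ (outcome (suc k) (uniform x y ∷ K , σ))
      branch zero eq = yields-≈ (outcome-goto {k} (uniform x y ∷ K , σ) (stay eq)) (spend {k} 4 tt (follow 2 _ ≡.refl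
        (yields-if zero (≡.trans (nat≡ f y) eq) (follow 1 _ ≡.refl
          (simulates k (≡.subst (HaltsAfter 2 n k) (stay eq) h) S (keep-scratch f))))))
      branch (suc i) eq = yields-≈ (outcome-toss {k} (uniform x y ∷ K , σ) (draw i eq)) (spend {k} 6 tt (follow 2 _ ≡.refl
        (yields-if (suc i) (≡.trans (nat≡ f y) eq) (follow 1 _ ≡.refl
          (yields-uniform (suc i) (≡.trans (nat≡ f y) eq) λ j → follow 1 _ ≡.refl
            (simulates k (≡.subst (HaltsAfter 2 n k) (draw i eq) h j) S
              (frame-nat x 0 (budget≡ f) ≡.refl (keep-scratch (keep-scratch f)))))))))
    simulates (suc k) {sample x y ∷ K} {L = L₀} {σ} {s₀} h (entry {L = L} S) f = branch (nat σ y) ≡.refl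
      where
      query : ∀ (q : Fin 2) → nat σ y ≡ toℕ q →
        next {2} {n} (sample x y ∷ K , σ) ≡ ask q (λ v → K , setNat x 0 (toℕ v) σ)
      query q eq = Virtual.next-sample q eq

      stay : ∀ i → nat σ y ≡ suc (suc i) → next {2} {n} (sample x y ∷ K , σ) ≡ goto (K , σ)
      stay i eq with nat σ y ℕ.<? 2
      ... | yes y<2 = contradiction (≡.subst (ℕ._< 2) eq y<2) λ { (ℕ.s≤s (ℕ.s≤s ())) }
      ... | no _    = ≡.refl

      rest : ℕ
      rest = k ℕ.* cost t ℕ.+ kᵣ

      result : Vector Carrier n
      result v = outcome k (K , setNat x 0 (toℕ v) σ)

      walk-on : ∀ q → nat σ y ≡ toℕ q → ∀ v {s} → Frame σ s → nat s token ≡ toℕ v →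
        Yields w (5 ℕ.+ t ℕ.* 4 ℕ.+ rest) ((takeWalk ⨾ put x token) ∷ L , s) (expect (power A t v) result)
      walk-on q eq v fr token≡ = yields-later
        (ℕ.≤-reflexive (≡.cong (3 ℕ.+_) (≡.trans (ℕ.+-suc (t ℕ.* 4) (suc rest)) (≡.cong suc (ℕ.+-suc (t ℕ.* 4) rest)))))
        (yields-takeWalk v fr token≡ λ z fr′ token≡′ → follow 1 _ ≡.refl
          (simulates k (≡.subst (HaltsAfter 2 n k) (query q eq) h z) S (frame-nat x 0 (budget≡ fr′) token≡′ fr′)))

      from-uniform : ∀ q → nat σ y ≡ toℕ q → ∀ {s} → Frame σ s →
        Yields w (6 ℕ.+ t ℕ.* 4 ℕ.+ rest) (uniform token size ∷ (takeWalk ⨾ put x token) ∷ L , s)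
               (expect (uniformly n) (λ v → expect (power A t v) result))
      from-uniform q eq fr = yields-uniform n (size≡ fr) λ v → walk-on q eq v (keep-token fr) ≡.refl

      from-either : ∀ q → nat σ y ≡ toℕ q → ∀ (i : Fin 2) {s} → Frame σ s → nat s scratch′ ≡ toℕ i →
        Yields w (7 ℕ.+ t ℕ.* 4 ℕ.+ rest)
          (ifNonZero scratch′ (natOp multiply token current one) (uniform token size) ∷ (takeWalk ⨾ put x token) ∷ L , s)
          ((expect (uniformly n) (λ v → expect (power A t v) result) Vector.∷
            expect (power A t u) result Vector.∷ Vector.[]) i)
      from-either q eq zero fr i≡ = yields-if 0 i≡ (from-uniform q eq fr)
      from-either q eq (suc zero) fr i≡ = yields-if 1 i≡ (follow 1 _ ≡.refl
        (walk-on q eq u (keep-token fr) (≡.trans (≡.cong₂ ℕ._*_ (current≡ fr) (one≡ fr)) (ℕ.*-identityʳ (toℕ u)))))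

      branch : ∀ i → nat σ y ≡ i → Yields w (suc k ℕ.* cost t ℕ.+ kᵣ) (L₀ , s₀) (outcome (suc k) (sample x y ∷ K , σ))
      branch 0 eq = yields-≈ (trans (outcome-ask {k} (sample x y ∷ K , σ) (query zero eq)) (sym (expect-probe result)))
        (spend-walk {k} 20 tt (follow 6 _ ≡.refl
          (yields-if 1 (≡.cong (λ i → truth (i ℕ.<? 2)) (≡.trans (nat≡ f y) eq)) (follow 1 _ ≡.refl
            (yields-if 0 (≡.trans (nat≡ f y) eq) (follow 3 _ ≡.refl
              (yields-uniform 2 ≡.refl λ i →
                from-either zero eq i (keep-scratch′ (keep-scratch′ (keep-scratch′ (keep-scratch′ (keep-scratch f))))) ≡.refl)))))))
      branch 1 eq = yields-≈ (trans (outcome-ask {k} (sample x y ∷ K , σ) (query (suc zero) eq)) (sym (expect-reference result)))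
        (spend-walk {k} 15 tt (follow 6 _ ≡.refl
          (yields-if 1 (≡.cong (λ i → truth (i ℕ.<? 2)) (≡.trans (nat≡ f y) eq)) (follow 1 _ ≡.refl
            (yields-if 1 (≡.trans (nat≡ f y) eq)
              (from-uniform (suc zero) eq (keep-scratch′ (keep-scratch′ (keep-scratch f)))))))))
      branch (suc (suc i)) eq = yields-≈ (outcome-goto {k} (sample x y ∷ K , σ) (stay i eq)) (spend {k} 8 tt (follow 6 _ ≡.refl
        (yields-if 0 (≡.cong (λ i → truth (i ℕ.<? 2)) (≡.trans (nat≡ f y) eq)) (follow 1 _ ≡.refl
          (simulates k (≡.subst (HaltsAfter 2 n k) (stay i eq) h) S (keep-scratch′ (keep-scratch′ (keep-scratch f))))))))

-- The test

-- After the clearance of a state: step to the next state, start a new round,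
-- or accept.
advanceState : Command
advanceState = ifNonZero position
  (natOp subtract position position one ⨾ sample current current ⨾ constant level 1)
  (ifNonZero rounds
    (natOp subtract rounds rounds one ⨾ natOp add position steps steps ⨾
     uniform current size ⨾ constant level 1)
    (constant verdict 1 ⨾ constant budget 0))

-- Run the tester on the present state, in a fresh region of memory.
examine : Command → Command
examine P = putNum failure failure ⨾ putNum accuracy accuracy ⨾ put size size ⨾ simulate P

-- Count the verdict of the tester, and give up the region that it has used.
tally : Command
tally = fetch scratch verdict ⨾ natOp subtract budget budget one ⨾
  ifNonZero scratch
    (natOp subtract level level one ⨾ ifNonZero level skip advanceState)
    (natOp add level level one)

-- The verdict remains 0, rejection, when the budget runs out.
mainLoop : Command → Command
mainLoop P = whileNonZero budget (examine P ⨾ tally)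

-- Is the number of rounds times ε² still below 8?
compareRounds : Command
compareRounds = embed number rounds ⨾ numOp multiply number number square ⨾ numLess scratch number bound

countRounds : Command
countRounds = whileNonZero scratch (natOp add rounds rounds one ⨾ compareRounds)

-- Set the budget to 20 runs for each of the 2t + 1 states of each round, the
-- modulus to one more, and the error δ of the tester to 1 / (6t).
prepare : Command
prepare =
  natOp add scratch steps steps ⨾ natOp add scratch one scratch ⨾ natOp multiply scratch rounds scratch ⨾
  constant scratch′ 20 ⨾ natOp multiply budget scratch′ scratch ⨾ natOp add modulus one budget ⨾
  constant scratch 6 ⨾ natOp multiply scratch scratch steps ⨾
  embed number scratch ⨾ embed number′ one ⨾ numOp divide failure number′ number

setup : Command
setup = constant one 1 ⨾ numOp multiply square accuracy accuracy ⨾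
  constant scratch 8 ⨾ embed bound scratch ⨾ compareRounds ⨾ countRounds ⨾ prepare

-- As position is initially 0, the first state is found as after the clearance
-- of the last state of a round.
mixingTest : Command → Command
mixingTest P = setup ⨾ advanceState ⨾ mainLoop P

-- A bound on the steps of one iteration of the main loop, when the tester takes
-- at most N steps: 8 to start it, and 17 to count its verdict and to advance.
iterationCost : (N t : ℕ) → ℕ
iterationCost N t = 8 ℕ.+ (N ℕ.* cost t ℕ.+ 17)

loopCost : (N t b : ℕ) → ℕ
loopCost N t b = b ℕ.* iterationCost N t ℕ.+ 2

testBudget : (K t : ℕ) → ℕ
testBudget K t = 20 ℕ.* (K ℕ.* suc (t ℕ.+ t))

-- A bound on the steps of the test with K rounds: 16 before the rounds are
-- counted, 8 for each round counted, one to end the count, 22 to prepare the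
-- main loop, and 9 to find the first state.
testCost : (K N t : ℕ) → ℕ
testCost K N t = 16 ℕ.+ (K ℕ.* 8 ℕ.+ suc (22 ℕ.+ (9 ℕ.+ loopCost N t (testBudget K t))))

module Test {c ℓ₁ ℓ₂} (F : ArchimedeanField c ℓ₁ ℓ₂) (P : Command)
  {n d : ℕ} .{{_ : NonZero n}} (M : Testing.MarkovChain F n d) (t : ℕ)
  (ε δ : ArchimedeanField.Carrier F) (N : ℕ)
  (P-halts : Testing.HaltsWithin F 2 n N (Testing.testerStart F P n ε δ)) where

  open OrderedField F
  open Testing F
  open Chains F
  open Machine F
  open Tested F M t
  open Runs (nextNode M) (stochastic M)

  -- The probabilities that the tester accepts or rejects the state u.
  accepted rejected : Fin n → Carrier
  accepted u = Pr (tested u) accept N (testerStart P n ε δ)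
  rejected u = Pr (tested u) reject N (testerStart P n ε δ)

  accepted-nonNegative : ∀ u → 0# ≤ accepted u
  accepted-nonNegative u = Runs.Pr-nonNegative (tested u) (tested-isDistribution u) accept N _

  rejected-nonNegative : ∀ u → 0# ≤ rejected u
  rejected-nonNegative u = Runs.Pr-nonNegative (tested u) (tested-isDistribution u) reject N _

  accepted+rejected≈1 : ∀ u → accepted u + rejected u ≈ 1#
  accepted+rejected≈1 u = Runs.Pr-total (tested u) (tested-isDistribution u) N _ P-halts

  open Process F (matrix M) (stochastic M) t accepted rejected
    accepted-nonNegative rejected-nonNegative accepted+rejected≈1 public

  module Loop (G : ℕ) where

    open Registers F n t ε δ G

    -- All regions of memory that may be used while at most g runs are left are
    -- blank.
    BlankUpTo : ∀ {a} {A : Set a} → A → ℕ → Memory A → Set a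
    BlankUpTo z g μ = ∀ g′ → g′ ℕ.≤ g → ∀ x j → μ (virtual x) (j ℕ.* G ℕ.+ g′) ≡ z

    -- The state of the machine between two runs of the tester.
    record Ready (r p l b : ℕ) (u : Fin n) (s : Store) : Set c where
      constructor ready
      field
        control   : Control r p l b u s
        natsBlank : BlankUpTo 0 b (nats s)
        numsBlank : BlankUpTo 0# b (nums s)

    yields-halt : ∀ {w s} v → nat s verdict ≡ v → Yields w 1 ([] , s) (indicator w (decision v))
    yields-halt {w} v eq = yields _ (≤-reflexive (reflexive (≡.cong (λ v → indicator w (decision v)) (≡.sym eq))))

    private
      loop : Command
      loop = mainLoop P

      later : ∀ {w k C v} j i → i ℕ.≤ j → Yields w (i ℕ.+ k) C v → Yields w (j ℕ.+ k) C v
      later {k = k} j i i≤j = yields-later (ℕ.+-monoˡ-≤ k i≤j)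

    mutual
      -- The level is l + 1 when u needs l + 1 more acceptances than rejections.
      yields-loop : ∀ {w} b {r p l u s} → b ℕ.< G → Ready r p (suc l) b u s →
        Yields w (loopCost N t b) (loop ∷ [] , s) (value w b r p l u)
      yields-loop zero b<G (ready (_ , _ , ve , _ , _ , _ , _ , bu , _) _ _) =
        yields-while-done bu (yields-halt 0 ve)
      yields-loop {w} (suc b) {r} {p} {l} {u} b<G (ready control@(si , _ , _ , _ , _ , _ , _ , bu , _ , _ , ac , fa) natsBlank numsBlank) =
        yields-later (ℕ.≤-reflexive (arith (N ℕ.* cost t) (b ℕ.* iterationCost N t)))
          (yields-while-again b bu (follow 7 _ ≡.refl
            (S.simulates {a = cleared w b r p l u} {value w b r p (suc l) u} finish N P-halts (S.entry S.done)
              (S.frame-nat size 0 bu si (S.frame-num accuracy 0 bu ac (S.frame-num failure 0 bu fa start))))))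
        where
        module S = Simulation F M t ε δ G (suc b) b<G r p (suc l) u

        start : S.Frame blank _
        start = S.frame (control , (λ x j → natsBlank (suc b) ℕ.≤-refl x j) , (λ x j → numsBlank (suc b) ℕ.≤-refl x j) ,
          (λ g′ g′<g → natsBlank g′ (ℕ.<⇒≤ g′<g)) , (λ g′ g′<g → numsBlank g′ (ℕ.<⇒≤ g′<g)))

        arith : ∀ x y → 8 ℕ.+ (x ℕ.+ (17 ℕ.+ (y ℕ.+ 2))) ≡ (8 ℕ.+ (x ℕ.+ 17)) ℕ.+ y ℕ.+ 2
        arith = solve-∀

        finish : ∀ {σ s} → S.Frame σ s → Yields w (17 ℕ.+ loopCost N t b) (tally ∷ loop ∷ [] , s)
          (S.select (decision (nat σ verdict)) (cleared w b r p l u) (value w b r p (suc l) u))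
        finish {σ} {s} fr@(S.frame ((sz , st , ve , ro , po , cu , le , bu , mo , on , ac , fa) , _ , _ , natsFresh , numsFresh)) =
          follow 4 _ ≡.refl (decide (nat σ verdict) (S.nat≡ fr verdict))
          where
          spent : Store
          spent = setNat budget 0 (nat s budget ℕ.∸ nat s one)
            (setNat scratch 0 (nats s (virtual verdict) (nat s budget)) s)

          ready-with : ∀ {i l′} → i ≡ l′ → Ready r p l′ b u (setNat level 0 i spent)
          ready-with eq = ready
            (sz , st , ve , ro , po , cu , eq , ≡.cong₂ ℕ._∸_ bu on , mo , on , ac , fa)
            (λ g′ g′≤b → natsFresh g′ (ℕ.s≤s g′≤b)) (λ g′ g′≤b → numsFresh g′ (ℕ.s≤s g′≤b))

          decide : ∀ v → nats s (virtual verdict) (nat s budget) ≡ v → Yields w _ _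
            (S.select (decision v) (cleared w b r p l u) (value w b r p (suc l) u))
          decide zero eq = later 13 2 (ℕ.≤ᵇ⇒≤ 2 13 _) (yields-if 0 eq (follow 1 _ ≡.refl
            (yields-loop b (ℕ.<⇒≤ b<G)
              (ready-with (≡.trans (≡.cong₂ ℕ._+_ le on) (ℕ.+-comm (suc l) 1))))))
          decide (suc v) eq = yields-if (suc v) eq (follow 2 _ ≡.refl (clear l le))
            where
            clear : ∀ l → nat s level ≡ suc l → Yields w _ _ (cleared w b r p l u)
            clear zero le = yields-if 0 (≡.cong₂ ℕ._∸_ le on)
              (yields-advance b (ℕ.<⇒≤ b<G) (ready-with (≡.cong₂ ℕ._∸_ le on)))
            clear (suc l) le = later 10 2 (ℕ.≤ᵇ⇒≤ 2 10 _) (yields-if (suc l) (≡.cong₂ ℕ._∸_ le on) (follow 1 _ ≡.refl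
              (yields-loop b (ℕ.<⇒≤ b<G) (ready-with (≡.cong₂ ℕ._∸_ le on)))))

      yields-advance : ∀ {w} b {r p l u s} → b ℕ.< G → Ready r p l b u s →
        Yields w (9 ℕ.+ loopCost N t b) (advanceState ∷ loop ∷ [] , s) (advance w b r p u)
      yields-advance b {r} {suc p} {u = u} b<G
        (ready (sz , st , ve , ro , po , cu , le , bu , mo , on , ac , fa) natsBlank numsBlank) =
        later 9 6 (ℕ.≤ᵇ⇒≤ 6 9 _) (yields-if (suc p) po (follow 3 _ ≡.refl (yields-sample u cu λ v → follow 1 _ ≡.refl
          (yields-loop b b<G (ready
            (sz , st , ve , ro , ≡.cong₂ ℕ._∸_ po on , ≡.refl , ≡.refl , bu , mo , on , ac , fa) natsBlank numsBlank)))))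
      yields-advance b {suc r} {zero} b<G
        (ready (sz , st , ve , ro , po , cu , le , bu , mo , on , ac , fa) natsBlank numsBlank) =
        yields-if 0 po (yields-if (suc r) ro (follow 5 _ ≡.refl (yields-uniform n sz λ v → follow 1 _ ≡.refl
          (yields-loop b b<G (ready
            (sz , st , ve , ≡.cong₂ ℕ._∸_ ro on , ≡.cong₂ ℕ._+_ st st , ≡.refl , ≡.refl , bu , mo , on , ac , fa)
            natsBlank numsBlank)))))
      yields-advance {w} b {zero} {zero} b<G
        (ready (sz , st , ve , ro , po , cu , le , bu , mo , on , ac , fa) natsBlank numsBlank) =
        yields-later (ℕ.≤-trans (ℕ.m≤m+n 7 2) (ℕ.m≤m+n 9 (loopCost N t b)))
          (yields-if 0 po (yields-if 0 ro (follow 3 _ ≡.refl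
            (yields-while-done ≡.refl (yields-halt 1 ≡.refl)))))

  -- Counting up to the number K of rounds

  module Setup (K : ℕ)
    (below : ∀ i → i ℕ.< K → fromℕ i * (ε * ε) < fromℕ 8)
    (enough : ¬ fromℕ K * (ε * ε) < fromℕ 8)
    where

    private
      G : ℕ
      G = suc (testBudget K t)

    open Loop G

    -- The state of the machine when i rounds have been counted.
    record Counting (i : ℕ) (s : Store) : Set c where
      constructor counting
      field
        registers : nat s size ≡ n × nat s steps ≡ t × nat s verdict ≡ 0 × nat s rounds ≡ i × nat s position ≡ 0 ×
          nat s current ≡ 0 × nat s level ≡ 0 × nat s one ≡ 1 ×
          num s accuracy ≡ ε × num s square ≡ ε * ε × num s bound ≡ fromℕ 8
        natsBlank : ∀ x j → nats s (virtual x) j ≡ 0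
        numsBlank : ∀ x j → nums s (virtual x) j ≡ 0#

    private
      truth-yes : ∀ {a} {A : Set a} (d : Dec A) → A → truth d ≡ 1
      truth-yes (yes _) a = ≡.refl
      truth-yes (no ¬a) a = contradiction a ¬a

      truth-no : ∀ {a} {A : Set a} (d : Dec A) → ¬ A → truth d ≡ 0
      truth-no (yes a) ¬a = contradiction a ¬a
      truth-no (no _)  ¬a = ≡.refl

    yields-countRounds : ∀ {w k L v} m {i s} → i ℕ.+ m ≡ K → Counting i s →
      nat s scratch ≡ truth (fromℕ i * (ε * ε) <? fromℕ 8) →
      (∀ {s′} → Counting K s′ → Yields w k (L , s′) v) →
      Yields w (m ℕ.* 8 ℕ.+ suc k) (countRounds ∷ L , s) v
    yields-countRounds zero {i} eq counting-i flag after with ≡.trans (≡.sym (ℕ.+-identityʳ i)) eq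
    ... | ≡.refl = yields-while-done (≡.trans flag (truth-no (_ <? _) enough)) (after counting-i)
    yields-countRounds (suc m) {i} {s} eq
      (counting (sz , st , ve , ro , po , cu , le , on , ac , sq , bo) natsBlank numsBlank) flag after =
      yields-while-again 0 (≡.trans flag (truth-yes (_ <? _) (below i (≡.subst (i ℕ.<_) eq (ℕ.m<m+n i (ℕ.s≤s ℕ.z≤n))))))
        (follow 7 _ ≡.refl (yields-countRounds m (≡.trans (≡.sym (ℕ.+-suc i m)) eq)
          (counting (sz , st , ve , ro′ , po , cu , le , on , ac , sq , bo) natsBlank numsBlank)
          (≡.cong₂ (λ x y → truth (x <? y)) (≡.cong₂ _*_ (≡.cong fromℕ ro′) sq) bo) after))
      where
      ro′ : nat s rounds ℕ.+ nat s one ≡ suc i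
      ro′ = ≡.trans (≡.cong₂ ℕ._+_ ro on) (ℕ.+-comm i 1)

    yields-mixingTest : ∀ {w} u → toℕ u ≡ 0 → δ ≡ fromℕ 1 / fromℕ (6 ℕ.* t) →
      Yields w (testCost K N t) (testStart (mixingTest P) n t ε) (advance w (testBudget K t) K 0 u)
    yields-mixingTest {w} u u≡0 δ≡ = follow 16 _ ≡.refl
      (yields-countRounds K ≡.refl
        (counting (≡.refl , ≡.refl , ≡.refl , ≡.refl , ≡.refl , ≡.refl , ≡.refl , ≡.refl , ≡.refl , ≡.refl , ≡.refl)
                  (λ _ _ → ≡.refl) (λ _ _ → ≡.refl))
        ≡.refl start)
      where
      start : ∀ {s} → Counting K s →
        Yields w (22 ℕ.+ (9 ℕ.+ loopCost N t (testBudget K t))) (prepare ∷ (advanceState ⨾ mainLoop P) ∷ [] , s)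
               (advance w (testBudget K t) K 0 u)
      start {s} (counting (sz , st , ve , ro , po , cu , le , on , ac , sq , bo) natsBlank numsBlank) =
        follow 22 _ ≡.refl (yields-advance (testBudget K t) (ℕ.n<1+n _) (ready
          (sz , st , ve , ro , po , ≡.trans cu (≡.sym u≡0) , le , bu , ≡.cong₂ ℕ._+_ on bu , on , ac ,
           ≡.trans (≡.cong₂ _/_ (≡.cong fromℕ on) (≡.cong (λ t → fromℕ (6 ℕ.* t)) st)) (≡.sym δ≡))
          (λ _ _ x j → natsBlank x _) (λ _ _ x j → numsBlank x _)))
        where
        bu : 20 ℕ.* (nat s rounds ℕ.* (nat s one ℕ.+ (nat s steps ℕ.+ nat s steps))) ≡ testBudget K t
        bu = ≡.cong (20 ℕ.*_) (≡.cong₂ ℕ._*_ ro (≡.cong₂ ℕ._+_ on (≡.cong₂ ℕ._+_ st st)))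

-- The running time

testBudget≤ : ∀ K t .{{_ : NonZero t}} → testBudget K t ℕ.≤ 60 ℕ.* (K ℕ.* t)
testBudget≤ K (suc t) = ℕ.≤-trans (ℕ.m≤m+n _ (20 ℕ.* (K ℕ.* t))) (ℕ.≤-reflexive (certificate K t))
  where
  certificate : ∀ K t → 20 ℕ.* (K ℕ.* suc (suc t ℕ.+ suc t)) ℕ.+ 20 ℕ.* (K ℕ.* t) ≡ 60 ℕ.* (K ℕ.* suc t)
  certificate = solve-∀

iterationCost≤ : ∀ N t .{{_ : NonZero N}} .{{_ : NonZero t}} → iterationCost N t ℕ.≤ 49 ℕ.* (N ℕ.* t)
iterationCost≤ (suc N) (suc t) =
  ℕ.≤-trans (ℕ.m≤m+n _ (45 ℕ.* t ℕ.+ 25 ℕ.* N ℕ.+ 45 ℕ.* (N ℕ.* t))) (ℕ.≤-reflexive (certificate N t))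
  where
  certificate : ∀ N t → 8 ℕ.+ (suc N ℕ.* (20 ℕ.+ suc t ℕ.* 4) ℕ.+ 17)
    ℕ.+ (45 ℕ.* t ℕ.+ 25 ℕ.* N ℕ.+ 45 ℕ.* (N ℕ.* t)) ≡ 49 ℕ.* (suc N ℕ.* suc t)
  certificate = solve-∀

-- The constant is 50 + 8 + 60 * 49.
testCost≤ : ∀ K N t .{{_ : NonZero K}} .{{_ : NonZero N}} .{{_ : NonZero t}} →
  testCost K N t ℕ.≤ 2998 ℕ.* (K ℕ.* (t ℕ.* t) ℕ.* N)
testCost≤ K N t = begin
  testCost K N t
    ≡⟨ collect (K ℕ.* 8) (testBudget K t ℕ.* iterationCost N t) ⟩
  50 ℕ.+ K ℕ.* 8 ℕ.+ testBudget K t ℕ.* iterationCost N t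
    ≤⟨ ℕ.+-mono-≤ (ℕ.+-mono-≤ (ℕ.*-monoʳ-≤ 50 1≤X) (ℕ.*-monoˡ-≤ 8 K≤X))
                  (ℕ.*-mono-≤ (testBudget≤ K t) (iterationCost≤ N t)) ⟩
  50 ℕ.* X ℕ.+ X ℕ.* 8 ℕ.+ 60 ℕ.* (K ℕ.* t) ℕ.* (49 ℕ.* (N ℕ.* t))
    ≡⟨ total K N t ⟩
  2998 ℕ.* X ∎
  where
  open ℕ.≤-Reasoning

  X : ℕ
  X = K ℕ.* (t ℕ.* t) ℕ.* N

  instance
    tt-nonZero : NonZero (t ℕ.* t)
    tt-nonZero = ℕ.m*n≢0 t t

    Ktt-nonZero : NonZero (K ℕ.* (t ℕ.* t))
    Ktt-nonZero = ℕ.m*n≢0 K (t ℕ.* t)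

  K≤X : K ℕ.≤ X
  K≤X = ℕ.≤-trans (ℕ.m≤m*n K (t ℕ.* t)) (ℕ.m≤m*n (K ℕ.* (t ℕ.* t)) N)

  1≤X : 1 ℕ.≤ X
  1≤X = ℕ.≤-trans (ℕ.>-nonZero⁻¹ K) K≤X

  collect : ∀ x y → 16 ℕ.+ (x ℕ.+ suc (22 ℕ.+ (9 ℕ.+ (y ℕ.+ 2)))) ≡ 50 ℕ.+ x ℕ.+ y
  collect = solve-∀

  total : ∀ K N t → 50 ℕ.* (K ℕ.* (t ℕ.* t) ℕ.* N) ℕ.+ K ℕ.* (t ℕ.* t) ℕ.* N ℕ.* 8
    ℕ.+ 60 ℕ.* (K ℕ.* t) ℕ.* (49 ℕ.* (N ℕ.* t)) ≡ 2998 ℕ.* (K ℕ.* (t ℕ.* t) ℕ.* N)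
  total = solve-∀

-- Correctness

-- The least number at which a decidable property fails, if it fails anywhere.
least-failure : ∀ {p} {P : ℕ → Set p} → (∀ i → Dec (P i)) → ∀ m → ¬ P m →
  ∃ λ k → (∀ i → i ℕ.< k → P i) × ¬ P k
least-failure P? zero ¬P0 = 0 , (λ _ ()) , ¬P0
least-failure P? (suc m) ¬Pm with P? 0
... | no ¬P0 = 0 , (λ _ ()) , ¬P0
... | yes P0 with least-failure (λ i → P? (suc i)) m ¬Pm
...   | k , below , ¬Pk = suc k , (λ { zero _ → P0 ; (suc i) (ℕ.s≤s i<k) → below i i<k }) , ¬Pk

first-state : ∀ n .{{_ : NonZero n}} → ∃ λ (u : Fin n) → toℕ u ≡ 0
first-state (suc n) = zero , ≡.refl

module Parameters {c ℓ₁ ℓ₂} (F : ArchimedeanField c ℓ₁ ℓ₂) where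

  open OrderedField F

  ⁻¹-positive : ∀ {x} → 0# < x → 0# < x ⁻¹
  ⁻¹-positive {x} 0<x = ⁻¹-nonNegative 0<x , λ 0≈x⁻¹ → 1≉0
    (trans (sym (⁻¹-inverseˡ 0<x)) (trans (*-congʳ (sym 0≈x⁻¹)) (zeroˡ x)))

  module _ (ε : Carrier) (0<ε : 0# < ε) where

    Insufficient : ℕ → Set _
    Insufficient i = fromℕ i * (ε * ε) < fromℕ 8

    -- The number of rounds is the least K with K ε² at least 8.
    rounds-needed : ∃ λ K → (∀ i → i ℕ.< K → Insufficient i) × ¬ Insufficient K
    rounds-needed with archimedean (fromℕ 8 / (ε * ε))
    ... | m , 8/ε²≤m = least-failure (λ i → fromℕ i * (ε * ε) <? fromℕ 8) m λ mε²<8 → <⇒≱ mε²<8 (begin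
      fromℕ 8                      ≈⟨ *-/-cancel (fromℕ 8) 0<ε² ⟨
      ε * ε * (fromℕ 8 / (ε * ε))  ≤⟨ *-monoʳ-≤ (<⇒≤ 0<ε²) 8/ε²≤m ⟩
      ε * ε * fromℕ m              ≈⟨ *-comm _ _ ⟩
      fromℕ m * (ε * ε)            ∎)
      where
      0<ε² : 0# < ε * ε
      0<ε² = *-positive 0<ε 0<ε

    rounds-nonZero : ∀ K → ¬ Insufficient K → NonZero K
    rounds-nonZero zero    enough = contradiction
      (≤-respˡ (sym (zeroˡ (ε * ε))) (fromℕ-nonNegative 8) ,
       λ 0≈8 → fromℕ≉0 8 (trans (sym 0≈8) (zeroˡ (ε * ε)))) enough
    rounds-nonZero (suc K) enough = _

    -- One round fewer does not suffice, and one round adds ε², at most 4.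
    rounds≤ : ∀ K → (∀ i → i ℕ.< K → Insufficient i) → ε ≤ fromℕ 2 → fromℕ K * (ε * ε) ≤ fromℕ 12
    rounds≤ zero    below ε≤2 = ≤-respˡ (sym (zeroˡ (ε * ε))) (fromℕ-nonNegative 12)
    rounds≤ (suc K) below ε≤2 = begin
      (1# + fromℕ K) * (ε * ε)
        ≈⟨ solve 2 (λ k e → (con (+ 1) :+ k) :* (e :* e) := e :* e :+ k :* (e :* e)) refl (fromℕ K) ε ⟩
      ε * ε + fromℕ K * (ε * ε)
        ≤⟨ +-mono-≤ (*-mono-≤ (<⇒≤ 0<ε) (fromℕ-nonNegative 2) ε≤2 ε≤2) (<⇒≤ (below K (ℕ.n<1+n K))) ⟩
      fromℕ 2 * fromℕ 2 + fromℕ 8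
        ≈⟨ solve 0 (con (+ 2) :* con (+ 2) :+ con (+ 8) := con (+ 12)) refl ⟩
      fromℕ 12 ∎

    time-bound : ∀ a K N t → fromℕ K * (ε * ε) ≤ fromℕ 12 →
      fromℕ (a ℕ.* (K ℕ.* (t ℕ.* t) ℕ.* N)) ≤ fromℕ (a ℕ.* 12) * (1# / ε ^ 2) * fromℕ t ^ 2 * fromℕ N
    time-bound a K N t Kε²≤12 = begin
      fromℕ (a ℕ.* (K ℕ.* (t ℕ.* t) ℕ.* N))
        ≈⟨ trans (fromℕ-* a _) (*-congˡ (trans (fromℕ-* (K ℕ.* (t ℕ.* t)) N) (*-congʳ (trans (fromℕ-* K (t ℕ.* t)) (*-congˡ (fromℕ-* t t)))))) ⟩
      fromℕ a * (fromℕ K * (fromℕ t * fromℕ t) * fromℕ N)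
        ≤⟨ *-monoʳ-≤ (fromℕ-nonNegative a) (*-monoˡ-≤ (fromℕ-nonNegative N)
             (*-monoˡ-≤ (*-nonNegative (fromℕ-nonNegative t) (fromℕ-nonNegative t)) K≤)) ⟩
      fromℕ a * (fromℕ 12 / ε ^ 2 * (fromℕ t * fromℕ t) * fromℕ N)
        ≈⟨ solve 5 (λ a b i t N → a :* (b :* i :* (t :* t) :* N) :=
              a :* b :* (con (+ 1) :* i) :* (t :* (t :* con (+ 1))) :* N) refl (fromℕ a) (fromℕ 12) ((ε ^ 2) ⁻¹) (fromℕ t) (fromℕ N) ⟩
      fromℕ a * fromℕ 12 * (1# / ε ^ 2) * fromℕ t ^ 2 * fromℕ N
        ≈⟨ *-congʳ (*-congʳ (*-congʳ (fromℕ-* a 12))) ⟨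
      fromℕ (a ℕ.* 12) * (1# / ε ^ 2) * fromℕ t ^ 2 * fromℕ N ∎
      where
      K≤ : fromℕ K ≤ fromℕ 12 / ε ^ 2
      K≤ = ≤-/ (*-positive 0<ε (*-positive 0<ε 0<1))
        (≤-respˡ (solve 2 (λ k e → k :* (e :* e) := e :* (e :* con (+ 1)) :* k) refl (fromℕ K) ε) Kε²≤12)

  module _ (t : ℕ) .{{_ : NonZero t}} where

    private instance
      6t-nonZero : NonZero (6 ℕ.* t)
      6t-nonZero = ℕ.m*n≢0 6 t

    -- The error allowed to the tester, in the form in which the program computes
    -- it.
    error : Carrier
    error = fromℕ 1 / fromℕ (6 ℕ.* t)

    error≈ : error ≈ 1# / fromℕ (6 ℕ.* t)
    error≈ = *-congʳ fromℕ-1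

    0<error : 0# < error
    0<error = *-positive (fromℕ-positive 1) (⁻¹-positive (fromℕ-positive (6 ℕ.* t)))

    6error≤1 : fromℕ 6 * error ≤ 1#
    6error≤1 = begin
      fromℕ 6 * error          ≤⟨ *-monoˡ-≤ (<⇒≤ 0<error) (fromℕ-mono-≤ {6} {6 ℕ.* t} (ℕ.m≤m*n 6 t)) ⟩
      fromℕ (6 ℕ.* t) * error  ≈⟨ *-/-cancel (fromℕ 1) (fromℕ-positive (6 ℕ.* t)) ⟩
      fromℕ 1                  ≈⟨ fromℕ-1 ⟩
      1#                       ∎

    error<1 : error < 1#
    error<1 = ≰⇒> λ 1≤error → <⇒≱ (fromℕ-positive 5) (0≤-⇒≤ (begin
      0#                       ≤⟨ ≤⇒0≤- 6error≤1 ⟩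
      1# - fromℕ 6 * error     ≤⟨ minus-monoʳ-≤ 1# (*-monoʳ-≤ (fromℕ-nonNegative 6) 1≤error) ⟩
      1# - fromℕ 6 * 1#        ≈⟨ solve 0 (con (+ 1) :- con (+ 6) :* con (+ 1) := con (+ 0) :- con (+ 5)) refl ⟩
      0# - fromℕ 5             ∎))

    -- One of two complementary probabilities is small when the other is large.
    small : ∀ {x y} → x + y ≈ 1# → 1# - error ≤ x → fromℕ 6 * y ≤ 1#
    small {x} {y} x+y≈1 1-error≤x = ≤-trans (*-monoʳ-≤ (fromℕ-nonNegative 6) y≤error) 6error≤1
      where
      y≤error : y ≤ error
      y≤error = ≤-by (x - (1# - error)) (≤⇒0≤- 1-error≤x)
        (trans (solve 3 (λ x y e → e := y :+ (x :- ((x :+ y) :- e))) refl x y error)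
               (+-congˡ (+-congˡ (-‿cong (+-congʳ x+y≈1)))))

module Correctness {c ℓ₁ ℓ₂} (F : ArchimedeanField c ℓ₁ ℓ₂) (P : Command)
  (f : ArchimedeanField.Carrier F → ArchimedeanField.Carrier F)
  (T : ℕ → ArchimedeanField.Carrier F → ArchimedeanField.Carrier F → ℕ)
  (tester : Testing.IsDistanceTester F P f T)
  {n d : ℕ} (t : ℕ) .{{_ : NonZero n}} .{{_ : NonZero t}}
  (ε : ArchimedeanField.Carrier F) (0<ε : ArchimedeanField._<_ F (ArchimedeanField.0# F) ε)
  (M : Testing.MarkovChain F n d) where

  open OrderedField F
  open Testing F
  open Chains F
  open Machine F
  open Parameters F
  open IsDistanceTester tester
  open Tested F M t
  open Closeness F using (module Probes; module Far)
  open Runs (nextNode M) (stochastic M)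

  -- The error, the running time of the tester, the number of rounds, and the
  -- running time of the test.
  δ : Carrier
  δ = error t

  N : ℕ
  N = T n ε δ

  P-halts : HaltsWithin 2 n N (testerStart P n ε δ)
  P-halts = halts n ε δ 0<ε (0<error t) (error<1 t)

  N-nonZero : NonZero N
  N-nonZero = positive N P-halts
    where
    positive : ∀ k → HaltsWithin 2 n k (testerStart P n ε δ) → NonZero k
    positive zero    ()
    positive (suc k) _  = _

  open Test F P M t ε δ N P-halts

  K : ℕ
  K = proj₁ (rounds-needed ε 0<ε)

  below : ∀ i → i ℕ.< K → Insufficient ε 0<ε i
  below = proj₁ (proj₂ (rounds-needed ε 0<ε))

  enough : ¬ Insufficient ε 0<ε K
  enough = proj₂ (proj₂ (rounds-needed ε 0<ε))

  K-nonZero : NonZero K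
  K-nonZero = rounds-nonZero ε 0<ε K enough

  -- The register of the present state is initially 0. The first round replaces
  -- it before any state is examined.
  start : Fin n
  start = proj₁ (first-state n)

  time : ℕ
  time = 2998 ℕ.* (K ℕ.* (t ℕ.* t) ℕ.* N)

  yields-verdict : ∀ w → Yields w time (testStart (mixingTest P) n t ε) (advance w (testBudget K t) K 0 start)
  yields-verdict w = yields-later (testCost≤ K N t {{K-nonZero}} {{N-nonZero}})
    (Setup.yields-mixingTest K below enough start (proj₂ (first-state n)) ≡.refl)

  mixingTest-halts : HaltsWithin n n time (testStart (mixingTest P) n t ε)
  mixingTest-halts = Yields.halts (yields-verdict accept)

  time≤ : ε ≤ fromℕ 2 →
    fromℕ time ≤ fromℕ (2998 ℕ.* 12) * (1# / ε ^ 2) * fromℕ t ^ 2 * fromℕ (T n ε (1# / fromℕ (6 ℕ.* t)))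
  time≤ ε≤2 = ≤-respʳ (*-congˡ (reflexive (≡.cong fromℕ (T-cong n refl (error≈ t)))))
    (time-bound ε 0<ε 2998 K N t (rounds≤ ε 0<ε K below ε≤2))

  accepts-mixing : Mixing M (f ε) t →
    fromℕ 2 / fromℕ 3 ≤ Pr (nextNode M) accept time (testStart (mixingTest P) n t ε)
  accepts-mixing mixing = ≤-trans
    (Accepting.accepting (λ u → small t (accepted+rejected≈1 u)
        (accepts n ε δ 0<ε (0<error t) (error<1 t) _ _ (probe-isDistribution u) s-isDistribution
          (mixing⇒probe-near mixing u)))
      K start (ℕ.>-nonZero⁻¹ K {{K-nonZero}}))
    (Yields.bound (yields-verdict accept))
    where open Probes M t

  rejects-far :
    (∀ (M̃ : MarkovChain n d) → Mixing M̃ (fromℕ 4 * ε) (2 ℕ.* t) →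
     ¬ Close t M M̃ (fromℕ 2 * ε) (fromℕ 101 / fromℕ 100 * ε)) →
    fromℕ 2 / fromℕ 3 ≤ Pr (nextNode M) reject time (testStart (mixingTest P) n t ε)
  rejects-far far = ≤-trans
    (Rejecting.rejecting Bad bad?
      (λ {u} bad → small t (trans (+-comm _ _) (accepted+rejected≈1 u))
        (rejects n ε δ 0<ε (0<error t) (error<1 t) _ _ (probe-isDistribution u) s-isDistribution bad))
      ε K (testBudget K t) start (far⇒risky far) (≮⇒≥ enough))
    (Yields.bound (yields-verdict reject))
    where open Far M t ε 0<ε

theorem35 : ∀ {c ℓ₁ ℓ₂} (F : ArchimedeanField c ℓ₁ ℓ₂) →
    let open ArchimedeanField F
        open Testing F
    in
    (P : Command) (f : Carrier → Carrier) (T : ℕ → Carrier → Carrier → ℕ) →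
    IsDistanceTester P f T →
    Σ Command λ Q → Σ ℕ λ C →
    ∀ (n d t : ℕ) .{{_ : NonZero n}} .{{_ : NonZero t}} (ε : Carrier) → 0# < ε →
    (M : MarkovChain n d) →
    Σ ℕ λ k →
      HaltsWithin n n k (testStart Q n t ε)
      × (ε ≤ fromℕ 2 →
         fromℕ k ≤ fromℕ C * (1# / ε ^ 2) * fromℕ t ^ 2
                   * fromℕ (T n ε (1# / fromℕ (6 ℕ.* t))))
      × (Mixing M (f ε) t →
         fromℕ 2 / fromℕ 3 ≤ Pr (nextNode M) accept k (testStart Q n t ε))
      × ((∀ (M̃ : MarkovChain n d) →
          Mixing M̃ (fromℕ 4 * ε) (2 ℕ.* t) →
          ¬ Close t M M̃ (fromℕ 2 * ε) (fromℕ 101 / fromℕ 100 * ε)) →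
         fromℕ 2 / fromℕ 3 ≤ Pr (nextNode M) reject k (testStart Q n t ε))
theorem35 F P f T tester = mixingTest P , 2998 ℕ.* 12 , λ n d t ε 0<ε M →
  let open Correctness F P f T tester t ε 0<ε M
  in time , mixingTest-halts , time≤ , accepts-mixing , rejects-far
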